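{- For any finite poset $P$ and finite multiset $\beta$ of elements of $P$, $F_{W_\beta}(\mathbf{x})=\omega X^\beta_{\mathrm{inc}(P)}(\mathbf{x})$. If moreover $P$ is a natural unit interval order, then $F_{W_\beta(t)}(\mathbf{x})=\omega X^\beta_{\mathrm{inc}(P)}(\mathbf{x},t)$.
   Context: Write $a<_Pb$ for strict order, $a\sim_Pb$ for incomparable or equal. For a word $w$, $\mathrm{Des}_P(w)=\{i:w_{i+1}<_Pw_i\}$; $Q_D(\mathbf{x})=\sum x_{i_1}\cdots x_{i_n}$ over $i_1\le\cdots\le i_n$ with $i_j<i_{j+1}$ for $j\in D$; for $\gamma=\sum_w\gamma_ww$ (coefficients in $\mathbb{Z}$ or $\mathbb{Q}(t)$), $F_\gamma=\sum_w\gamma_wQ_{\mathrm{Des}_P(w)}$. $W_\beta=\sum w$ over words of content (multiset of letters) $\beta$; $\omega$ is the involution of symmetric functions with $\omega h_\lambda=e_\lambda$. A natural unit interval order is a poset $P$ with a total order $<$ such that $a<_Pb\Rightarrow a<b$ and ($a\sim_Pb$, $b\sim_Pc$, $a<_Pc$) $\Rightarrow a<b<c$. $\mathrm{inv}_P(w)=\#\{i<j: w_i>w_j, w_i\sim_Pw_j\}$ and $W_\beta(t)=\sum t^{\mathrm{inv}_P(w)}w$ over words of content $\beta$. If $a$ has multiplicity $n_a$ in $\beta$, $P[\beta]$ is the poset with elements $a^{(1)},\dots,a^{(n_a)}$ ($a\in P$) and $a^{(i)}<b^{(j)}$ iff $a<_Pb$; for a natural unit interval order it carries the total order $a^{(1)}<\cdots<a^{(n_a)}$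 and $a^{(i)}<b^{(j)}$ whenever $a<b$. $X^\beta_{\mathrm{inc}(P)}(\mathbf{x})=\sum_\kappa\prod_{b\in P[\beta]}x_{\kappa(b)}$, over maps $\kappa:P[\beta]\to\mathbb{Z}_{\ge1}$ with $\kappa(b)\ne\kappa(b')$ whenever $b\ne b'$ are incomparable in $P[\beta]$, and $\kappa(a^{(1)})>\cdots>\kappa(a^{(n_a)})$ for each $a$. $X^\beta_{\mathrm{inc}(P)}(\mathbf{x},t)$ is the same sum weighted by $t^{\mathrm{asc}(\kappa)}$, where $\mathrm{asc}(\kappa)=\#\{(b,b'): b<b',\ b,b'\text{ incomparable in }P[\beta],\ \kappa(b)<\kappa(b')\}$. -}

module Defs where

open import Level using (Level; _⊔_) renaming (suc to lsuc)
open import Algebra.Bundles using (CommutativeRing)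
open import Data.Nat using (ℕ; zero; suc; _∸_; _≥_; NonZero)
import Data.Nat as ℕ
open import Data.Fin using (Fin; zero; suc; toℕ)
import Data.Fin as Fin
open import Data.Fin.Properties using (all?; any?; ∀-cons)
import Data.Fin.Properties as Finₚ
open import Data.Fin.Subset using (Subset; _∈_; ⊤; ⊥)
open import Data.Fin.Subset.Properties using (_∈?_)
open import Data.List using (List; []; _∷_; map; concatMap; filter; length; foldr; allFin; upTo; cartesianProduct; cartesianProductWith)
open import Data.List.Relation.Unary.All using (All)
open import Data.List.Relation.Unary.Linked using (Linked)
open import Data.Vec using (Vec; []; _∷_; lookup; tabulate; sum)
import Data.Vec.Properties as Vecₚ
open import Data.Product using (Σ; ∃; _×_; _,_; proj₁; proj₂)
import Data.Product.Properties as Productₚ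
open import Data.Sum using (_⊎_)
open import Relation.Binary.Core using (Rel)
open import Relation.Binary.Definitions using (Decidable; DecidableEquality)
open import Relation.Binary.Structures using (IsDecStrictPartialOrder; IsStrictTotalOrder)
open import Relation.Binary.PropositionalEquality using (_≡_; _≢_)
open import Relation.Nullary using (Dec; ¬_; does)
open import Relation.Nullary.Decidable using (_×-dec_; _⊎-dec_; _→-dec_; ¬?)

-- All dependent functions on Fin n whose value at i is drawn from xs i.
allFunctions : ∀ {a n} {A : Fin n → Set a} → (∀ i → List (A i)) → List (∀ i → A i)
allFunctions {n = zero}          xs = (λ ()) ∷ []
allFunctions {n = suc n} {A = A} xs =
  cartesianProductWith (∀-cons {P = A}) (xs zero) (allFunctions (λ i → xs (suc i)))

-- The number of times f takes each value on the list bs; when the values index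
-- variables, this is the exponent vector of the monomial ∏_{b ∈ bs} x_{f b}.
content : ∀ {b} {B : Set b} {m} → List B → (B → Fin m) → Vec ℕ m
content bs f = tabulate λ c → length (filter (λ b → f b Fin.≟ c) bs)

_≟ᵛ_ : ∀ {m} → DecidableEquality (Vec ℕ m)
_≟ᵛ_ = Vecₚ.≡-dec ℕ._≟_

Word : ℕ → Set
Word k = Σ ℕ λ n → Fin n → Fin k

-- Finite posets are given by their strict order on the underlying set Fin size.
record FinitePoset (p : Level) : Set (lsuc p) where
  infix 4 _<ₚ_
  field
    size                    : ℕ
    _<ₚ_                    : Rel (Fin size) p
    isDecStrictPartialOrder : IsDecStrictPartialOrder _≡_ _<ₚ_

  open IsDecStrictPartialOrder isDecStrictPartialOrder public
    using () renaming (_<?_ to _<ₚ?_)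

  infix 4 _∼ₚ_ _∼ₚ?_

  -- Incomparable or equal.
  _∼ₚ_ : Rel (Fin size) p
  a ∼ₚ b = ¬ (a <ₚ b) × ¬ (b <ₚ a)

  _∼ₚ?_ : Decidable _∼ₚ_
  a ∼ₚ? b = ¬? (a <ₚ? b) ×-dec ¬? (b <ₚ? a)

record NaturalUnitIntervalOrder {p} (q : Level) (P : FinitePoset p) : Set (p ⊔ lsuc q) where
  open FinitePoset P using (size; _<ₚ_; _∼ₚ_)
  infix 4 _<_
  field
    _<_                : Rel (Fin size) q
    isStrictTotalOrder : IsStrictTotalOrder _≡_ _<_
    <ₚ⇒<               : ∀ {a b} → a <ₚ b → a < b
    ∼ₚ-between         : ∀ {a b c} → a ∼ₚ b → b ∼ₚ c → a <ₚ c → (a < b) × (b < c)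

  open IsStrictTotalOrder isStrictTotalOrder public using (_<?_)

module _ {p} (P : FinitePoset p) where
  open FinitePoset P

  -- A multiset is its vector of multiplicities.
  Multiset : Set
  Multiset = Vec ℕ size

  -- Position i (counted from 0) is a descent if there is a next position j = i + 1
  -- with w_j <ₚ w_i.
  Des : ((n , w) : Word size) → Subset n
  Des (n , w) = tabulate λ i →
    does (any? λ j → (toℕ j ℕ.≟ suc (toℕ i)) ×-dec (w j <ₚ? w i))

  wordsOfContent : Multiset → List (Word size)
  wordsOfContent β =
    map (sum β ,_)
      (filter (λ w → content (allFin (sum β)) w ≟ᵛ β) (allFunctions λ _ → allFin size))

  -- The underlying set of P[β]; (a , i) is the copy a^(i+1) of a.
  P[_] : Multiset → Set
  P[ β ] = Σ (Fin size) λ a → Fin (lookup β a)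

  module _ {β : Multiset} where

    _≟ᵇ_ : DecidableEquality P[ β ]
    _≟ᵇ_ = Productₚ.≡-dec Fin._≟_ Fin._≟_

    _<ᵇ_ : Rel P[ β ] p
    b <ᵇ b′ = proj₁ b <ₚ proj₁ b′

    Incomparable : Rel P[ β ] p
    Incomparable b b′ = b ≢ b′ × ¬ (b <ᵇ b′) × ¬ (b′ <ᵇ b)

    incomparable? : Decidable Incomparable
    incomparable? b b′ =
      ¬? (b ≟ᵇ b′) ×-dec ¬? (proj₁ b <ₚ? proj₁ b′) ×-dec ¬? (proj₁ b′ <ₚ? proj₁ b)

  elements : (β : Multiset) → List P[ β ]
  elements β = concatMap (λ a → map (a ,_) (allFin (lookup β a))) (allFin size)

  -- Maps P[β] → {1,…,m}, in curried form.
  Colouring : Multiset → ℕ → Set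
  Colouring β m = (a : Fin size) → Fin (lookup β a) → Fin m

  module _ {β : Multiset} {m : ℕ} where

    colour : Colouring β m → P[ β ] → Fin m
    colour κ (a , i) = κ a i

    Admissible : Colouring β m → Set p
    Admissible κ =
      (∀ a i a′ i′ → Incomparable {β} (a , i) (a′ , i′) → κ a i ≢ κ a′ i′) ×
      (∀ a i j → i Fin.< j → κ a j Fin.< κ a i)

    admissible? : (κ : Colouring β m) → Dec (Admissible κ)
    admissible? κ =
      (all? λ a → all? λ i → all? λ a′ → all? λ i′ →
        incomparable? {β} (a , i) (a′ , i′) →-dec ¬? (κ a i Fin.≟ κ a′ i′)) ×-dec
      (all? λ a → all? λ i → all? λ j →
        (i Fin.<? j) →-dec (κ a j Fin.<? κ a i))

  -- The admissible maps κ : P[β] → {1,…,m} with ∏_b x_{κ(b)} = x^α.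
  colourings : (β : Multiset) {m : ℕ} → Vec ℕ m → List (Colouring β m)
  colourings β {m} α =
    filter (λ κ → admissible? {β} κ ×-dec (content (elements β) (colour {β} κ) ≟ᵛ α))
      (allFunctions λ a → allFunctions λ i → allFin m)

  module _ {q} (N : NaturalUnitIntervalOrder q P) where
    open NaturalUnitIntervalOrder N using (_<_; _<?_)

    inv : Word size → ℕ
    inv (n , w) =
      length (filter
        (λ (i , j) → (i Fin.<? j) ×-dec (w j <? w i) ×-dec (w i ∼ₚ? w j))
        (cartesianProduct (allFin n) (allFin n)))

    -- The total order carried by P[β].
    _⊏_ : ∀ {β} → Rel P[ β ] q
    (a , i) ⊏ (a′ , i′) = (a < a′) ⊎ (a ≡ a′ × toℕ i ℕ.< toℕ i′)

    _⊏?_ : ∀ {β} → Decidable (_⊏_ {β})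
    (a , i) ⊏? (a′ , i′) = (a <? a′) ⊎-dec ((a Fin.≟ a′) ×-dec (toℕ i ℕ.<? toℕ i′))

    asc : ∀ {β m} → Colouring β m → ℕ
    asc {β} κ =
      length (filter
        (λ (b , b′) → (_⊏?_ {β} b b′) ×-dec incomparable? {β} b b′ ×-dec
                      (colour {β} κ b Fin.<? colour {β} κ b′))
        (cartesianProduct (elements β) (elements β)))

-- {i₁,…,iₙ} indexes a monomial of Q_D: i₁ ≤ ⋯ ≤ iₙ, strictly increasing after each
-- position in D, positions counted from 0.  (D may contain the last position, which imposes nothing.)
Compatible : ∀ {n m} → Subset n → (Fin n → Fin m) → Set
Compatible D i =
  ∀ j j′ → toℕ j′ ≡ suc (toℕ j) →
    (i j Fin.≤ i j′) × (j ∈ D → i j Fin.< i j′)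

compatible? : ∀ {n m} (D : Subset n) (i : Fin n → Fin m) → Dec (Compatible D i)
compatible? D i =
  all? λ j → all? λ j′ → (toℕ j′ ℕ.≟ suc (toℕ j)) →-dec
    ((i j Fin.≤? i j′) ×-dec ((j ∈? D) →-dec (i j Fin.<? i j′)))

splits : ∀ {m} → Vec ℕ m → List (Vec ℕ m × Vec ℕ m)
splits []      = ([] , []) ∷ []
splits (a ∷ α) =
  cartesianProductWith (λ b (β , γ) → (b ∷ β , (a ∸ b) ∷ γ)) (upTo (suc a)) (splits α)

record Partition : Set where
  field
    parts      : List ℕ
    positive   : All NonZero parts
    decreasing : Linked _≥_ parts

-- The coefficients lie in an arbitrary commutative ring R, and t is an arbitrary element
-- of R; the cases of interest are R = ℤ, and R = ℚ(t) with t the indeterminate.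
module _ {c ℓ} (R : CommutativeRing c ℓ) where
  open CommutativeRing R
  open import Algebra.Properties.Semiring.Exp semiring using (_^_)

  -- A formal power series in x₁, x₂, … is given by its coefficients: f m α is the
  -- coefficient of x₁^α₁ ⋯ xₘ^αₘ.  The same monomial also arises from longer α by
  -- appending zeros; the series below do not depend on this choice, since only the
  -- variables x₁,…,xₘ can contribute to that coefficient.
  Series : Set c
  Series = (m : ℕ) → Vec ℕ m → Carrier

  infix 4 _≋_ _≋ω_
  _≋_ : Series → Series → Set ℓ
  f ≋ g = ∀ m (α : Vec ℕ m) → f m α ≈ g m α

  ∑ : ∀ {a} {A : Set a} → List A → (A → Carrier) → Carrier
  ∑ xs f = foldr (λ x s → f x + s) 0# xs

  infixl 7 _⊛_
  _⊛_ : Series → Series → Series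
  (f ⊛ g) m α = ∑ (splits α) λ (β , γ) → f m β * g m γ

  Q : ∀ {n} → Subset n → Series
  Q {n} D m α =
    ∑ (filter (λ i → compatible? D i ×-dec (content (allFin n) i ≟ᵛ α))
        (allFunctions λ _ → allFin m))
      λ _ → 1#

  linearCombination : ∀ {a} {A : Set a} → (A → Series) → List (Carrier × A) → Series
  linearCombination f γ m α = ∑ γ λ (r , a) → r * f a m α

  -- hₙ is the sum over i₁ ≤ ⋯ ≤ iₙ, and eₙ the sum over i₁ < ⋯ < iₙ.
  h e : ℕ → Series
  h n = Q {n} ⊥
  e n = Q {n} ⊤

  one : Series
  one m α with sum α
  ... | zero  = 1#
  ... | suc _ = 0#

  hᵖ eᵖ : Partition → Series
  hᵖ λ′ = foldr (λ n f → h n ⊛ f) one (Partition.parts λ′)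
  eᵖ λ′ = foldr (λ n f → e n ⊛ f) one (Partition.parts λ′)

  -- f ≋ω g says that g is a symmetric function and f = ω g.  The h_λ form an R-basis of
  -- the symmetric functions and ω is the linear map with ω h_λ = e_λ, so this is the
  -- graph of ω: g = Σ c_λ h_λ and f = Σ c_λ e_λ for one finite family of coefficients.
  _≋ω_ : Series → Series → Set (c ⊔ ℓ)
  f ≋ω g = ∃ λ (cs : List (Carrier × Partition)) →
    (g ≋ linearCombination hᵖ cs) × (f ≋ linearCombination eᵖ cs)

  module _ {p} (P : FinitePoset p) where
    open FinitePoset P using (size)

    F : List (Carrier × Word size) → Series
    F = linearCombination (λ w → Q (Des P w))

    W : Multiset P → List (Carrier × Word size)
    W β = map (1# ,_) (wordsOfContent P β)

    X : Multiset P → Series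
    X β m α = ∑ (colourings P β α) λ _ → 1#

    module _ {q} (N : NaturalUnitIntervalOrder q P) (t : Carrier) where

      Wₜ : Multiset P → List (Carrier × Word size)
      Wₜ β = map (λ w → (t ^ inv P N w , w)) (wordsOfContent P β)

      Xₜ : Multiset P → Series
      Xₜ β m α = ∑ (colourings P β α) λ κ → t ^ asc P N {β} κ

{-# OPTIONS --safe #-}

-- Let u_a (a ∈ P) be noncommuting variables, let e_i(u) be the sum of the words of length i with
-- a descent at every position, and h_i(u) that of the words without descents.  For
-- φ(w) = [w has content β] t^inv(w), the coefficient of x^α in F is φ(h_α₁(u) h_α₂(u) ⋯) and that
-- in X is φ(⋯ e_α₂(u) e_α₁(u)), since a colouring amounts to a sequence of chains.  The relations
-- ∑ (-1)ˡ e_l(u) h_{k-l}(u) = 0 hold for every P.  Moreover φ does not see the order of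
-- neighbouring factors e_i(u) e_j(u): without weights because it depends only on the content, and
-- for a natural unit interval order because the letters of two chains, joined when incomparable,
-- form paths, and exchanging the two chains along the paths of odd length preserves inv.  Hence φ
-- factors through symmetric functions.  By the fundamental theorem F = ∑ c_λ e_λ for some c_λ;
-- both φ and the "superfunctions" that specialise to e_λ(x) on h-factors and to h_λ(x) on
-- e-factors satisfy the alternating relations, so they also agree on e-factors: X = ∑ c_λ h_λ.
module Submission where

open import Defs hiding (∑; e; h)
import Defs
open import Algebra.Bundles using (CommutativeRing; CommutativeSemiring)
open import Data.Bool using (Bool; true; false; if_then_else_)
open import Data.Empty.Polymorphic using (⊥)
open import Data.Fin as Fin using (Fin; zero; suc; toℕ)
import Data.Fin.Properties as Finₚ
import Data.Fin.Subset as Subset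
open import Data.Fin.Subset using (Subset; _∈_)
open import Data.Fin.Subset.Properties using (∈⊤; ∉⊥)
open import Data.List using (List; []; _∷_; _++_; map; concatMap; filter; foldr; length; replicate; reverse; allFin; tabulate; upTo; applyUpTo; cartesianProduct; cartesianProductWith)
open import Data.List.Membership.Propositional.Properties using (∈-allFin)
open import Data.List.Properties using (++-assoc; ++-identityʳ; map-++; map-tabulate; map-upTo; length-++; length-map; length-replicate; length-tabulate; filter-accept; filter-reject; unfold-reverse)
open import Data.List.Relation.Binary.Permutation.Propositional using (_↭_; refl; prep; swap; trans)
import Data.List.Relation.Binary.Permutation.Propositional.Properties as ↭ₚ
open import Data.List.Relation.Unary.All as All using (All; []; _∷_; all?)
import Data.List.Relation.Unary.All.Properties as Allₚ
open import Data.List.Relation.Unary.AllPairs using ([]; _∷_)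
import Data.List.Relation.Unary.AllPairs.Properties as AllPairsₚ
open import Data.List.Relation.Unary.Linked using (Linked; []; [-]; _∷_; linked?)
open import Data.List.Relation.Unary.Linked.Properties using (Linked⇒AllPairs; AllPairs⇒Linked)
open import Data.Nat as ℕ using (ℕ; zero; suc; 2+; _∸_; NonZero)
open import Data.Nat.ListAction using () renaming (sum to sumᴸ)
import Data.Nat.Properties as ℕₚ
open import Data.Nat.Tactic.RingSolver using (solve-∀)
open import Data.Product using (_×_; _,_; ∃; proj₁; proj₂; map₁)
open import Data.Sum using (_⊎_; inj₁; inj₂)
open import Data.Unit.Polymorphic using (⊤; tt)
open import Data.Vec as Vec using (Vec; []; _∷_; toList; sum; lookup; _[_]≔_)
import Data.Vec.Properties as Vecₚ
import Data.Vec.Relation.Unary.All as VecAll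
import Data.Vec.Relation.Unary.All.Properties as VecAllₚ
open import Function using (_∘_; id; flip; _⇔_; mk⇔; Equivalence)
import Level
open import Relation.Binary.Core using (Rel)
import Relation.Binary.Definitions as B
open import Relation.Binary.Definitions using (tri<; tri≈; tri>)
open import Relation.Binary.PropositionalEquality as ≡ using (_≡_; _≢_; refl)
open import Relation.Binary.Structures using (IsDecStrictPartialOrder; IsStrictTotalOrder)
open import Relation.Nullary using (Dec; ¬_; does; yes; no)
open import Relation.Nullary.Decidable using (map′; _×-dec_; _⊎-dec_; _→-dec_; ¬?; toSum; dec-true)
open import Relation.Nullary.Negation using (contradiction)
import Relation.Unary as Unary

-- As R is arbitrary, nothing may be divided by: the coefficients c_λ must come from an integral
-- construction. Because `_≋ω_` asks for one family of coefficients for both expansions, ω itself is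
-- never formed; passing from F to X means changing the kind of the slots while the c_λ stay fixed.
--
-- Both halves of the theorem are one argument with a relation `D` as parameter, which says which
-- pairs of letters count towards the exponent of t. It is empty for a general P, which carries no
-- total order, and larger-and-incomparable for a natural unit interval order. Only the exchange of
-- neighbouring e-factors is proved separately.
--
-- The link between colourings and sequences of chains is a 0-1 matrix with a row for each letter of
-- P and a column for each colour. Row a is the set of colours of the copies of a; since these
-- colours decrease, the set determines them. Column c is the set of letters of colour c, which must
-- be a chain and hence is the content of a single decreasing word. Transposing the matrix exchanges
-- the two descriptions.

-- Finite sums and Iverson brackets

module Sum {c ℓ} (S : CommutativeSemiring c ℓ) where
  open CommutativeSemiring S hiding (refl; trans; zero)
  private module S = CommutativeSemiring S
  open import Algebra.Properties.CommutativeSemigroup +-commutativeSemigroup using (interchange; x∙yz≈y∙xz)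
  open import Relation.Binary.Reasoning.Setoid setoid

  ∑ : ∀ {a} {A : Set a} → List A → (A → Carrier) → Carrier
  ∑ xs f = foldr (λ x s → f x + s) 0# xs

  infix 5 ∑
  syntax ∑ xs (λ x → e) = ∑[ x ∈ xs ] e

  module _ {a} {A : Set a} where

    ∑-congAll : ∀ {f g : A → Carrier} {xs} → All (λ x → f x ≈ g x) xs → ∑ xs f ≈ ∑ xs g
    ∑-congAll []       = S.refl
    ∑-congAll (e ∷ es) = +-cong e (∑-congAll es)

    ∑-cong : ∀ {f g : A → Carrier} xs → (∀ x → f x ≈ g x) → ∑ xs f ≈ ∑ xs g
    ∑-cong []       _ = S.refl
    ∑-cong (x ∷ xs) e = +-cong (e x) (∑-cong xs e)

    ∑-zero : ∀ {f : A → Carrier} xs → (∀ x → f x ≈ 0#) → ∑ xs f ≈ 0#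
    ∑-zero []       _ = S.refl
    ∑-zero (x ∷ xs) e = S.trans (+-cong (e x) (∑-zero xs e)) (+-identityˡ 0#)

    ∑-+ : ∀ (f g : A → Carrier) xs → ∑[ x ∈ xs ] (f x + g x) ≈ ∑ xs f + ∑ xs g
    ∑-+ f g []       = sym (+-identityˡ 0#)
    ∑-+ f g (x ∷ xs) = S.trans (+-congˡ (∑-+ f g xs)) (interchange (f x) (g x) (∑ xs f) (∑ xs g))

    ∑-*ˡ : ∀ r (f : A → Carrier) xs → ∑[ x ∈ xs ] r * f x ≈ r * ∑ xs f
    ∑-*ˡ r f []       = sym (zeroʳ r)
    ∑-*ˡ r f (x ∷ xs) = S.trans (+-congˡ (∑-*ˡ r f xs)) (sym (distribˡ r (f x) (∑ xs f)))

    ∑-*ʳ : ∀ r (f : A → Carrier) xs → ∑[ x ∈ xs ] f x * r ≈ ∑ xs f * r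
    ∑-*ʳ r f xs = S.trans (∑-cong xs (λ x → *-comm (f x) r)) (S.trans (∑-*ˡ r f xs) (*-comm r _))

    ∑-++ : ∀ (f : A → Carrier) xs ys → ∑ (xs ++ ys) f ≈ ∑ xs f + ∑ ys f
    ∑-++ f []       ys = sym (+-identityˡ _)
    ∑-++ f (x ∷ xs) ys = S.trans (+-congˡ (∑-++ f xs ys)) (sym (+-assoc _ _ _))

    ∑-↭ : ∀ (f : A → Carrier) {xs ys} → xs ↭ ys → ∑ xs f ≈ ∑ ys f
    ∑-↭ f refl         = S.refl
    ∑-↭ f (prep x r)   = +-congˡ (∑-↭ f r)
    ∑-↭ f (swap x y r) = S.trans (+-congˡ (+-congˡ (∑-↭ f r))) (x∙yz≈y∙xz _ _ _)
    ∑-↭ f (trans r s)  = S.trans (∑-↭ f r) (∑-↭ f s)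

  module _ {a b} {A : Set a} {B : Set b} where

    ∑-comm : ∀ (f : A → B → Carrier) xs ys →
      ∑[ x ∈ xs ] ∑[ y ∈ ys ] f x y ≈ ∑[ y ∈ ys ] ∑[ x ∈ xs ] f x y
    ∑-comm f []       ys = sym (∑-zero ys (λ _ → S.refl))
    ∑-comm f (x ∷ xs) ys =
      S.trans (+-congˡ (∑-comm f xs ys)) (sym (∑-+ (f x) (λ y → ∑[ x′ ∈ xs ] f x′ y) ys))

    ∑-map : ∀ (g : A → B) (f : B → Carrier) xs → ∑ (map g xs) f ≈ ∑ xs (f ∘ g)
    ∑-map g f []       = S.refl
    ∑-map g f (x ∷ xs) = +-congˡ (∑-map g f xs)

    ∑-concatMap : ∀ (g : A → List B) (f : B → Carrier) xs →
      ∑ (concatMap g xs) f ≈ ∑[ x ∈ xs ] ∑ (g x) f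
    ∑-concatMap g f []       = S.refl
    ∑-concatMap g f (x ∷ xs) =
      S.trans (∑-++ f (g x) (concatMap g xs)) (+-congˡ (∑-concatMap g f xs))

  ∑-product : ∀ {a b d} {A : Set a} {B : Set b} {D : Set d} (g : A → B → D) (f : D → Carrier) xs ys →
    ∑ (cartesianProductWith g xs ys) f ≈ ∑[ x ∈ xs ] ∑[ y ∈ ys ] f (g x y)
  ∑-product g f []       ys = S.refl
  ∑-product g f (x ∷ xs) ys =
    S.trans (∑-++ f (map (g x) ys) _) (+-cong (∑-map (g x) f ys) (∑-product g f xs ys))

  ∑-tabulate : ∀ {a} {A : Set a} {n} (g : Fin n → A) (f : A → Carrier) →
    ∑ (tabulate g) f ≈ ∑ (allFin n) (f ∘ g)
  ∑-tabulate {n = n} g f =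
    S.trans (reflexive (≡.cong (λ l → ∑ l f) (≡.sym (map-tabulate id g)))) (∑-map g f (allFin n))

  ∑-allFin-suc : ∀ n (f : Fin (suc n) → Carrier) →
    ∑ (allFin (suc n)) f ≈ f zero + ∑ (allFin n) (f ∘ suc)
  ∑-allFin-suc n f = +-congˡ (∑-tabulate suc f)

  -- Only `does` is inspected, so `map′` leaves a bracket definitionally unchanged. This is why the
  -- bracket of a decision on `x ∷ y ∷ w` can be treated as that of a `_×-dec_` without further
  -- argument.
  ⟦_⟧ : ∀ {p} {P : Set p} → Dec P → Carrier
  ⟦ d ⟧ = if does d then 1# else 0#

  module _ {p} {P : Set p} where

    ⟦⟧-true : (d : Dec P) → P → ⟦ d ⟧ ≈ 1#
    ⟦⟧-true (yes _) _ = S.refl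
    ⟦⟧-true (no ¬p) p = contradiction p ¬p

    ⟦⟧-false : (d : Dec P) → ¬ P → ⟦ d ⟧ ≈ 0#
    ⟦⟧-false (yes p) ¬p = contradiction p ¬p
    ⟦⟧-false (no _)  _  = S.refl

    ⟦⟧-true* : (d : Dec P) → P → ∀ x → ⟦ d ⟧ * x ≈ x
    ⟦⟧-true* d p x = S.trans (*-congʳ (⟦⟧-true d p)) (*-identityˡ x)

    ⟦⟧-false* : (d : Dec P) → ¬ P → ∀ x → ⟦ d ⟧ * x ≈ 0#
    ⟦⟧-false* d ¬p x = S.trans (*-congʳ (⟦⟧-false d ¬p)) (zeroˡ x)

    guard : ∀ {x y} (d : Dec P) → (P → x ≈ y) → ⟦ d ⟧ * x ≈ ⟦ d ⟧ * y
    guard (yes p) e = *-congˡ (e p)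
    guard (no _)  _ = S.trans (zeroˡ _) (sym (zeroˡ _))

    ⟦⟧-complement : ∀ (d : Dec P) x → ⟦ d ⟧ * x + ⟦ ¬? d ⟧ * x ≈ x
    ⟦⟧-complement (yes _) x = S.trans (+-cong (*-identityˡ x) (zeroˡ x)) (+-identityʳ x)
    ⟦⟧-complement (no _)  x = S.trans (+-cong (zeroˡ x) (*-identityˡ x)) (+-identityˡ x)

  module _ {p q} {P : Set p} {Q : Set q} where

    ⟦⟧-cong : (P → Q) → (Q → P) → (d : Dec P) (d′ : Dec Q) → ⟦ d ⟧ ≈ ⟦ d′ ⟧
    ⟦⟧-cong f g (yes p) d′ = sym (⟦⟧-true d′ (f p))
    ⟦⟧-cong f g (no ¬p) d′ = sym (⟦⟧-false d′ (¬p ∘ g))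

    ⟦⟧-× : (d : Dec P) (d′ : Dec Q) → ⟦ d ×-dec d′ ⟧ ≈ ⟦ d ⟧ * ⟦ d′ ⟧
    ⟦⟧-× (yes _) d′ = sym (*-identityˡ _)
    ⟦⟧-× (no _)  d′ = sym (zeroˡ _)

    ⟦⟧-×* : ∀ (d : Dec P) (d′ : Dec Q) x → ⟦ d ×-dec d′ ⟧ * x ≈ ⟦ d ⟧ * (⟦ d′ ⟧ * x)
    ⟦⟧-×* d d′ x = S.trans (*-congʳ (⟦⟧-× d d′)) (*-assoc _ _ _)

    ⟦⟧-cong* : (P → Q) → (Q → P) → (d : Dec P) (d′ : Dec Q) →
      ∀ {x y} → (P → x ≈ y) → ⟦ d ⟧ * x ≈ ⟦ d′ ⟧ * y
    ⟦⟧-cong* f g d d′ e = S.trans (guard d e) (*-congʳ (⟦⟧-cong f g d d′))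

  ∑-filter : ∀ {a p} {A : Set a} {P : A → Set p} (P? : Unary.Decidable P) (f : A → Carrier) xs →
    ∑ (filter P? xs) f ≈ ∑[ x ∈ xs ] ⟦ P? x ⟧ * f x
  ∑-filter P? f []       = S.refl
  ∑-filter P? f (x ∷ xs) with does (P? x)
  ... | true  = +-cong (sym (*-identityˡ _)) (∑-filter P? f xs)
  ... | false = S.trans (∑-filter P? f xs) (S.trans (sym (+-identityˡ _)) (+-congʳ (sym (zeroˡ _))))

  ∑-unique : ∀ {n p} {P : Fin n → Set p} (P? : Unary.Decidable P) (x : Fin n) → P x → (∀ y → P y → y ≡ x) →
    ∀ (f : Fin n → Carrier) → ∑[ y ∈ allFin n ] ⟦ P? y ⟧ * f y ≈ f x
  ∑-unique {suc n} P? zero px u f = begin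
    ∑[ y ∈ allFin (suc n) ] ⟦ P? y ⟧ * f y
      ≈⟨ ∑-allFin-suc n (λ y → ⟦ P? y ⟧ * f y) ⟩
    ⟦ P? zero ⟧ * f zero + (∑[ y ∈ allFin n ] ⟦ P? (suc y) ⟧ * f (suc y))
      ≈⟨ +-cong (⟦⟧-true* (P? zero) px _)
           (∑-zero (allFin n) λ y → ⟦⟧-false* (P? (suc y)) (λ py → 1+i≢0 (u (suc y) py)) _) ⟩
    f zero + 0#
      ≈⟨ +-identityʳ _ ⟩
    f zero ∎
    where
    1+i≢0 : ∀ {i : Fin n} → ¬ (suc i ≡ zero)
    1+i≢0 ()
  ∑-unique {suc n} P? (suc x) px u f = begin
    ∑[ y ∈ allFin (suc n) ] ⟦ P? y ⟧ * f y
      ≈⟨ ∑-allFin-suc n (λ y → ⟦ P? y ⟧ * f y) ⟩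
    ⟦ P? zero ⟧ * f zero + (∑[ y ∈ allFin n ] ⟦ P? (suc y) ⟧ * f (suc y))
      ≈⟨ +-cong (⟦⟧-false* (P? zero) (λ p0 → 0≢1+i (u zero p0)) _)
           (∑-unique (P? ∘ suc) x px (λ y py → Finₚ.suc-injective (u (suc y) py)) (f ∘ suc)) ⟩
    0# + f (suc x)
      ≈⟨ +-identityˡ _ ⟩
    f (suc x) ∎
    where
    0≢1+i : ¬ (zero ≡ suc x)
    0≢1+i ()

  ∑-≟ : ∀ {n} (x : Fin n) (f : Fin n → Carrier) → ∑[ y ∈ allFin n ] ⟦ x Fin.≟ y ⟧ * f y ≈ f x
  ∑-≟ x f = ∑-unique (x Fin.≟_) x ≡.refl (λ _ → ≡.sym) f

-- Words of fixed length, and slots for the factors e_i and h_i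

words : ∀ {a} {A : Set a} → List A → ℕ → List (List A)
words as zero    = [] ∷ []
words as (suc n) = cartesianProductWith _∷_ as (words as n)

words-length : ∀ {a} {A : Set a} (as : List A) n → All (λ w → length w ≡ n) (words as n)
words-length as zero    = ≡.refl ∷ []
words-length as (suc n) =
  Allₚ.cartesianProductWith⁺ (≡.setoid _) (≡.setoid _) _∷_ as (words as n)
    λ _ w∈ → ≡.cong suc (All.lookup (words-length as n) w∈)

data Kind : Set where
  𝕖 𝕙 : Kind

Slot : Set
Slot = Kind × ℕ

total : List Slot → ℕ
total []            = 0
total ((_ , i) ∷ s) = i ℕ.+ total s

-- Alternating sums

module Alternating {c ℓ} (R : CommutativeRing c ℓ) where
  open CommutativeRing R hiding (refl; trans; zero)
  private module R = CommutativeRing R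
  open Sum commutativeSemiring
  open import Algebra.Properties.Ring ring using (x[y-z]≈xy-xz)
  open import Algebra.Properties.AbelianGroup +-abelianGroup using (⁻¹-∙-comm; ε⁻¹≈ε; x∙y⁻¹≈ε⇒x≈y)
  open import Relation.Binary.Reasoning.Setoid setoid

  -‿cong₂ : ∀ {x y u v} → x ≈ y → u ≈ v → x - u ≈ y - v
  -‿cong₂ e f = +-cong e (-‿cong f)

  0-0≈0 : 0# - 0# ≈ 0#
  0-0≈0 = -‿inverseʳ 0#

  +⇒- : ∀ {x y z} → x ≈ y + z → x - y ≈ z
  +⇒- {x} {y} {z} e = begin
    x - y           ≈⟨ +-congʳ (R.trans e (+-comm y z)) ⟩
    (z + y) - y     ≈⟨ +-assoc z y (- y) ⟩
    z + (y - y)     ≈⟨ +-congˡ (-‿inverseʳ y) ⟩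
    z + 0#          ≈⟨ +-identityʳ z ⟩
    z ∎

  -⇒≈ : ∀ {x y} → x - y ≈ 0# → x ≈ y
  -⇒≈ = x∙y⁻¹≈ε⇒x≈y _ _

  ∑-neg : ∀ {a} {A : Set a} (f : A → Carrier) xs → ∑[ x ∈ xs ] (- f x) ≈ - ∑ xs f
  ∑-neg f []       = sym ε⁻¹≈ε
  ∑-neg f (x ∷ xs) = R.trans (+-congˡ (∑-neg f xs)) (⁻¹-∙-comm (f x) (∑ xs f))

  ∑-sub : ∀ {a} {A : Set a} (f g : A → Carrier) xs → ∑[ x ∈ xs ] (f x - g x) ≈ ∑ xs f - ∑ xs g
  ∑-sub f g xs = R.trans (∑-+ f (λ x → - g x) xs) (+-congˡ (∑-neg g xs))

  -- This is ∑ (-1)ˡ g l (k - l) over l ≤ k. Nested subtraction avoids powers of -1 and makes the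
  -- term l = 0 available by computation, which is how a relation is solved for h_k.
  alt : ℕ → (ℕ → ℕ → Carrier) → Carrier
  alt zero    g = g 0 0
  alt (suc k) g = g 0 (suc k) - alt k (λ l r → g (suc l) r)

  -- The bound r ≤ k lets an induction hypothesis for smaller 𝕙-slots be applied under the sum.
  alt-cong≤ : ∀ k {g g′ : ℕ → ℕ → Carrier} → (∀ l r → r ℕ.≤ k → g l r ≈ g′ l r) → alt k g ≈ alt k g′
  alt-cong≤ zero    e = e 0 0 ℕₚ.≤-refl
  alt-cong≤ (suc k) e =
    -‿cong₂ (e 0 (suc k) ℕₚ.≤-refl) (alt-cong≤ k λ l r r≤k → e (suc l) r (ℕₚ.m≤n⇒m≤1+n r≤k))

  alt-cong : ∀ k {g g′ : ℕ → ℕ → Carrier} → (∀ l r → g l r ≈ g′ l r) → alt k g ≈ alt k g′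
  alt-cong k e = alt-cong≤ k (λ l r _ → e l r)

  alt-∑ : ∀ {a} {A : Set a} k (u : A → Carrier) (g : A → ℕ → ℕ → Carrier) xs →
    alt k (λ l r → ∑[ x ∈ xs ] u x * g x l r) ≈ ∑[ x ∈ xs ] u x * alt k (g x)
  alt-∑ zero    u g xs = R.refl
  alt-∑ (suc k) u g xs = begin
    (∑[ x ∈ xs ] u x * g x 0 (suc k)) - alt k (λ l r → ∑[ x ∈ xs ] u x * g x (suc l) r)
      ≈⟨ +-congˡ (-‿cong (alt-∑ k u (λ x l r → g x (suc l) r) xs)) ⟩
    (∑[ x ∈ xs ] u x * g x 0 (suc k)) - (∑[ x ∈ xs ] u x * alt k (λ l r → g x (suc l) r))
      ≈⟨ ∑-sub _ _ xs ⟨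
    ∑[ x ∈ xs ] (u x * g x 0 (suc k) - u x * alt k (λ l r → g x (suc l) r))
      ≈⟨ ∑-cong xs (λ x → sym (x[y-z]≈xy-xz (u x) _ _)) ⟩
    ∑[ x ∈ xs ] u x * alt (suc k) (g x) ∎

  ∑-words-suc : ∀ {a} {A : Set a} (as : List A) n (f : List A → Carrier) →
    ∑ (words as (suc n)) f ≈ ∑[ x ∈ as ] ∑[ w ∈ words as n ] f (x ∷ w)
  ∑-words-suc as n f = ∑-product _∷_ f as (words as n)

  ∑-words-+ : ∀ {a} {A : Set a} (as : List A) m n (f : List A → Carrier) →
    ∑ (words as (m ℕ.+ n)) f ≈ ∑[ u ∈ words as m ] ∑[ v ∈ words as n ] f (u ++ v)
  ∑-words-+ as zero    n f = sym (+-identityʳ _)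
  ∑-words-+ as (suc m) n f = begin
    ∑ (words as (suc m ℕ.+ n)) f
      ≈⟨ ∑-words-suc as (m ℕ.+ n) f ⟩
    ∑[ x ∈ as ] ∑[ w ∈ words as (m ℕ.+ n) ] f (x ∷ w)
      ≈⟨ ∑-cong as (λ x → ∑-words-+ as m n (f ∘ (x ∷_))) ⟩
    ∑[ x ∈ as ] ∑[ u ∈ words as m ] ∑[ v ∈ words as n ] f (x ∷ u ++ v)
      ≈⟨ ∑-words-suc as m (λ u → ∑[ v ∈ words as n ] f (u ++ v)) ⟨
    ∑[ u ∈ words as (suc m) ] ∑[ v ∈ words as n ] f (u ++ v) ∎

  -- The relations ∑ (-1)ˡ eₗ hₖ₋ₗ = 0 and e₀ = h₀ = 1, in every context.
  record Super (f : List Slot → Carrier) : Set ℓ where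
    field
      alternating : ∀ u k v → alt (suc k) (λ l r → f (u ++ (𝕖 , l) ∷ (𝕙 , r) ∷ v)) ≈ 0#
      removable   : ∀ u c v → f (u ++ (c , 0) ∷ v) ≈ f (u ++ v)

-- Noncommutative e_i(u) and h_i(u): relations and commutation

module Noncommutative {c ℓ p} (R : CommutativeRing c ℓ) {K : ℕ}
  {_≺_ : Rel (Fin K) p} (_≺?_ : B.Decidable _≺_) where
  open CommutativeRing R hiding (refl; trans; zero)
  private module R = CommutativeRing R
  open Sum commutativeSemiring
  open Alternating R
  open import Algebra.Properties.CommutativeSemigroup *-commutativeSemigroup using (x∙yz≈y∙xz)
  open import Relation.Binary.Reasoning.Setoid setoid

  wordsᴷ : ℕ → List (List (Fin K))
  wordsᴷ = words (allFin K)

  dec? : ∀ w → Dec (Linked (λ x y → y ≺ x) w)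
  dec? = linked? (λ x y → y ≺? x)

  nod? : ∀ w → Dec (Linked (λ x y → ¬ (y ≺ x)) w)
  nod? = linked? (λ x y → ¬? (y ≺? x))

  χ : Kind → List (Fin K) → Carrier
  χ 𝕖 w = ⟦ dec? w ⟧
  χ 𝕙 w = ⟦ nod? w ⟧

  -- The functional φ, extended linearly to noncommutative polynomials, at the product of the e_i(u)
  -- and h_i(u) that the slots prescribe. Absorbing each prefix into φ takes the place of
  -- multiplication in the free algebra.
  G : (List (Fin K) → Carrier) → List Slot → Carrier
  G φ []            = φ []
  G φ ((c , i) ∷ s) = ∑[ a ∈ wordsᴷ i ] χ c a * G (φ ∘ (a ++_)) s

  G-congLength : ∀ {φ ψ} s → (∀ w → length w ≡ total s → φ w ≈ ψ w) → G φ s ≈ G ψ s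
  G-congLength []            e = e [] ≡.refl
  G-congLength ((c , i) ∷ s) e =
    ∑-congAll (All.map (λ {a} |a|≡i → *-congˡ (G-congLength s λ w |w|≡ →
      e (a ++ w) (≡.trans (length-++ a) (≡.cong₂ ℕ._+_ |a|≡i |w|≡))))
      (words-length (allFin K) i))

  G-cong : ∀ {φ ψ} s → (∀ w → φ w ≈ ψ w) → G φ s ≈ G ψ s
  G-cong s e = G-congLength s (λ w _ → e w)

  G-zero : ∀ {φ} s → (∀ w → φ w ≈ 0#) → G φ s ≈ 0#
  G-zero []            e = e []
  G-zero ((c , i) ∷ s) e =
    ∑-zero (wordsᴷ i) (λ a → R.trans (*-congˡ (G-zero s (e ∘ (a ++_)))) (zeroʳ _))

  G-∑ : ∀ {a} {A : Set a} (r : A → Carrier) (φ : A → List (Fin K) → Carrier) xs s →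
    G (λ w → ∑[ x ∈ xs ] r x * φ x w) s ≈ ∑[ x ∈ xs ] r x * G (φ x) s
  G-∑ r φ xs []            = R.refl
  G-∑ r φ xs ((c , i) ∷ s) = begin
    ∑[ a ∈ wordsᴷ i ] χ c a * G (λ w → ∑[ x ∈ xs ] r x * φ x (a ++ w)) s
      ≈⟨ ∑-cong (wordsᴷ i) (λ a → *-congˡ (G-∑ r (λ x w → φ x (a ++ w)) xs s)) ⟩
    ∑[ a ∈ wordsᴷ i ] χ c a * (∑[ x ∈ xs ] r x * G (φ x ∘ (a ++_)) s)
      ≈⟨ ∑-cong (wordsᴷ i) (λ a → sym (∑-*ˡ (χ c a) _ xs)) ⟩
    ∑[ a ∈ wordsᴷ i ] ∑[ x ∈ xs ] χ c a * (r x * G (φ x ∘ (a ++_)) s)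
      ≈⟨ ∑-comm _ (wordsᴷ i) xs ⟩
    ∑[ x ∈ xs ] ∑[ a ∈ wordsᴷ i ] χ c a * (r x * G (φ x ∘ (a ++_)) s)
      ≈⟨ ∑-cong xs (λ x → R.trans (∑-cong (wordsᴷ i) (λ a → x∙yz≈y∙xz _ _ _)) (∑-*ˡ (r x) _ (wordsᴷ i))) ⟩
    ∑[ x ∈ xs ] r x * G (φ x) ((c , i) ∷ s) ∎

  G-++ : ∀ φ s s′ → G φ (s ++ s′) ≈ G (λ w → G (φ ∘ (w ++_)) s′) s
  G-++ φ []            s′ = R.refl
  G-++ φ ((c , i) ∷ s) s′ = ∑-cong (wordsᴷ i) λ a → *-congˡ (R.trans
    (G-++ (φ ∘ (a ++_)) s s′)
    (G-cong s λ w → G-cong s′ λ w′ → reflexive (≡.cong φ (≡.sym (++-assoc a w w′)))))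

  G-removable : ∀ φ u c v → G φ (u ++ (c , 0) ∷ v) ≈ G φ (u ++ v)
  G-removable φ []            𝕖 v = R.trans (+-identityʳ _) (*-identityˡ _)
  G-removable φ []            𝕙 v = R.trans (+-identityʳ _) (*-identityˡ _)
  G-removable φ ((d , i) ∷ u) c v =
    ∑-cong (wordsᴷ i) λ a → *-congˡ (G-removable (φ ∘ (a ++_)) u c v)

  nodTail : (List (Fin K) → Carrier) → List (Fin K) → ℕ → Carrier
  nodTail φ a r = ∑[ b ∈ wordsᴷ r ] ⟦ nod? b ⟧ * φ (a ++ b)

  -- Each word occurs once for every factorisation into a decreasing and a descent-free part;
  -- telescoping over the length of the decreasing part leaves the words below x without descent.
  alt-dec-nod : ∀ x k φ →
    alt k (λ l r → ∑[ a ∈ wordsᴷ l ] ⟦ dec? (x ∷ a) ⟧ * nodTail φ a r) ≈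
    ∑[ w ∈ wordsᴷ k ] ⟦ nod? (x ∷ w) ⟧ * φ w
  alt-dec-nod x zero φ = +-congʳ (*-congˡ (R.trans (+-identityʳ _) (*-identityˡ _)))
  alt-dec-nod x (suc k) φ = +⇒- (begin
    1# * nodTail φ [] (suc k) + 0#
      ≈⟨ R.trans (+-identityʳ _) (*-identityˡ _) ⟩
    ∑[ w ∈ wordsᴷ (suc k) ] ⟦ nod? w ⟧ * φ w
      ≈⟨ ∑-words-suc (allFin K) k _ ⟩
    ∑[ y ∈ allFin K ] T y
      -- Sort the descent-free words by their first letter y. If y ≺ x, then y can also continue the
      -- decreasing part, and the induction hypothesis for y produces the same words with the other
      -- sign; otherwise x can be put in front without creating a descent.
      ≈⟨ ∑-cong (allFin K) (λ y → sym (⟦⟧-complement (y ≺? x) (T y))) ⟩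
    ∑[ y ∈ allFin K ] (⟦ y ≺? x ⟧ * T y + ⟦ ¬? (y ≺? x) ⟧ * T y)
      ≈⟨ ∑-+ _ _ (allFin K) ⟩
    (∑[ y ∈ allFin K ] ⟦ y ≺? x ⟧ * T y) + (∑[ y ∈ allFin K ] ⟦ ¬? (y ≺? x) ⟧ * T y)
      ≈⟨ +-cong (sym descend) (sym ascend) ⟩
    alt k (λ l r → ∑[ a ∈ wordsᴷ (suc l) ] ⟦ dec? (x ∷ a) ⟧ * nodTail φ a r) +
    (∑[ w ∈ wordsᴷ (suc k) ] ⟦ nod? (x ∷ w) ⟧ * φ w) ∎)
    where
    T : Fin K → Carrier
    T y = ∑[ w ∈ wordsᴷ k ] ⟦ nod? (y ∷ w) ⟧ * φ (y ∷ w)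

    step : ∀ l r → ∑[ a ∈ wordsᴷ (suc l) ] ⟦ dec? (x ∷ a) ⟧ * nodTail φ a r ≈
      ∑[ y ∈ allFin K ] ⟦ y ≺? x ⟧ * (∑[ a ∈ wordsᴷ l ] ⟦ dec? (y ∷ a) ⟧ * nodTail (φ ∘ (y ∷_)) a r)
    step l r = R.trans (∑-words-suc (allFin K) l _) (∑-cong (allFin K) λ y → R.trans
      (∑-cong (wordsᴷ l) λ a → ⟦⟧-×* (y ≺? x) (dec? (y ∷ a)) _)
      (∑-*ˡ ⟦ y ≺? x ⟧ _ (wordsᴷ l)))

    descend : alt k (λ l r → ∑[ a ∈ wordsᴷ (suc l) ] ⟦ dec? (x ∷ a) ⟧ * nodTail φ a r) ≈
      ∑[ y ∈ allFin K ] ⟦ y ≺? x ⟧ * T y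
    descend = begin
      alt k (λ l r → ∑[ a ∈ wordsᴷ (suc l) ] ⟦ dec? (x ∷ a) ⟧ * nodTail φ a r)
        ≈⟨ alt-cong k step ⟩
      _ ≈⟨ alt-∑ k (λ y → ⟦ y ≺? x ⟧) _ (allFin K) ⟩
      _ ≈⟨ ∑-cong (allFin K) (λ y → *-congˡ (alt-dec-nod y k (φ ∘ (y ∷_)))) ⟩
      ∑[ y ∈ allFin K ] ⟦ y ≺? x ⟧ * T y ∎

    ascend : ∑[ w ∈ wordsᴷ (suc k) ] ⟦ nod? (x ∷ w) ⟧ * φ w ≈ ∑[ y ∈ allFin K ] ⟦ ¬? (y ≺? x) ⟧ * T y
    ascend = R.trans (∑-words-suc (allFin K) k _) (∑-cong (allFin K) λ y → R.trans
      (∑-cong (wordsᴷ k) λ w → ⟦⟧-×* (¬? (y ≺? x)) (nod? (y ∷ w)) _)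
      (∑-*ˡ ⟦ ¬? (y ≺? x) ⟧ _ (wordsᴷ k)))

  -- The term l = 0 consists of all descent-free words. In the other terms the decreasing part
  -- starts with some y, and telescoping below y leaves each descent-free word that starts with y,
  -- so everything cancels.
  alt-dec-nod₀ : ∀ k φ → alt (suc k) (λ l r → ∑[ a ∈ wordsᴷ l ] ⟦ dec? a ⟧ * nodTail φ a r) ≈ 0#
  alt-dec-nod₀ k φ = +⇒- (begin
    1# * nodTail φ [] (suc k) + 0#
      ≈⟨ R.trans (+-identityʳ _) (*-identityˡ _) ⟩
    ∑[ w ∈ wordsᴷ (suc k) ] ⟦ nod? w ⟧ * φ w
      ≈⟨ ∑-words-suc (allFin K) k _ ⟩
    ∑[ y ∈ allFin K ] ∑[ w ∈ wordsᴷ k ] ⟦ nod? (y ∷ w) ⟧ * φ (y ∷ w)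
      ≈⟨ ∑-cong (allFin K) (λ y → R.trans (sym (*-identityˡ _)) (*-congˡ (sym (alt-dec-nod y k (φ ∘ (y ∷_)))))) ⟩
    _ ≈⟨ alt-∑ k (λ _ → 1#) _ (allFin K) ⟨
    _ ≈⟨ alt-cong k (λ l r → R.trans (∑-cong (allFin K) (λ y → *-identityˡ _)) (sym (∑-words-suc (allFin K) l _))) ⟩
    alt k (λ l r → ∑[ a ∈ wordsᴷ (suc l) ] ⟦ dec? a ⟧ * nodTail φ a r)
      ≈⟨ +-identityʳ _ ⟨
    alt k (λ l r → ∑[ a ∈ wordsᴷ (suc l) ] ⟦ dec? a ⟧ * nodTail φ a r) + 0# ∎)

  G-alternating : ∀ φ u k v → alt (suc k) (λ l r → G φ (u ++ (𝕖 , l) ∷ (𝕙 , r) ∷ v)) ≈ 0#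
  G-alternating φ [] k v = R.trans (alt-cong (suc k) factor) (alt-dec-nod₀ k (λ w′ → G (φ ∘ (w′ ++_)) v))
    where
    factor : ∀ l r → G φ ((𝕖 , l) ∷ (𝕙 , r) ∷ v) ≈
      ∑[ a ∈ wordsᴷ l ] ⟦ dec? a ⟧ * nodTail (λ w′ → G (φ ∘ (w′ ++_)) v) a r
    factor l r = ∑-cong (wordsᴷ l) λ a → *-congˡ (∑-cong (wordsᴷ r) λ b → *-congˡ
      (G-cong v λ w → reflexive (≡.cong φ (≡.sym (++-assoc a b w)))))
  G-alternating φ ((c , i) ∷ u) k v = R.trans
    (alt-∑ (suc k) (χ c) (λ a l r → G (φ ∘ (a ++_)) (u ++ (𝕖 , l) ∷ (𝕙 , r) ∷ v)) (wordsᴷ i))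
    (∑-zero (wordsᴷ i) λ a → R.trans (*-congˡ (G-alternating (φ ∘ (a ++_)) u k v)) (zeroʳ _))

  G-super : ∀ φ → Super (G φ)
  G-super φ = record { alternating = G-alternating φ ; removable = G-removable φ }

  E₂ : (List (Fin K) → Carrier) → ℕ → ℕ → Carrier
  E₂ φ i j = ∑[ a ∈ wordsᴷ i ] ⟦ dec? a ⟧ * (∑[ b ∈ wordsᴷ j ] ⟦ dec? b ⟧ * φ (a ++ b))

  -- The context on both sides is what makes the property usable in the middle of a product: u
  -- stands for the prefix that `G` has absorbed into φ, and v for the words contributed by the
  -- slots after the pair.
  SwapInvariant : (List (Fin K) → Carrier) → Set ℓ
  SwapInvariant φ = ∀ u v i j → E₂ (λ w → φ (u ++ (w ++ v))) i j ≈ E₂ (λ w → φ (u ++ (w ++ v))) j i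

  E₂-cong : ∀ {φ ψ} i j → (∀ w → φ w ≈ ψ w) → E₂ φ i j ≈ E₂ ψ i j
  E₂-cong i j e = ∑-cong (wordsᴷ i) λ a → *-congˡ (∑-cong (wordsᴷ j) λ b → *-congˡ (e (a ++ b)))

  swapInvariant-++ : ∀ φ a → SwapInvariant φ → SwapInvariant (φ ∘ (a ++_))
  swapInvariant-++ φ a inv u v i j = R.trans (E₂-cong i j e) (R.trans (inv (a ++ u) v i j) (E₂-cong j i (sym ∘ e)))
    where
    e : ∀ w → φ (a ++ (u ++ (w ++ v))) ≈ φ ((a ++ u) ++ (w ++ v))
    e w = reflexive (≡.cong φ (≡.sym (++-assoc a u (w ++ v))))

  -- The quantification over φ is needed because `G` replaces φ by `φ ∘ (a ++_)` whenever it passes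
  -- a slot.
  Commute : Slot → Slot → Set (c Level.⊔ ℓ)
  Commute x y = ∀ φ → SwapInvariant φ → ∀ s → G φ (x ∷ y ∷ s) ≈ G φ (y ∷ x ∷ s)

  commute-𝕖𝕖 : ∀ i j → Commute (𝕖 , i) (𝕖 , j)
  commute-𝕖𝕖 i j φ inv s = R.trans (asE₂ i j)
    (R.trans (G-cong s λ w → inv [] w i j) (sym (asE₂ j i)))
    where
    asE₂ : ∀ i j → G φ ((𝕖 , i) ∷ (𝕖 , j) ∷ s) ≈ G (λ w → E₂ (λ w′ → φ (w′ ++ w)) i j) s
    asE₂ i j = sym (begin
      G (λ w → E₂ (λ w′ → φ (w′ ++ w)) i j) s
        ≈⟨ G-∑ (λ a → ⟦ dec? a ⟧) (λ a w → ∑[ b ∈ wordsᴷ j ] ⟦ dec? b ⟧ * φ ((a ++ b) ++ w)) (wordsᴷ i) s ⟩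
      _ ≈⟨ ∑-cong (wordsᴷ i) (λ a → *-congˡ (G-∑ (λ b → ⟦ dec? b ⟧) (λ b w → φ ((a ++ b) ++ w)) (wordsᴷ j) s)) ⟩
      _ ≈⟨ ∑-cong (wordsᴷ i) (λ a → *-congˡ (∑-cong (wordsᴷ j) λ b → *-congˡ (G-cong s λ w →
             reflexive (≡.cong φ (++-assoc a b w))))) ⟩
      G φ ((𝕖 , i) ∷ (𝕖 , j) ∷ s) ∎)

  -- hᵢ is a combination of the words eₗ hᵢ₋ₗ with l ≥ 1.
  commute-𝕙 : ∀ x → (∀ l → Commute (𝕖 , l) x) → ∀ i → Commute (𝕙 , i) x
  commute-𝕙 x comm i = go i i ℕₚ.≤-refl
    where
    -- The relation for h_{k+1} refers to every h_r with r ≤ k, so the recursion runs on a bound n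
    -- instead of on i.
    go : ∀ n i → i ℕ.≤ n → Commute (𝕙 , i) x
    go n zero _ φ inv s = R.trans (G-removable φ [] 𝕙 (x ∷ s)) (sym (G-removable φ (x ∷ []) 𝕙 s))
    go (suc n) (suc k) (ℕ.s≤s k≤n) φ inv s = begin
      G φ ((𝕙 , suc k) ∷ x ∷ s)
        ≈⟨ G-removable φ [] 𝕖 ((𝕙 , suc k) ∷ x ∷ s) ⟨
      G φ ((𝕖 , 0) ∷ (𝕙 , suc k) ∷ x ∷ s)
        ≈⟨ -⇒≈ (G-alternating φ [] k (x ∷ s)) ⟩
      alt k (λ l r → G φ ((𝕖 , suc l) ∷ (𝕙 , r) ∷ x ∷ s))
        ≈⟨ alt-cong≤ k (λ l r r≤k → ∑-cong (wordsᴷ (suc l)) λ a → *-congˡ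
             (go n r (ℕₚ.≤-trans r≤k k≤n) (φ ∘ (a ++_)) (swapInvariant-++ φ a inv) s)) ⟩
      alt k (λ l r → G φ ((𝕖 , suc l) ∷ x ∷ (𝕙 , r) ∷ s))
        ≈⟨ alt-cong k (λ l r → comm (suc l) φ inv ((𝕙 , r) ∷ s)) ⟩
      alt k (λ l r → G φ (x ∷ (𝕖 , suc l) ∷ (𝕙 , r) ∷ s))
        ≈⟨ -⇒≈ (G-alternating φ (x ∷ []) k s) ⟨
      G φ (x ∷ (𝕖 , 0) ∷ (𝕙 , suc k) ∷ s)
        ≈⟨ G-removable φ (x ∷ []) 𝕖 ((𝕙 , suc k) ∷ s) ⟩
      G φ (x ∷ (𝕙 , suc k) ∷ s) ∎

  commute-𝕖𝕙 : ∀ i j → Commute (𝕖 , i) (𝕙 , j)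
  commute-𝕖𝕙 i j φ inv s = sym (commute-𝕙 (𝕖 , i) (λ l → commute-𝕖𝕖 l i) j φ inv s)

  commute : ∀ x y → Commute x y
  commute (𝕖 , i) (𝕖 , j) = commute-𝕖𝕖 i j
  commute (𝕖 , i) (𝕙 , j) = commute-𝕖𝕙 i j
  commute (𝕙 , i) (𝕖 , j) = commute-𝕙 (𝕖 , j) (λ l → commute-𝕖𝕖 l j) i
  commute (𝕙 , i) (𝕙 , j) = commute-𝕙 (𝕙 , j) (λ l → commute-𝕖𝕙 l j) i

  G-↭ : ∀ φ → SwapInvariant φ → ∀ {s s′} → s ↭ s′ → G φ s ≈ G φ s′
  G-↭ φ inv refl = R.refl
  G-↭ φ inv (prep (c , i) r) =
    ∑-cong (wordsᴷ i) λ a → *-congˡ (G-↭ (φ ∘ (a ++_)) (swapInvariant-++ φ a inv) r)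
  G-↭ φ inv (swap {xs} x@(c , i) y@(d , j) r) = R.trans (commute x y φ inv xs)
    (∑-cong (wordsᴷ j) λ b → *-congˡ (∑-cong (wordsᴷ i) λ a → *-congˡ
      (G-↭ (φ ∘ (b ++_) ∘ (a ++_)) (swapInvariant-++ (φ ∘ (b ++_)) a (swapInvariant-++ φ b inv)) r)))
  G-↭ φ inv (trans r r′) = R.trans (G-↭ φ inv r) (G-↭ φ inv r′)

-- The ways to take some of i boxes: an 𝕙-slot gives up at most one of them.
choices : Kind → ℕ → List (ℕ × ℕ)
choices c zero    = (0 , 0) ∷ []
choices 𝕖 (suc i) = (0 , suc i) ∷ map (map₁ suc) (choices 𝕖 i)
choices 𝕙 (suc i) = (0 , suc i) ∷ (1 , i) ∷ []

choices-sum : ∀ c i → All (λ (j , r) → j ℕ.+ r ≡ i) (choices c i)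
choices-sum 𝕖 zero    = ≡.refl ∷ []
choices-sum 𝕙 zero    = ≡.refl ∷ []
choices-sum 𝕖 (suc i) = ≡.refl ∷ Allₚ.map⁺ (All.map (≡.cong suc) (choices-sum 𝕖 i))
choices-sum 𝕙 (suc i) = ≡.refl ∷ ≡.refl ∷ []

hslots eslots : List ℕ → List Slot
hslots = map (𝕙 ,_)
eslots = map (𝕖 ,_)

total-hslots : ∀ xs → total (hslots xs) ≡ sumᴸ xs
total-hslots []       = ≡.refl
total-hslots (x ∷ xs) = ≡.cong (x ℕ.+_) (total-hslots xs)

positives : List ℕ → List ℕ
positives []           = []
positives (zero  ∷ xs) = positives xs
positives (suc x ∷ xs) = suc x ∷ positives xs

length-positives : ∀ xs → length (positives xs) ℕ.≤ sumᴸ xs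
length-positives []           = ℕ.z≤n
length-positives (zero  ∷ xs) = length-positives xs
length-positives (suc x ∷ xs) = ℕ.s≤s (ℕₚ.≤-trans (length-positives xs) (ℕₚ.m≤n+m _ x))

sum-map-suc : ∀ xs → sumᴸ (map suc xs) ≡ length xs ℕ.+ sumᴸ xs
sum-map-suc []       = ≡.refl
sum-map-suc (x ∷ xs) = ≡.cong suc (≡.trans (≡.cong (x ℕ.+_) (sum-map-suc xs)) (lemma x (length xs) (sumᴸ xs)))
  where
  lemma : ∀ a b d → a ℕ.+ (b ℕ.+ d) ≡ b ℕ.+ (a ℕ.+ d)
  lemma = solve-∀

positive-or-zero : ∀ xs → (∃ λ ys → xs ≡ map suc ys) ⊎ (∃ λ ys → xs ↭ 0 ∷ ys)
positive-or-zero []           = inj₁ ([] , ≡.refl)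
positive-or-zero (zero  ∷ xs) = inj₂ (xs , refl)
positive-or-zero (suc x ∷ xs) with positive-or-zero xs
... | inj₁ (ys , eq) = inj₁ (x ∷ ys , ≡.cong (suc x ∷_) eq)
... | inj₂ (ys , r)  = inj₂ (suc x ∷ ys , trans (prep (suc x) r) (swap (suc x) 0 refl))

-- Superfunctions and the fundamental theorem

module Superfunctions {c ℓ} (R : CommutativeRing c ℓ) where
  open CommutativeRing R hiding (refl; trans; zero)
  private module R = CommutativeRing R
  open Sum commutativeSemiring
  open Alternating R
  open import Algebra.Properties.AbelianGroup +-abelianGroup using (⁻¹-∙-comm; ∙-cancelˡ; ⁻¹-injective)
  open import Algebra.Properties.Ring ring using (x[y-z]≈xy-xz)
  open import Algebra.Properties.CommutativeSemigroup +-commutativeSemigroup using (interchange)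
  open import Algebra.Properties.CommutativeSemigroup *-commutativeSemigroup using (x∙yz≈y∙xz)
  open import Relation.Binary.Reasoning.Setoid setoid

  alt-∑₁ : ∀ {a} {A : Set a} k (g : A → ℕ → ℕ → Carrier) xs →
    alt k (λ l r → ∑[ x ∈ xs ] g x l r) ≈ ∑[ x ∈ xs ] alt k (g x)
  alt-∑₁ k g xs = R.trans (alt-cong k λ l r → ∑-cong xs λ x → sym (*-identityˡ _))
    (R.trans (alt-∑ k (λ _ → 1#) g xs) (∑-cong xs λ x → *-identityˡ _))

  sub-+ : ∀ x y u v → (x + y) - (u + v) ≈ (x - u) + (y - v)
  sub-+ x y u v = R.trans (+-congˡ (sym (⁻¹-∙-comm u v))) (interchange x y (- u) (- v))

  alt-+ : ∀ k (g g′ : ℕ → ℕ → Carrier) → alt k (λ l r → g l r + g′ l r) ≈ alt k g + alt k g′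
  alt-+ zero    g g′ = R.refl
  alt-+ (suc k) g g′ = R.trans (+-congˡ (-‿cong (alt-+ k (λ l → g (suc l)) (λ l → g′ (suc l))))) (sub-+ _ _ _ _)

  -- Separates the choice of taking a box from an 𝕙-slot. That choice exists only for r > 0 and
  -- leaves r - 1 boxes, so its part n is summed in degree k.
  alt-shift : ∀ k (g m n : ℕ → ℕ → Carrier) →
    (∀ l → g l 0 ≈ m l 0) → (∀ l r → g l (suc r) ≈ m l (suc r) + n l r) →
    alt (suc k) g ≈ alt (suc k) m + alt k n
  alt-shift zero g m n g0 gs = begin
    g 0 1 - g 1 0             ≈⟨ -‿cong₂ (gs 0 0) (g0 1) ⟩
    (m 0 1 + n 0 0) - m 1 0   ≈⟨ +-assoc _ _ _ ⟩
    m 0 1 + (n 0 0 - m 1 0)   ≈⟨ +-congˡ (+-comm _ _) ⟩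
    m 0 1 + (- m 1 0 + n 0 0) ≈⟨ +-assoc _ _ _ ⟨
    (m 0 1 - m 1 0) + n 0 0 ∎
  alt-shift (suc k) g m n g0 gs = R.trans
    (-‿cong₂ (gs 0 (suc k)) (alt-shift k (g ∘ suc) (m ∘ suc) (n ∘ suc) (g0 ∘ suc) (gs ∘ suc)))
    (sub-+ _ _ _ _)

  -- The last term enters with coefficient 1 or -1, so a relation determines it from the others; in
  -- this way e_k is recovered from the e_l with l < k.
  alt-last : ∀ k {g g′ : ℕ → ℕ → Carrier} → alt k g ≈ alt k g′ →
    (∀ l r → l ℕ.< k → g l r ≈ g′ l r) → g k 0 ≈ g′ k 0
  alt-last zero    e _ = e
  alt-last (suc k) {g} {g′} e lt = alt-last k
    (⁻¹-injective (∙-cancelˡ (g 0 (suc k)) _ _ (R.trans e (+-congʳ (sym (lt 0 (suc k) ℕ.z<s))))))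
    (λ l r l<k → lt (suc l) r (ℕ.s<s l<k))

  -- For p = [n = j] this is multiplication by the superfunction that is e_n on 𝕙-slots and h_n on
  -- 𝕖-slots: `choices` says how many boxes a slot gives to that factor, p sees only their total,
  -- and g receives the boxes that remain. A general p is needed since each choice shifts its
  -- argument.
  mul : (ℕ → Carrier) → (List Slot → Carrier) → List Slot → Carrier
  mul p g []            = p 0 * g []
  mul p g ((c , i) ∷ s) = ∑[ x ∈ choices c i ] mul (p ∘ (proj₁ x ℕ.+_)) (g ∘ ((c , proj₂ x) ∷_)) s

  mul-cong : ∀ {p p′ g g′} s → (∀ n → p n ≈ p′ n) → (∀ s → g s ≈ g′ s) → mul p g s ≈ mul p′ g′ s
  mul-cong []            ep eg = *-cong (ep 0) (eg [])
  mul-cong ((c , i) ∷ s) ep eg = ∑-cong (choices c i) λ (j , r) →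
    mul-cong s (ep ∘ (j ℕ.+_)) (eg ∘ ((c , r) ∷_))

  mul-zero : ∀ {p g} s → (∀ j s′ → j ℕ.+ total s′ ≡ total s → p j * g s′ ≈ 0#) → mul p g s ≈ 0#
  mul-zero []            e = e 0 [] ≡.refl
  mul-zero ((c , i) ∷ s) e = R.trans
    (∑-congAll (All.map (λ {(j , r)} j+r≡i → mul-zero s λ j′ s′ eq → e (j ℕ.+ j′) ((c , r) ∷ s′)
      (≡.trans (lemma j j′ r (total s′)) (≡.cong₂ ℕ._+_ j+r≡i eq))) (choices-sum c i)))
    (∑-zero (choices c i) (λ _ → R.refl))
    where
    lemma : ∀ a b d f → (a ℕ.+ b) ℕ.+ (d ℕ.+ f) ≡ (a ℕ.+ d) ℕ.+ (b ℕ.+ f)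
    lemma = solve-∀

  mul-∑ : ∀ {a} {A : Set a} p (u : A → Carrier) (g : A → List Slot → Carrier) xs s →
    mul p (λ s → ∑[ x ∈ xs ] u x * g x s) s ≈ ∑[ x ∈ xs ] u x * mul p (g x) s
  mul-∑ p u g xs [] = R.trans (sym (∑-*ˡ (p 0) _ xs)) (∑-cong xs λ x → x∙yz≈y∙xz _ _ _)
  mul-∑ p u g xs ((c , i) ∷ s) = R.trans
    (∑-cong (choices c i) λ (j , r) → mul-∑ (p ∘ (j ℕ.+_)) u (λ x → g x ∘ ((c , r) ∷_)) xs s)
    (R.trans (∑-comm _ (choices c i) xs) (∑-cong xs λ x → ∑-*ˡ (u x) _ (choices c i)))

  mul-sub : ∀ p g g′ s → mul p (λ s → g s - g′ s) s ≈ mul p g s - mul p g′ s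
  mul-sub p g g′ []            = x[y-z]≈xy-xz (p 0) (g []) (g′ [])
  mul-sub p g g′ ((c , i) ∷ s) = R.trans
    (∑-cong (choices c i) λ (j , r) → mul-sub (p ∘ (j ℕ.+_)) (g ∘ ((c , r) ∷_)) (g′ ∘ ((c , r) ∷_)) s)
    (∑-sub _ _ (choices c i))

  mul-alt : ∀ k p (g : ℕ → ℕ → List Slot → Carrier) s →
    mul p (λ s → alt k (λ l r → g l r s)) s ≈ alt k (λ l r → mul p (g l r) s)
  mul-alt zero    p g s = R.refl
  mul-alt (suc k) p g s = R.trans (mul-sub p (g 0 (suc k)) _ s)
    (+-congˡ (-‿cong (mul-alt k p (λ l → g (suc l)) s)))

  -- On balance the first two slots give up no boxes: with signs, the 𝕖-slot contributes ∑ (-y)ʲ and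
  -- the 𝕙-slot 1 + y, and these are inverse to each other. In the induction on k, the terms with a
  -- box from the 𝕙-slot cancel those with at least one box from the 𝕖-slot.
  alt-mul : ∀ k p g s →
    alt k (λ l r → mul p g ((𝕖 , l) ∷ (𝕙 , r) ∷ s)) ≈
    alt k (λ l r → mul p (λ s → g ((𝕖 , l) ∷ (𝕙 , r) ∷ s)) s)
  alt-mul zero    p g s = R.trans (+-identityʳ _) (+-identityʳ _)
  alt-mul (suc k) p g s = begin
    M p 0 (suc k) - alt k (λ l r → M p (suc l) r)
      ≈⟨ -‿cong₂ (+-identityʳ _) (R.trans (alt-cong k take𝕖) (alt-+ k _ _)) ⟩
    Mₕ p 0 (suc k) - (alt k (λ l r → Mₕ p (suc l) r) + alt k (M (p ∘ suc)))
      ≈⟨ R.trans (+-congˡ (sym (⁻¹-∙-comm _ _))) (sym (+-assoc _ _ _)) ⟩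
    alt (suc k) (Mₕ p) - alt k (M (p ∘ suc))
      ≈⟨ -‿cong₂ (alt-shift k (Mₕ p) (m p) (m (p ∘ suc)) (λ l → +-identityʳ _) (λ l r → +-congˡ (+-identityʳ _)))
           (alt-mul k (p ∘ suc) g s) ⟩
    (alt (suc k) (m p) + alt k (m (p ∘ suc))) - alt k (m (p ∘ suc))
      ≈⟨ +⇒- (+-comm _ _) ⟩
    alt (suc k) (m p) ∎
    where
    m Mₕ M : (ℕ → Carrier) → ℕ → ℕ → Carrier
    m  p l r = mul p (λ s → g ((𝕖 , l) ∷ (𝕙 , r) ∷ s)) s
    Mₕ p l r = mul p (λ s → g ((𝕖 , l) ∷ s)) ((𝕙 , r) ∷ s)
    M  p l r = mul p g ((𝕖 , l) ∷ (𝕙 , r) ∷ s)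
    take𝕖 : ∀ l r → M p (suc l) r ≈ Mₕ p (suc l) r + M (p ∘ suc) l r
    take𝕖 l r = +-congˡ (∑-map (map₁ suc) _ (choices 𝕖 l))

  super-∷ : ∀ {g} x → Super g → Super (g ∘ (x ∷_))
  super-∷ x sg = record
    { alternating = λ u → Super.alternating sg (x ∷ u)
    ; removable   = λ u → Super.removable sg (x ∷ u) }

  mul-super : ∀ p {g} → Super g → Super (mul p g)
  mul-super p {g} sg = record { alternating = alternating p sg ; removable = removable p sg }
    where
    alternating : ∀ p {g} → Super g → ∀ u k v →
      alt (suc k) (λ l r → mul p g (u ++ (𝕖 , l) ∷ (𝕙 , r) ∷ v)) ≈ 0#
    alternating p {g} sg [] k v = begin
      alt (suc k) (λ l r → mul p g ((𝕖 , l) ∷ (𝕙 , r) ∷ v))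
        ≈⟨ alt-mul (suc k) p g v ⟩
      alt (suc k) (λ l r → mul p (λ s → g ((𝕖 , l) ∷ (𝕙 , r) ∷ s)) v)
        ≈⟨ mul-alt (suc k) p (λ l r s → g ((𝕖 , l) ∷ (𝕙 , r) ∷ s)) v ⟨
      mul p (λ s → alt (suc k) (λ l r → g ((𝕖 , l) ∷ (𝕙 , r) ∷ s))) v
        ≈⟨ mul-zero v (λ j s _ → R.trans (*-congˡ (Super.alternating sg [] k s)) (zeroʳ _)) ⟩
      0# ∎
    alternating p {g} sg ((c , i) ∷ u) k v = R.trans
      (alt-∑₁ (suc k) (λ (j , q) l r → mul (p ∘ (j ℕ.+_)) (g ∘ ((c , q) ∷_)) (u ++ (𝕖 , l) ∷ (𝕙 , r) ∷ v)) (choices c i))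
      (∑-zero (choices c i) λ (j , r) → alternating (p ∘ (j ℕ.+_)) (super-∷ (c , r) sg) u k v)
    removable : ∀ p {g} → Super g → ∀ u c v → mul p g (u ++ (c , 0) ∷ v) ≈ mul p g (u ++ v)
    removable p sg []            c v = R.trans (+-identityʳ _)
      (mul-cong v (λ _ → R.refl) (Super.removable sg [] c))
    removable p sg ((d , i) ∷ u) c v = ∑-cong (choices d i) λ (j , r) →
      removable (p ∘ (j ℕ.+_)) (super-∷ (d , r) sg) u c v

  Symmetric : ∀ {a} {A : Set a} → (List A → Carrier) → Set _
  Symmetric f = ∀ {s s′} → s ↭ s′ → f s ≈ f s′

  mul-symmetric : ∀ p {g} → Symmetric g → Symmetric (mul p g)
  mul-symmetric p sg refl = R.refl
  mul-symmetric p sg (prep (c , i) r) = ∑-cong (choices c i) λ (j , q) →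
    mul-symmetric (p ∘ (j ℕ.+_)) (sg ∘ prep (c , q)) r
  mul-symmetric p {g} sg (swap {xs} {ys} (c , i) (d , j) r) = begin
    _ ≈⟨ ∑-comm _ (choices c i) (choices d j) ⟩
    _ ≈⟨ ∑-cong (choices d j) (λ (b , q′) → ∑-cong (choices c i) λ (a , q) → R.trans
           (mul-cong xs (λ n → reflexive (≡.cong p (lemma a b n))) (λ s → sg (swap (c , q) (d , q′) refl)))
           (mul-symmetric (p ∘ (b ℕ.+_) ∘ (a ℕ.+_)) (sg ∘ prep (d , q′) ∘ prep (c , q)) r)) ⟩
    mul p g ((d , j) ∷ (c , i) ∷ ys) ∎
    where
    lemma : ∀ a b n → a ℕ.+ (b ℕ.+ n) ≡ b ℕ.+ (a ℕ.+ n)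
    lemma = solve-∀
  mul-symmetric p sg (trans r r′) = R.trans (mul-symmetric p sg r) (mul-symmetric p sg r′)

  -- On 𝕙-slots this is the coefficient of e_λ, and on 𝕖-slots that of h_λ.
  elementary : List ℕ → List Slot → Carrier
  elementary []       s = ⟦ 0 ℕ.≟ total s ⟧
  elementary (n ∷ ns)   = mul (λ j → ⟦ n ℕ.≟ j ⟧) (elementary ns)

  total-++ : ∀ u v → total (u ++ v) ≡ total u ℕ.+ total v
  total-++ []            v = ≡.refl
  total-++ ((_ , i) ∷ u) v = ≡.trans (≡.cong (i ℕ.+_) (total-++ u v)) (≡.sym (ℕₚ.+-assoc i (total u) (total v)))

  total-↭ : ∀ {s s′} → s ↭ s′ → total s ≡ total s′
  total-↭ refl = ≡.refl
  total-↭ (prep (_ , i) r) = ≡.cong (i ℕ.+_) (total-↭ r)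
  total-↭ (swap {xs} (_ , i) (_ , j) r) =
    ≡.trans (lemma i j (total xs)) (≡.cong (λ n → j ℕ.+ (i ℕ.+ n)) (total-↭ r))
    where
    lemma : ∀ a b n → a ℕ.+ (b ℕ.+ n) ≡ b ℕ.+ (a ℕ.+ n)
    lemma = solve-∀
  total-↭ (trans r r′) = ≡.trans (total-↭ r) (total-↭ r′)

  elementary-super : ∀ ns → Super (elementary ns)
  elementary-super (n ∷ ns) = mul-super _ (elementary-super ns)
  elementary-super []       = record
    -- The two slots of the relation hold k + 1 > 0 boxes in every term, so no total is 0 and each
    -- term vanishes by itself.
    { alternating = λ u k v → R.trans
        (alt-const (suc k) (λ l r → ⟦ 0 ℕ.≟ total (u ++ (𝕖 , l) ∷ (𝕙 , r) ∷ v) ⟧) λ l r eq →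
          ⟦⟧-false (0 ℕ.≟ _) λ eq′ → 0≢ u v l r k eq (≡.trans eq′ (total-++ u _)))
        R.refl
    ; removable   = λ u c v → reflexive (≡.cong (λ n → ⟦ 0 ℕ.≟ n ⟧)
        (≡.trans (total-++ u ((c , 0) ∷ v)) (≡.sym (total-++ u v)))) }
    where
    alt-const : ∀ k (g : ℕ → ℕ → Carrier) → (∀ l r → l ℕ.+ r ≡ k → g l r ≈ 0#) → alt k g ≈ 0#
    alt-const zero    g e = e 0 0 ≡.refl
    alt-const (suc k) g e = R.trans
      (-‿cong₂ (e 0 (suc k) ≡.refl) (alt-const k (λ l → g (suc l)) (λ l r eq → e (suc l) r (≡.cong suc eq))))
      0-0≈0
    0≢ : ∀ u v l r k → l ℕ.+ r ≡ suc k → 0 ≢ total u ℕ.+ (l ℕ.+ (r ℕ.+ total v))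
    0≢ u v l r k eq 0≡ with () ← ≡.trans (≡.sym eq) (ℕₚ.m+n≡0⇒m≡0 (l ℕ.+ r) {total v}
      (≡.trans (ℕₚ.+-assoc l r (total v)) (ℕₚ.m+n≡0⇒n≡0 (total u) (≡.sym 0≡))))

  elementary-symmetric : ∀ ns → Symmetric (elementary ns)
  elementary-symmetric []       r = reflexive (≡.cong (λ n → ⟦ 0 ℕ.≟ n ⟧) (total-↭ r))
  elementary-symmetric (n ∷ ns) r = mul-symmetric _ (elementary-symmetric ns) r

  elementary-degree : ∀ ns s → sumᴸ ns ≢ total s → elementary ns s ≈ 0#
  elementary-degree []       s ne = ⟦⟧-false (0 ℕ.≟ total s) ne
  elementary-degree (n ∷ ns) s ne = mul-zero s λ j s′ eq → R.trans
    (guard (n ℕ.≟ j) λ n≡j → elementary-degree ns s′ λ eq′ → ne (≡.trans (≡.cong₂ ℕ._+_ n≡j eq′) eq))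
    (zeroʳ _)

  -- An 𝕙-slot gives up at most one box, so k boxes are taken from k slots in only one way.
  mul-few : ∀ k g xs → length xs ℕ.< k → mul (λ j → ⟦ k ℕ.≟ j ⟧) g (hslots xs) ≈ 0#
  mul-few (suc k) g []           _            = zeroˡ _
  mul-few (suc k) g (zero  ∷ xs) (ℕ.s<s lt)   = R.trans (+-identityʳ _)
    (mul-few (suc k) (g ∘ ((𝕙 , 0) ∷_)) xs (ℕₚ.m<n⇒m<1+n lt))
  mul-few (suc k) g (suc x ∷ xs) (ℕ.s<s lt)   = R.trans
    (+-cong (mul-few (suc k) (g ∘ ((𝕙 , suc x) ∷_)) xs (ℕₚ.m<n⇒m<1+n lt))
      (R.trans (+-identityʳ _) (R.trans
        (mul-cong (hslots xs) (λ j → ⟦⟧-cong ℕₚ.suc-injective (≡.cong suc) (suc k ℕ.≟ suc j) (k ℕ.≟ j)) (λ _ → R.refl))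
        (mul-few k (g ∘ ((𝕙 , x) ∷_)) xs lt))))
    (+-identityˡ 0#)

  mul-all : ∀ k g xs → length xs ≡ k →
    mul (λ j → ⟦ k ℕ.≟ j ⟧) g (hslots (map suc xs)) ≈ g (hslots xs)
  mul-all zero    g []       ≡.refl = *-identityˡ _
  mul-all (suc k) g (x ∷ xs) eq     = R.trans
    (+-cong (mul-few (suc k) (g ∘ ((𝕙 , suc x) ∷_)) (map suc xs) (ℕₚ.≤-reflexive (≡.trans (≡.cong suc (length-map suc xs)) eq)))
      (R.trans (+-identityʳ _) (R.trans
        (mul-cong (hslots (map suc xs)) (λ j → ⟦⟧-cong ℕₚ.suc-injective (≡.cong suc) (suc k ℕ.≟ suc j) (k ℕ.≟ j)) (λ _ → R.refl))
        (mul-all k (g ∘ ((𝕙 , x) ∷_)) xs (ℕₚ.suc-injective eq)))))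
    (+-identityˡ _)

  -- A relation expresses e_{k+1} through the products e_l h_{k+1-l} with l ≤ k, so 𝕖-slots can be
  -- eliminated. The elimination inserts a new 𝕙-slot before the tail v; `P v` therefore ranges over
  -- all 𝕙-prefixes, so that such a slot can be moved into the prefix.
  super-unique : ∀ {f f′} → Super f → Super f′ →
    (∀ xs → f (hslots xs) ≈ f′ (hslots xs)) → ∀ s → f s ≈ f′ s
  super-unique {f} {f′} sf sf′ agree s = agreeAt s []
    where
    module f = Super sf
    module f′ = Super sf′

    P : List Slot → Set ℓ
    P v = ∀ xs → f (hslots xs ++ v) ≈ f′ (hslots xs ++ v)

    P-𝕙 : ∀ i {v} → P v → P ((𝕙 , i) ∷ v)
    P-𝕙 i {v} pv xs = ≡.subst (λ s → f s ≈ f′ s) eq (pv (xs ++ i ∷ []))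
      where
      eq : hslots (xs ++ i ∷ []) ++ v ≡ hslots xs ++ (𝕙 , i) ∷ v
      eq = ≡.trans (≡.cong (_++ v) (map-++ (𝕙 ,_) xs (i ∷ []))) (++-assoc (hslots xs) _ v)

    P-𝕖 : ∀ n j → j ℕ.≤ n → ∀ {v} → P v → P ((𝕖 , j) ∷ v)
    P-𝕖 n zero _ {v} pv xs = R.trans (f.removable (hslots xs) 𝕖 v)
      (R.trans (pv xs) (sym (f′.removable (hslots xs) 𝕖 v)))
    P-𝕖 (suc n) (suc k) (ℕ.s≤s k≤n) {v} pv xs = begin
      f (u ++ (𝕖 , suc k) ∷ v)
        ≈⟨ remove₀ sf ⟨
      f (u ++ (𝕖 , suc k) ∷ (𝕙 , 0) ∷ v)
        ≈⟨ alt-last (suc k) (R.trans (f.alternating u k v) (sym (f′.alternating u k v)))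
             (λ l r l≤k → P-𝕖 n l (ℕₚ.≤-trans (ℕ.s≤s⁻¹ l≤k) k≤n) (P-𝕙 r pv) xs) ⟩
      f′ (u ++ (𝕖 , suc k) ∷ (𝕙 , 0) ∷ v)
        ≈⟨ remove₀ sf′ ⟩
      f′ (u ++ (𝕖 , suc k) ∷ v) ∎
      where
      u = hslots xs
      remove₀ : ∀ {f} → Super f → f (u ++ (𝕖 , suc k) ∷ (𝕙 , 0) ∷ v) ≈ f (u ++ (𝕖 , suc k) ∷ v)
      remove₀ {f} sf = ≡.subst₂ (λ s s′ → f s ≈ f s′) (++-assoc u _ _) (++-assoc u _ _)
        (Super.removable sf (u ++ (𝕖 , suc k) ∷ []) 𝕙 v)

    agreeAt : ∀ v → P v
    agreeAt [] xs = ≡.subst (λ s → f s ≈ f′ s) (≡.sym (++-identityʳ (hslots xs))) (agree xs)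
    agreeAt ((𝕖 , j) ∷ v) = P-𝕖 j j ℕₚ.≤-refl (agreeAt v)
    agreeAt ((𝕙 , i) ∷ v) = P-𝕙 i (agreeAt v)

  Terms : Set c
  Terms = List (Carrier × List ℕ)

  combination : Terms → List Slot → Carrier
  combination cs s = ∑[ x ∈ cs ] proj₁ x * elementary (proj₂ x) s

  combination-super : ∀ cs → Super (combination cs)
  combination-super cs = record
    { alternating = λ u k v → R.trans
        (alt-∑ (suc k) proj₁ (λ x l r → elementary (proj₂ x) (u ++ (𝕖 , l) ∷ (𝕙 , r) ∷ v)) cs)
        (∑-zero cs λ (_ , ns) → R.trans (*-congˡ (Super.alternating (elementary-super ns) u k v)) (zeroʳ _))
    ; removable   = λ u c v → ∑-cong cs λ (_ , ns) → *-congˡ (Super.removable (elementary-super ns) u c v) }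

  combination-symmetric : ∀ cs → Symmetric (combination cs)
  combination-symmetric cs r = ∑-cong cs λ (_ , ns) → *-congˡ (elementary-symmetric ns r)

  -- Putting the bound k in front of the parts says at once that they decrease weakly and are at
  -- most k, which is what is needed to add k as a new first part.
  PartsBounded : ℕ → ℕ → Carrier × List ℕ → Set
  PartsBounded k N (_ , ns) = Linked ℕ._≥_ (k ∷ ns) × All NonZero ns × sumᴸ ns ℕ.< N

  combination-degree : ∀ {k N cs} → All (PartsBounded k N) cs → ∀ s → N ℕ.≤ total s → combination cs s ≈ 0#
  combination-degree {cs = cs} bs s N≤ = R.trans
    (∑-congAll (All.map (λ {(_ , ns)} (_ , _ , lt) → R.trans
      (*-congˡ (elementary-degree ns s λ eq → ℕₚ.<⇒≱ lt (≡.subst (_ ℕ.≤_) (≡.sym eq) N≤))) (zeroʳ _)) bs))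
    (∑-zero cs λ _ → R.refl)

  -- The fundamental theorem in k variables: subtract the expansion of f with one variable set
  -- to 0; what is left vanishes whenever some variable does, hence is divisible by e_k.
  fundamental : ∀ fuel k N → N ℕ.≤ fuel → (f : List ℕ → Carrier) → Symmetric f →
    (∀ xs → length xs ≡ k → N ℕ.≤ sumᴸ xs → f xs ≈ 0#) →
    ∃ λ cs → All (PartsBounded k N) cs × (∀ xs → length xs ≡ k → f xs ≈ combination cs (hslots xs))
  fundamental fuel k zero _ f sym-f bd = [] , [] , λ xs eq → bd xs eq ℕ.z≤n
  fundamental fuel zero (suc N) _ f sym-f bd =
    (f [] , []) ∷ [] , ([-] , [] , ℕ.z<s) ∷ [] ,
    λ { [] ≡.refl → sym (R.trans (+-identityʳ _) (*-identityʳ _)) }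
  fundamental (suc fuel) (suc k) N@(suc N′) (ℕ.s≤s N′≤fuel) f sym-f bd
    with cs₁ , bs₁ , eq₁ ← fundamental (suc fuel) k N (ℕ.s≤s N′≤fuel) (f ∘ (0 ∷_)) (sym-f ∘ prep 0)
           (λ xs eq → bd (0 ∷ xs) (≡.cong suc eq))
    -- Division by e_{k+1} lowers each of the k + 1 exponents by one: the quotient is read off at
    -- `map suc xs`, and its degree bound drops by k + 1. As k + 1 > 0, the smaller fuel still
    -- suffices.
    with cs₂ , bs₂ , eq₂ ← fundamental fuel (suc k) (N ℕ.∸ suc k)
           (ℕₚ.≤-trans (ℕₚ.m∸n≤m N′ k) N′≤fuel)
           (λ xs → f (map suc xs) - combination cs₁ (hslots (map suc xs)))
           (λ r → -‿cong₂ (sym-f (↭ₚ.map⁺ suc r)) (combination-symmetric cs₁ (↭ₚ.map⁺ (𝕙 ,_) (↭ₚ.map⁺ suc r))))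
           (λ xs eq N∸k≤ → let N≤ = ≡.subst (N ℕ.≤_) (≡.trans (≡.cong (ℕ._+ sumᴸ xs) (≡.sym eq)) (≡.sym (sum-map-suc xs)))
                                       (ℕₚ.≤-trans (ℕₚ.m≤n+m∸n N (suc k)) (ℕₚ.+-monoʳ-≤ (suc k) N∸k≤))
             in R.trans (-‿cong₂ (bd (map suc xs) (≡.trans (length-map suc xs) eq) N≤)
                   (combination-degree bs₁ (hslots (map suc xs)) (≡.subst (N ℕ.≤_) (≡.sym (total-hslots (map suc xs))) N≤)))
                 0-0≈0)
    = cs₁ ++ map raise cs₂ ,
      Allₚ.++⁺ (All.map (λ {x} → weaken x) bs₁) (Allₚ.map⁺ (All.map (λ {x} → raised x) bs₂)) ,
      expands
    where
    raise : Carrier × List ℕ → Carrier × List ℕ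
    raise (r , ns) = r , suc k ∷ ns

    weaken : ∀ x → PartsBounded k N x → PartsBounded (suc k) N x
    weaken _ ([-]     , nz , lt) = [-] , nz , lt
    weaken _ (ge ∷ dn , nz , lt) = ℕₚ.m≤n⇒m≤1+n ge ∷ dn , nz , lt

    raised : ∀ x → PartsBounded (suc k) (N ℕ.∸ suc k) x → PartsBounded (suc k) N (raise x)
    raised _ (dn , nz , lt) = ℕₚ.≤-refl ∷ dn , _ ∷ nz , below lt
      where
      below : ∀ {m} → m ℕ.< N ℕ.∸ suc k → suc k ℕ.+ m ℕ.< N
      below lt = ℕₚ.≰⇒> (ℕₚ.<⇒≱ lt ∘ ℕₚ.m≤n+o⇒m∸n≤o N (suc k))

    split : ∀ xs → combination (cs₁ ++ map raise cs₂) (hslots xs) ≈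
      combination cs₁ (hslots xs) +
      (∑[ x ∈ cs₂ ] proj₁ x * mul (λ j → ⟦ suc k ℕ.≟ j ⟧) (elementary (proj₂ x)) (hslots xs))
    split xs = R.trans (∑-++ _ cs₁ (map raise cs₂)) (+-congˡ (∑-map raise _ cs₂))

    expands : ∀ xs → length xs ≡ suc k → f xs ≈ combination (cs₁ ++ map raise cs₂) (hslots xs)
    expands xs eq with positive-or-zero xs
    ... | inj₁ (ys , ≡.refl) = sym (begin
      combination (cs₁ ++ map raise cs₂) (hslots (map suc ys))
        ≈⟨ split (map suc ys) ⟩
      _ ≈⟨ +-congˡ (∑-cong cs₂ λ (_ , ns) → *-congˡ (mul-all (suc k) (elementary ns) ys |ys|)) ⟩
      combination cs₁ (hslots (map suc ys)) + combination cs₂ (hslots ys)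
        ≈⟨ +-congˡ (eq₂ ys |ys|) ⟨
      combination cs₁ (hslots (map suc ys)) + (f (map suc ys) - combination cs₁ (hslots (map suc ys)))
        ≈⟨ +-comm _ _ ⟩
      (f (map suc ys) - combination cs₁ (hslots (map suc ys))) + combination cs₁ (hslots (map suc ys))
        ≈⟨ R.trans (+-assoc _ _ _) (R.trans (+-congˡ (-‿inverseˡ _)) (+-identityʳ _)) ⟩
      f (map suc ys) ∎)
      where
      |ys| : length ys ≡ suc k
      |ys| = ≡.trans (≡.sym (length-map suc ys)) eq
    -- When some exponent is 0, the terms containing e_{k+1} vanish by `mul-few`, and `cs₁` was
    -- chosen to be right on exactly these monomials.
    ... | inj₂ (ys , r) = begin
      f xs
        ≈⟨ sym-f r ⟩
      f (0 ∷ ys)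
        ≈⟨ eq₁ ys |ys| ⟩
      combination cs₁ (hslots ys)
        ≈⟨ Super.removable (combination-super cs₁) [] 𝕙 (hslots ys) ⟨
      combination cs₁ (hslots (0 ∷ ys))
        ≈⟨ +-identityʳ _ ⟨
      combination cs₁ (hslots (0 ∷ ys)) + 0#
        ≈⟨ +-congˡ (∑-zero cs₂ λ (_ , ns) → R.trans (*-congˡ (R.trans (+-identityʳ _)
             (mul-few (suc k) (elementary ns ∘ ((𝕙 , 0) ∷_)) ys (ℕₚ.≤-reflexive (≡.cong suc |ys|))))) (zeroʳ _)) ⟨
      _ ≈⟨ split (0 ∷ ys) ⟨
      combination (cs₁ ++ map raise cs₂) (hslots (0 ∷ ys))
        ≈⟨ combination-symmetric (cs₁ ++ map raise cs₂) (↭ₚ.map⁺ (𝕙 ,_) r) ⟨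
      combination (cs₁ ++ map raise cs₂) (hslots xs) ∎
      where
      |ys| : length ys ≡ k
      |ys| = ℕₚ.suc-injective (≡.trans (≡.sym (↭ₚ.↭-length r)) eq)

  super-positives : ∀ {f} → Super f → ∀ xs → f (hslots xs) ≈ f (hslots (positives xs))
  super-positives sf []           = R.refl
  super-positives sf (zero  ∷ xs) = R.trans (Super.removable sf [] 𝕙 (hslots xs)) (super-positives sf xs)
  super-positives sf (suc x ∷ xs) = super-positives (super-∷ (𝕙 , suc x) sf) xs

  super-pad : ∀ {f} → Super f → ∀ d xs → f (hslots (replicate d 0 ++ xs)) ≈ f (hslots xs)
  super-pad sf zero    xs = R.refl
  super-pad sf (suc d) xs = R.trans (Super.removable sf [] 𝕙 _) (super-pad sf d xs)

  -- In degree n, n variables suffice: without its zeros, a list of exponents with sum at most n has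
  -- at most n entries, and zeros can be added back up to length n. The bound `suc n` records that f
  -- vanishes above degree n.
  expansion : ∀ n {f} → Super f → Symmetric f → (∀ s → n ≢ total s → f s ≈ 0#) →
    ∃ λ cs → All (λ (_ , ns) → Linked ℕ._≥_ ns × All NonZero ns) cs × (∀ s → f s ≈ combination cs s)
  expansion n {f} sf sym-f deg
    with cs , bs , eq ← fundamental (suc n) n (suc n) ℕₚ.≤-refl (f ∘ hslots) (sym-f ∘ ↭ₚ.map⁺ (𝕙 ,_))
           (λ xs _ n<Σ → deg (hslots xs) λ n≡ → ℕₚ.<⇒≢ n<Σ (≡.trans n≡ (total-hslots xs)))
    = cs , All.map (λ (dn , nz , _) → unbound dn , nz) bs ,
      super-unique sf (combination-super cs) agree
    where
    unbound : ∀ {k ns} → Linked ℕ._≥_ (k ∷ ns) → Linked ℕ._≥_ ns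
    unbound [-]      = []
    unbound (_ ∷ dn) = dn

    agree : ∀ xs → f (hslots xs) ≈ combination cs (hslots xs)
    agree xs with suc n ℕ.≤? sumᴸ xs
    ... | yes n<Σ = R.trans (deg (hslots xs) λ n≡ → ℕₚ.<⇒≢ n<Σ (≡.trans n≡ (total-hslots xs)))
      (sym (combination-degree bs (hslots xs) (≡.subst (suc n ℕ.≤_) (≡.sym (total-hslots xs)) n<Σ)))
    ... | no n≮Σ = R.trans (normalise sf) (R.trans (eq padded |padded|) (sym (normalise (combination-super cs))))
      where
      ys = positives xs
      padded = replicate (n ℕ.∸ length ys) 0 ++ ys
      |ys|≤n : length ys ℕ.≤ n
      |ys|≤n = ℕₚ.≤-trans (length-positives xs) (ℕₚ.≮⇒≥ n≮Σ)
      |padded| : length padded ≡ n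
      |padded| = ≡.trans (length-++ (replicate (n ℕ.∸ length ys) 0))
        (≡.trans (≡.cong (ℕ._+ length ys) (length-replicate (n ℕ.∸ length ys))) (ℕₚ.m∸n+n≡m |ys|≤n))
      normalise : ∀ {f} → Super f → f (hslots xs) ≈ f (hslots padded)
      normalise sf = R.trans (super-positives sf xs) (sym (super-pad sf (n ℕ.∸ length ys) ys))

-- Contents of words

occurrences : ∀ {m} → Fin m → List (Fin m) → ℕ
occurrences c i = length (filter (Fin._≟ c) i)

length-filter-map : ∀ {a b p} {A : Set a} {B : Set b} {P : B → Set p} (P? : ∀ y → Dec (P y)) (f : A → B) xs →
  length (filter (λ x → P? (f x)) xs) ≡ length (filter P? (map f xs))
length-filter-map P? f []       = refl
length-filter-map P? f (x ∷ xs) with does (P? (f x))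
... | true  = ≡.cong suc (length-filter-map P? f xs)
... | false = length-filter-map P? f xs

content-tabulate : ∀ {n m} (i : Fin n → Fin m) → content (allFin n) i ≡ content (tabulate i) id
content-tabulate {n} i = Vecₚ.tabulate-cong λ c → ≡.trans
  (length-filter-map (Fin._≟ c) i (allFin n))
  (≡.cong (length ∘ filter (Fin._≟ c)) (map-tabulate id i))

occurrences-suc : ∀ {m} (c : Fin m) i → occurrences (suc c) (map suc i) ≡ occurrences c i
occurrences-suc c []      = refl
occurrences-suc c (d ∷ i) with does (d Fin.≟ c)
... | true  = ≡.cong suc (occurrences-suc c i)
... | false = occurrences-suc c i

occurrences-zero : ∀ {m} (i : List (Fin m)) → occurrences zero (map suc i) ≡ 0
occurrences-zero []      = refl
occurrences-zero (d ∷ i) = occurrences-zero i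

content-map-suc : ∀ {m} (i : List (Fin m)) → content (map suc i) id ≡ 0 ∷ content i id
content-map-suc i = ≡.cong₂ _∷_ (occurrences-zero i) (Vecₚ.tabulate-cong λ c → occurrences-suc c i)

total-slots : ∀ c {m} (α : Vec ℕ m) → total (map (c ,_) (toList α)) ≡ sum α
total-slots c []      = refl
total-slots c (a ∷ α) = ≡.cong (a ℕ.+_) (total-slots c α)

-- Compatible index sequences, read along a word

module CompatibleWords {a r} {A : Set a} {_▷_ : Rel A r} (_▷?_ : B.Decidable _▷_) where

  -- A form of `Compatible` that can be peeled from the front, with the descent set given by a
  -- relation between neighbouring letters instead of a subset of positions.
  data CompatibleWord {m} : List A → List (Fin m) → Set (a Level.⊔ r) where
    []  : CompatibleWord [] []
    [-] : ∀ {x c} → CompatibleWord (x ∷ []) (c ∷ [])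
    _∷_ : ∀ {x y c d w i} → (c Fin.≤ d) × (x ▷ y → c Fin.< d) →
          CompatibleWord (y ∷ w) (d ∷ i) → CompatibleWord (x ∷ y ∷ w) (c ∷ d ∷ i)

  uncons : ∀ {m x y w} {c d : Fin m} {i} → CompatibleWord (x ∷ y ∷ w) (c ∷ d ∷ i) →
    ((c Fin.≤ d) × (x ▷ y → c Fin.< d)) × CompatibleWord (y ∷ w) (d ∷ i)
  uncons (p ∷ ps) = p , ps

  step? : ∀ {m} (c d : Fin m) x y → Dec ((c Fin.≤ d) × (x ▷ y → c Fin.< d))
  step? c d x y = (c Fin.≤? d) ×-dec ((x ▷? y) →-dec (c Fin.<? d))

  compatibleWord? : ∀ {m} w (i : List (Fin m)) → Dec (CompatibleWord w i)
  compatibleWord? []          []          = yes []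
  compatibleWord? []          (_ ∷ _)     = no λ ()
  compatibleWord? (x ∷ w)     []          = no λ ()
  compatibleWord? (x ∷ [])    (c ∷ [])    = yes [-]
  compatibleWord? (x ∷ [])    (_ ∷ _ ∷ _) = no λ ()
  compatibleWord? (x ∷ _ ∷ _) (_ ∷ [])    = no λ ()
  compatibleWord? (x ∷ y ∷ w) (c ∷ d ∷ i) =
    map′ (λ (p , ps) → p ∷ ps) uncons (step? c d x y ×-dec compatibleWord? (y ∷ w) (d ∷ i))

  Compatible▷ : ∀ {n m} → (Fin n → A) → (Fin n → Fin m) → Set r
  Compatible▷ w i = ∀ j j′ → toℕ j′ ≡ suc (toℕ j) → (i j Fin.≤ i j′) × (w j ▷ w j′ → i j Fin.< i j′)

  compatible▷⇒ : ∀ {n m} (w : Fin n → A) (i : Fin n → Fin m) →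
    Compatible▷ w i → CompatibleWord (tabulate w) (tabulate i)
  compatible▷⇒ {zero}        w i p = []
  compatible▷⇒ {suc zero}    w i p = [-]
  compatible▷⇒ {suc (suc n)} w i p =
    p zero (suc zero) refl ∷
    compatible▷⇒ (w ∘ suc) (i ∘ suc) (λ j j′ eq → p (suc j) (suc j′) (≡.cong suc eq))

  compatible▷⇐ : ∀ {n m} (w : Fin n → A) (i : Fin n → Fin m) →
    CompatibleWord (tabulate w) (tabulate i) → Compatible▷ w i
  compatible▷⇐ {suc (suc n)} w i (p ∷ ps) zero    (suc zero) eq = p
  compatible▷⇐ {suc (suc n)} w i (p ∷ ps) (suc j) (suc j′)   eq =
    compatible▷⇐ (w ∘ suc) (i ∘ suc) ps j j′ (ℕₚ.suc-injective eq)

  compatible-suc : ∀ {m} w {i : List (Fin m)} → CompatibleWord w i → CompatibleWord w (map suc i)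
  compatible-suc []          []              = []
  compatible-suc (x ∷ [])    [-]             = [-]
  compatible-suc (x ∷ y ∷ w) ((le , lt) ∷ p) = (ℕ.s≤s le , ℕ.s≤s ∘ lt) ∷ compatible-suc (y ∷ w) p

  compatible-pred : ∀ {m} w {i : List (Fin m)} → CompatibleWord w (map suc i) → CompatibleWord w i
  compatible-pred []          {[]}        []              = []
  compatible-pred (x ∷ [])    {_ ∷ []}    [-]             = [-]
  compatible-pred (x ∷ y ∷ w) {_ ∷ _ ∷ _} ((le , lt) ∷ p) = (ℕ.s≤s⁻¹ le , ℕ.s≤s⁻¹ ∘ lt) ∷ compatible-pred (y ∷ w) p

  positive-head : ∀ {m w} {c : Fin m} {i} → CompatibleWord w (suc c ∷ i) → occurrences zero (suc c ∷ i) ≡ 0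
  positive-head [-]                           = refl
  positive-head (_∷_ {d = suc d} _ p)         = positive-head p
  positive-head (_∷_ {d = zero} (() , _) _)

-- Coefficients of Q_D, e_λ and h_λ

module Counting {c ℓ} (R : CommutativeRing c ℓ) where
  open CommutativeRing R hiding (refl; trans; zero)
  private module R = CommutativeRing R
  open Sum commutativeSemiring
  open Alternating R
  open Superfunctions R
  open import Relation.Binary.Reasoning.Setoid setoid

  ∑-functions : ∀ {b} {B : Set b} (bs : List B) n (f : List B → Carrier) →
    ∑[ i ∈ allFunctions {n = n} (λ _ → bs) ] f (tabulate i) ≈ ∑ (words bs n) f
  ∑-functions bs zero    f = R.refl
  ∑-functions bs (suc n) f = begin
    ∑[ i ∈ allFunctions {n = suc n} (λ _ → bs) ] f (tabulate i)
      ≈⟨ ∑-product _ _ bs _ ⟩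
    ∑[ b ∈ bs ] ∑[ i ∈ allFunctions {n = n} (λ _ → bs) ] f (b ∷ tabulate i)
      ≈⟨ ∑-cong bs (λ b → ∑-functions bs n (f ∘ (b ∷_))) ⟩
    ∑[ b ∈ bs ] ∑[ i ∈ words bs n ] f (b ∷ i)
      ≈⟨ ∑-words-suc bs n f ⟨
    ∑ (words bs (suc n)) f ∎

  ∑-words-avoiding : ∀ {m} n (f : List (Fin (suc m)) → Carrier) →
    (∀ i → occurrences zero i ≢ 0 → f i ≈ 0#) →
    ∑ (words (allFin (suc m)) n) f ≈ ∑[ i ∈ words (allFin m) n ] f (map suc i)
  ∑-words-avoiding zero    f e = R.refl
  ∑-words-avoiding {m} (suc n) f e = begin
    ∑ (words (allFin (suc m)) (suc n)) f
      ≈⟨ ∑-words-suc (allFin (suc m)) n f ⟩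
    ∑[ d ∈ allFin (suc m) ] ∑[ i ∈ words (allFin (suc m)) n ] f (d ∷ i)
      ≈⟨ ∑-allFin-suc m (λ d → ∑[ i ∈ words (allFin (suc m)) n ] f (d ∷ i)) ⟩
    (∑[ i ∈ words (allFin (suc m)) n ] f (zero ∷ i)) +
    (∑[ d ∈ allFin m ] ∑[ i ∈ words (allFin (suc m)) n ] f (suc d ∷ i))
      ≈⟨ +-cong (∑-zero (words (allFin (suc m)) n) (λ i → e (zero ∷ i) λ ()))
           (∑-cong (allFin m) λ d → ∑-words-avoiding n (f ∘ (suc d ∷_)) (λ i → e (suc d ∷ i))) ⟩
    0# + (∑[ d ∈ allFin m ] ∑[ i ∈ words (allFin m) n ] f (suc d ∷ map suc i))
      ≈⟨ +-identityˡ _ ⟩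
    ∑[ d ∈ allFin m ] ∑[ i ∈ words (allFin m) n ] f (map suc (d ∷ i))
      ≈⟨ ∑-words-suc (allFin m) n (f ∘ map suc) ⟨
    ∑[ i ∈ words (allFin m) (suc n) ] f (map suc i) ∎

  module _ {a r} {A : Set a} {_▷_ : Rel A r} (_▷?_ : B.Decidable _▷_) where
    open CompatibleWords _▷?_

    -- The coefficient of x^α in Q_D, for D the set of positions with x ▷ y.
    quasi : ∀ {m} → List A → Vec ℕ m → Carrier
    quasi {m} w α = ∑[ i ∈ words (allFin m) (length w) ] ⟦ compatibleWord? w i ⟧ * ⟦ content i id ≟ᵛ α ⟧

    Q≈quasi : ∀ {n m} (D : Subset n) (w : Fin n → A) (α : Vec ℕ m) →
      (∀ j j′ → toℕ j′ ≡ suc (toℕ j) → j ∈ D ⇔ w j ▷ w j′) →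
      Q R D m α ≈ quasi (tabulate w) α
    Q≈quasi {n} {m} D w α D⇔ = begin
      Q R D m α
        ≈⟨ ∑-filter (λ i → compatible? D i ×-dec (content (allFin n) i ≟ᵛ α)) (λ _ → 1#) (allFunctions (λ _ → allFin m)) ⟩
      ∑[ i ∈ allFunctions {n = n} (λ _ → allFin m) ] ⟦ compatible? D i ×-dec (content (allFin n) i ≟ᵛ α) ⟧ * 1#
        ≈⟨ ∑-cong (allFunctions {n = n} (λ _ → allFin m)) (λ i → R.trans (*-identityʳ _) (R.trans
             (⟦⟧-× (compatible? D i) (content (allFin n) i ≟ᵛ α))
             (*-cong (⟦⟧-cong (to i) (from i) (compatible? D i) (compatibleWord? (tabulate w) (tabulate i)))
               (reflexive (≡.cong (λ v → ⟦ v ≟ᵛ α ⟧) (content-tabulate i)))))) ⟩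
      ∑[ i ∈ allFunctions {n = n} (λ _ → allFin m) ]
        ⟦ compatibleWord? (tabulate w) (tabulate i) ⟧ * ⟦ content (tabulate i) id ≟ᵛ α ⟧
        ≈⟨ ∑-functions (allFin m) n _ ⟩
      _ ≡⟨ ≡.cong (λ k → ∑[ i ∈ words (allFin m) k ] ⟦ compatibleWord? (tabulate w) i ⟧ * ⟦ content i id ≟ᵛ α ⟧)
             (length-tabulate w) ⟨
      quasi (tabulate w) α ∎
      where
      to : ∀ i → Compatible D i → CompatibleWord (tabulate w) (tabulate i)
      to i p = compatible▷⇒ w i λ j j′ eq →
        proj₁ (p j j′ eq) , λ x▷y → proj₂ (p j j′ eq) (Equivalence.from (D⇔ j j′ eq) x▷y)
      from : ∀ i → CompatibleWord (tabulate w) (tabulate i) → Compatible D i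
      from i p j j′ eq with q ← compatible▷⇐ w i p j j′ eq =
        proj₁ q , λ j∈D → proj₂ q (Equivalence.to (D⇔ j j′ eq) j∈D)

    quasi-0∷ : ∀ {m} w (α : Vec ℕ m) → quasi w (0 ∷ α) ≈ quasi w α
    quasi-0∷ w α = R.trans
      (∑-words-avoiding (length w) _ λ i ne → R.trans
        (*-congˡ (⟦⟧-false (content i id ≟ᵛ (0 ∷ α)) λ eq → ne (Vecₚ.∷-injectiveˡ eq))) (zeroʳ _))
      (∑-cong (words (allFin _) (length w)) λ i → *-cong
        (⟦⟧-cong (compatible-pred w) (compatible-suc w) (compatibleWord? w (map suc i)) (compatibleWord? w i))
        (⟦⟧-cong (λ eq → Vecₚ.∷-injectiveʳ (≡.trans (≡.sym (content-map-suc i)) eq))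
          (λ eq → ≡.trans (content-map-suc i) (≡.cong (0 ∷_) eq)) (content (map suc i) id ≟ᵛ (0 ∷ α)) (content i id ≟ᵛ α)))

    quasi-[]-suc : ∀ {m} k (α : Vec ℕ m) → quasi [] (suc k ∷ α) ≈ 0#
    quasi-[]-suc k α = R.trans (+-identityʳ _) (R.trans
      (*-congˡ (⟦⟧-false (content [] id ≟ᵛ (suc k ∷ α)) λ ())) (zeroʳ _))

    -- Here x has received the smallest index and k further letters must receive it. If k > 0, the
    -- next letter is one of them, so no descent may follow x; if k = 0, the index rises after x and
    -- nothing is required.
    noDescent : ℕ → A → List A → Carrier
    noDescent (suc k) x (y ∷ _) = ⟦ ¬? (x ▷? y) ⟧
    noDescent _       _ _       = 1#

    quasi-suc∷ : ∀ {m} x w k (α : Vec ℕ m) → quasi (x ∷ w) (suc k ∷ α) ≈ noDescent k x w * quasi w (k ∷ α)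
    quasi-suc∷ {m} x w k α = begin
      quasi (x ∷ w) (suc k ∷ α)
        ≈⟨ ∑-words-suc (allFin (suc m)) (length w) _ ⟩
      ∑[ d ∈ allFin (suc m) ] ∑[ i ∈ words (allFin (suc m)) (length w) ] term d i
        ≈⟨ ∑-allFin-suc m (λ d → ∑ (words (allFin (suc m)) (length w)) (term d)) ⟩
      (∑[ i ∈ words (allFin (suc m)) (length w) ] term zero i) +
      (∑[ d ∈ allFin m ] ∑[ i ∈ words (allFin (suc m)) (length w) ] term (suc d) i)
        ≈⟨ +-cong (∑-congAll (All.map (λ {i} → first w k i) (words-length (allFin (suc m)) (length w))))
             (∑-zero (allFin m) λ d → ∑-zero (words (allFin (suc m)) (length w)) (later d)) ⟩
      (∑[ i ∈ words (allFin (suc m)) (length w) ]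
        noDescent k x w * (⟦ compatibleWord? w i ⟧ * ⟦ content i id ≟ᵛ (k ∷ α) ⟧)) + 0#
        ≈⟨ R.trans (+-identityʳ _) (∑-*ˡ (noDescent k x w) _ (words (allFin (suc m)) (length w))) ⟩
      noDescent k x w * quasi w (k ∷ α) ∎
      where
      term : Fin (suc m) → List (Fin (suc m)) → Carrier
      term d i = ⟦ compatibleWord? (x ∷ w) (d ∷ i) ⟧ * ⟦ content (d ∷ i) id ≟ᵛ (suc k ∷ α) ⟧

      later : ∀ d i → term (suc d) i ≈ 0#
      later d i = R.trans
        (guard (compatibleWord? (x ∷ w) (suc d ∷ i)) λ p → ⟦⟧-false (content (suc d ∷ i) id ≟ᵛ (suc k ∷ α)) λ eq →
          contradiction (≡.trans (≡.sym (positive-head p)) (Vecₚ.∷-injectiveˡ eq)) λ ())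
        (zeroʳ _)

      shift : ∀ k i → ⟦ content (zero ∷ i) id ≟ᵛ (suc k ∷ α) ⟧ ≈ ⟦ content i id ≟ᵛ (k ∷ α) ⟧
      shift k i = ⟦⟧-cong
        (λ eq → ≡.cong₂ _∷_ (ℕₚ.suc-injective (Vecₚ.∷-injectiveˡ eq)) (Vecₚ.∷-injectiveʳ eq))
        (λ eq → ≡.cong₂ _∷_ (≡.cong suc (Vecₚ.∷-injectiveˡ eq)) (Vecₚ.∷-injectiveʳ eq))
        (content (zero ∷ i) id ≟ᵛ (suc k ∷ α)) (content i id ≟ᵛ (k ∷ α))

      first : ∀ w k i → length i ≡ length w →
        ⟦ compatibleWord? (x ∷ w) (zero ∷ i) ⟧ * ⟦ content (zero ∷ i) id ≟ᵛ (suc k ∷ α) ⟧ ≈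
        noDescent k x w * (⟦ compatibleWord? w i ⟧ * ⟦ content i id ≟ᵛ (k ∷ α) ⟧)
      first []      zero    [] _ = R.trans (*-congˡ (shift 0 [])) (sym (*-identityˡ _))
      first []      (suc k) [] _ = R.trans (*-congˡ (shift (suc k) [])) (sym (*-identityˡ _))
      first (y ∷ w) k (d ∷ i) _ = begin
        ⟦ compatibleWord? (x ∷ y ∷ w) (zero ∷ d ∷ i) ⟧ * ⟦ content (zero ∷ d ∷ i) id ≟ᵛ (suc k ∷ α) ⟧
          ≈⟨ *-congˡ (shift k (d ∷ i)) ⟩
        ⟦ compatibleWord? (x ∷ y ∷ w) (zero ∷ d ∷ i) ⟧ * ⟦ content (d ∷ i) id ≟ᵛ (k ∷ α) ⟧
          ≈⟨ ⟦⟧-×* (step? zero d x y) (compatibleWord? (y ∷ w) (d ∷ i)) _ ⟩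
        ⟦ step? zero d x y ⟧ * (⟦ compatibleWord? (y ∷ w) (d ∷ i) ⟧ * ⟦ content (d ∷ i) id ≟ᵛ (k ∷ α) ⟧)
          ≈⟨ step k d ⟩
        noDescent k x (y ∷ w) * (⟦ compatibleWord? (y ∷ w) (d ∷ i) ⟧ * ⟦ content (d ∷ i) id ≟ᵛ (k ∷ α) ⟧) ∎
        where
        step : ∀ k d →
          ⟦ step? zero d x y ⟧ * (⟦ compatibleWord? (y ∷ w) (d ∷ i) ⟧ * ⟦ content (d ∷ i) id ≟ᵛ (k ∷ α) ⟧) ≈
          noDescent k x (y ∷ w) * (⟦ compatibleWord? (y ∷ w) (d ∷ i) ⟧ * ⟦ content (d ∷ i) id ≟ᵛ (k ∷ α) ⟧)
        -- The next index is zero exactly when a further zero is due. In the two inconsistent cases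
        -- both sides vanish: either there is a zero too many, or a zero is due although the indices
        -- have already left zero and cannot return.
        step zero zero = R.trans (*-congˡ vanish) (R.trans (zeroʳ _) (sym (R.trans (*-congˡ vanish) (zeroʳ _))))
          where
          vanish : ⟦ compatibleWord? (y ∷ w) (zero ∷ i) ⟧ * ⟦ content (zero ∷ i) id ≟ᵛ (zero ∷ α) ⟧ ≈ 0#
          vanish = R.trans (*-congˡ (⟦⟧-false (content (zero ∷ i) id ≟ᵛ (zero ∷ α)) λ ())) (zeroʳ _)
        step zero (suc d) = *-congʳ (⟦⟧-true (step? zero (suc d) x y) (ℕ.z≤n , λ _ → ℕ.z<s))
        step (suc k) zero = *-congʳ (⟦⟧-cong (λ (_ , f) x▷y → contradiction (f x▷y) λ ())
          (λ ¬x▷y → ℕ.z≤n , λ x▷y → contradiction x▷y ¬x▷y) (step? (zero {n = m}) zero x y) (¬? (x ▷? y)))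
        step (suc k) (suc d) = R.trans (*-congˡ vanish) (R.trans (zeroʳ _) (sym (R.trans (*-congˡ vanish) (zeroʳ _))))
          where
          vanish : ⟦ compatibleWord? (y ∷ w) (suc d ∷ i) ⟧ * ⟦ content (suc d ∷ i) id ≟ᵛ (suc k ∷ α) ⟧ ≈ 0#
          vanish = R.trans
            (guard (compatibleWord? (y ∷ w) (suc d ∷ i)) λ p → ⟦⟧-false (content (suc d ∷ i) id ≟ᵛ (suc k ∷ α)) λ eq →
              contradiction (≡.trans (≡.sym (positive-head p)) (Vecₚ.∷-injectiveˡ eq)) λ ())
            (zeroʳ _)

    descentFree? : ∀ w → Dec (Linked (λ x y → ¬ (x ▷ y)) w)
    descentFree? = linked? (λ x y → ¬? (x ▷? y))

    -- As the indices increase weakly, the smallest one occupies an initial block, which must be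
    -- free of descents: one factor h_{α₁}(u). At the end of the block the index rises strictly, so
    -- the junction with w imposes nothing.
    quasi-block : ∀ {m} u w (α : Vec ℕ m) → quasi (u ++ w) (length u ∷ α) ≈ ⟦ descentFree? u ⟧ * quasi w α
    quasi-block []      w α = R.trans (quasi-0∷ w α) (sym (*-identityˡ _))
    quasi-block (x ∷ []) w α = R.trans (quasi-suc∷ x w 0 α) (*-congˡ (quasi-0∷ w α))
    quasi-block (x ∷ u@(y ∷ u′)) w α = begin
      quasi (x ∷ u ++ w) (suc (length u) ∷ α)
        ≈⟨ quasi-suc∷ x (u ++ w) (length u) α ⟩
      ⟦ ¬? (x ▷? y) ⟧ * quasi (u ++ w) (length u ∷ α)
        ≈⟨ *-congˡ (quasi-block u w α) ⟩
      ⟦ ¬? (x ▷? y) ⟧ * (⟦ descentFree? u ⟧ * quasi w α)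
        ≈⟨ ⟦⟧-×* (¬? (x ▷? y)) (descentFree? u) _ ⟨
      ⟦ descentFree? (x ∷ u) ⟧ * quasi w α ∎

    quasi-length : ∀ {m} w (α : Vec ℕ m) → length w ≢ sum α → quasi w α ≈ 0#
    quasi-length []      []          ne = contradiction refl ne
    quasi-length (x ∷ w) []          ne = R.refl
    quasi-length w       (zero  ∷ α) ne = R.trans (quasi-0∷ w α) (quasi-length w α ne)
    quasi-length []      (suc k ∷ α) ne = quasi-[]-suc k α
    quasi-length (x ∷ w) (suc k ∷ α) ne = R.trans (quasi-suc∷ x w k α) (R.trans
      (*-congˡ (quasi-length w (k ∷ α) (ne ∘ ≡.cong suc))) (zeroʳ _))

  -- The exponents that one variable may have in e_n (at most 1) and in h_n (any). The kinds appear
  -- crossed because e_λ is the value on 𝕙-slots and h_λ that on 𝕖-slots.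
  allowed : Kind → ℕ → Carrier
  allowed 𝕙 (suc (suc _)) = 0#
  allowed _ _             = 1#

  allowedAll : Kind → ∀ {m} → Vec ℕ m → Carrier
  allowedAll c []      = 1#
  allowedAll c (a ∷ α) = allowed c a * allowedAll c α

  -- e_n and h_n come from words over a one-letter alphabet, with ▷ holding always or never.
  Always Never : Rel (⊤ {Level.zero}) Level.zero
  Always _ _ = ⊤
  Never  _ _ = ⊥

  always? : B.Decidable Always
  always? _ _ = yes tt

  never? : B.Decidable Never
  never? _ _ = no λ ()

  quasi-always : ∀ n {m} (α : Vec ℕ m) →
    quasi always? (replicate n tt) α ≈ allowedAll 𝕙 α * ⟦ n ℕ.≟ sum α ⟧
  quasi-always n       (0 ∷ α)           = R.trans (quasi-0∷ always? (replicate n tt) α) (R.trans (quasi-always n α) (*-congʳ (sym (*-identityˡ _))))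
  quasi-always zero    []                = +-identityʳ _
  quasi-always (suc n) []                = sym (zeroʳ _)
  quasi-always zero    (suc k ∷ α)       = R.trans (quasi-[]-suc always? k α) (sym (zeroʳ _))
  quasi-always (suc n) (1 ∷ α)           = R.trans (quasi-suc∷ always? tt (replicate n tt) 0 α)
    (R.trans (*-identityˡ _) (quasi-always n (0 ∷ α)))
  quasi-always (suc n) (suc (suc k) ∷ α) = R.trans (quasi-suc∷ always? tt (replicate n tt) (suc k) α)
    (R.trans (vanish n) (sym (R.trans (*-congʳ (zeroˡ _)) (zeroˡ _))))
    where
    vanish : ∀ n → noDescent always? (suc k) tt (replicate n tt) * quasi always? (replicate n tt) (suc k ∷ α) ≈ 0#
    vanish zero    = R.trans (*-congˡ (quasi-[]-suc always? k α)) (zeroʳ _)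
    vanish (suc n) = zeroˡ _

  quasi-never : ∀ n {m} (α : Vec ℕ m) →
    quasi never? (replicate n tt) α ≈ allowedAll 𝕖 α * ⟦ n ℕ.≟ sum α ⟧
  quasi-never n       (0 ∷ α)     = R.trans (quasi-0∷ never? (replicate n tt) α) (R.trans (quasi-never n α) (*-congʳ (sym (*-identityˡ _))))
  quasi-never zero    []          = +-identityʳ _
  quasi-never (suc n) []          = sym (zeroʳ _)
  quasi-never zero    (suc k ∷ α) = R.trans (quasi-[]-suc never? k α) (sym (zeroʳ _))
  quasi-never (suc n) (suc k ∷ α) = R.trans (quasi-suc∷ never? tt (replicate n tt) k α)
    (R.trans (*-congʳ (free n k)) (R.trans (*-identityˡ _) (R.trans (quasi-never n (k ∷ α)) (*-congʳ (*-congʳ (reflexive (same k)))))))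
    where
    free : ∀ n k → noDescent never? k tt (replicate n tt) ≈ 1#
    free zero    zero    = R.refl
    free zero    (suc k) = R.refl
    free (suc n) zero    = R.refl
    free (suc n) (suc k) = R.refl
    same : ∀ k → allowed 𝕖 k ≡ 1#
    same _ = refl

  tabulate-const : ∀ n → tabulate {n = n} (λ _ → tt {Level.zero}) ≡ replicate n tt
  tabulate-const zero    = refl
  tabulate-const (suc n) = ≡.cong (tt ∷_) (tabulate-const n)

  e≈ : ∀ n {m} (α : Vec ℕ m) → Defs.e R n m α ≈ allowedAll 𝕙 α * ⟦ n ℕ.≟ sum α ⟧
  e≈ n α = R.trans (Q≈quasi always? {n} Subset.⊤ (λ _ → tt) α λ _ _ _ → mk⇔ _ λ _ → ∈⊤)
    (R.trans (reflexive (≡.cong (λ w → quasi always? w α) (tabulate-const n))) (quasi-always n α))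

  h≈ : ∀ n {m} (α : Vec ℕ m) → Defs.h R n m α ≈ allowedAll 𝕖 α * ⟦ n ℕ.≟ sum α ⟧
  h≈ n α = R.trans (Q≈quasi never? {n} Subset.⊥ (λ _ → tt) α λ _ _ _ → mk⇔ (λ j∈⊥ → contradiction j∈⊥ ∉⊥) λ ())
    (R.trans (reflexive (≡.cong (λ w → quasi never? w α) (tabulate-const n))) (quasi-never n α))

  ∑-choices : ∀ c a (g : ℕ → ℕ → Carrier) →
    ∑[ b ∈ upTo (suc a) ] allowed c b * g b (a ∸ b) ≈ ∑[ x ∈ choices c a ] g (proj₁ x) (proj₂ x)
  ∑-choices 𝕖 zero    g = +-congʳ (*-identityˡ _)
  ∑-choices 𝕙 zero    g = +-congʳ (*-identityˡ _)
  ∑-choices 𝕖 (suc a) g = +-cong (*-identityˡ _) (begin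
    ∑[ b ∈ applyUpTo suc (suc a) ] 1# * g b (suc a ∸ b)
      ≡⟨ ≡.cong (λ bs → ∑[ b ∈ bs ] 1# * g b (suc a ∸ b)) (map-upTo suc (suc a)) ⟨
    ∑[ b ∈ map suc (upTo (suc a)) ] 1# * g b (suc a ∸ b)
      ≈⟨ ∑-map suc _ (upTo (suc a)) ⟩
    ∑[ b ∈ upTo (suc a) ] 1# * g (suc b) (a ∸ b)
      ≈⟨ ∑-choices 𝕖 a (g ∘ suc) ⟩
    ∑[ x ∈ choices 𝕖 a ] g (suc (proj₁ x)) (proj₂ x)
      ≈⟨ ∑-map _ _ (choices 𝕖 a) ⟨
    ∑ (map (map₁ suc) (choices 𝕖 a)) (λ x → g (proj₁ x) (proj₂ x)) ∎)
  ∑-choices 𝕙 (suc a) g = +-cong (*-identityˡ _) (+-cong (*-identityˡ _) (begin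
    ∑[ b ∈ applyUpTo 2+ a ] allowed 𝕙 b * g b (suc a ∸ b)
      ≡⟨ ≡.cong (λ bs → ∑[ b ∈ bs ] allowed 𝕙 b * g b (suc a ∸ b)) (map-upTo 2+ a) ⟨
    ∑[ b ∈ map 2+ (upTo a) ] allowed 𝕙 b * g b (suc a ∸ b)
      ≈⟨ ∑-map _ _ (upTo a) ⟩
    ∑[ b ∈ upTo a ] 0# * g (suc (suc b)) (suc a ∸ suc (suc b))
      ≈⟨ ∑-zero (upTo a) (λ _ → zeroˡ _) ⟩
    0# ∎))

  -- Identifies the Cauchy product of power series with `mul`; the first factor has the shape in
  -- which `e≈` and `h≈` deliver the coefficients of e_n and h_n.
  ∑-splits : ∀ c {m} (p : ℕ → Carrier) (f : List Slot → Carrier) (α : Vec ℕ m) →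
    ∑[ x ∈ splits α ] (allowedAll c (proj₁ x) * p (sum (proj₁ x))) * f (map (c ,_) (toList (proj₂ x))) ≈
    mul p f (map (c ,_) (toList α))
  ∑-splits c p f []      = R.trans (+-identityʳ _) (*-congʳ (*-identityˡ _))
  ∑-splits c p f (a ∷ α) = begin
    _ ≈⟨ ∑-product _ _ (upTo (suc a)) (splits α) ⟩
    ∑[ b ∈ upTo (suc a) ] ∑[ x ∈ splits α ]
      ((allowed c b * allowedAll c (proj₁ x)) * p (b ℕ.+ sum (proj₁ x))) * f ((c , a ∸ b) ∷ map (c ,_) (toList (proj₂ x)))
      ≈⟨ ∑-cong (upTo (suc a)) (λ b → ∑-cong (splits α) λ x → R.trans (*-congʳ (*-assoc _ _ _)) (*-assoc _ _ _)) ⟩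
    _ ≈⟨ ∑-cong (upTo (suc a)) (λ b → ∑-*ˡ (allowed c b) _ (splits α)) ⟩
    _ ≈⟨ ∑-choices c a (λ b r → ∑[ x ∈ splits α ]
           (allowedAll c (proj₁ x) * p (b ℕ.+ sum (proj₁ x))) * f ((c , r) ∷ map (c ,_) (toList (proj₂ x)))) ⟩
    _ ≈⟨ ∑-cong (choices c a) (λ (b , r) → ∑-splits c (p ∘ (b ℕ.+_)) (f ∘ ((c , r) ∷_)) α) ⟩
    mul p f (map (c ,_) (toList (a ∷ α))) ∎

  one≈ : ∀ c {m} (α : Vec ℕ m) → one R m α ≈ elementary [] (map (c ,_) (toList α))
  one≈ c α rewrite total-slots c α with sum α
  ... | zero  = R.refl
  ... | suc _ = R.refl

  foldr≈elementary : ∀ c (f : ℕ → Series R) →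
    (∀ n {m} (α : Vec ℕ m) → f n m α ≈ allowedAll c α * ⟦ n ℕ.≟ sum α ⟧) → ∀ ns {m} (α : Vec ℕ m) →
    foldr (λ n g → _⊛_ R (f n) g) (one R) ns m α ≈ elementary ns (map (c ,_) (toList α))
  foldr≈elementary c f f≈ []       α = one≈ c α
  foldr≈elementary c f f≈ (n ∷ ns) α = R.trans
    (∑-cong (splits α) λ (β , γ) → *-cong (f≈ n β) (foldr≈elementary c f f≈ ns γ))
    (∑-splits c (λ j → ⟦ n ℕ.≟ j ⟧) (elementary ns) α)

  hᵖ≈ : ∀ λ′ {m} (α : Vec ℕ m) → hᵖ R λ′ m α ≈ elementary (Partition.parts λ′) (eslots (toList α))
  hᵖ≈ λ′ = foldr≈elementary 𝕖 (Defs.h R) h≈ (Partition.parts λ′)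

  eᵖ≈ : ∀ λ′ {m} (α : Vec ℕ m) → eᵖ R λ′ m α ≈ elementary (Partition.parts λ′) (hslots (toList α))
  eᵖ≈ λ′ = foldr≈elementary 𝕙 (Defs.e R) e≈ (Partition.parts λ′)

module ℕ∑ = Sum ℕₚ.+-*-commutativeSemiring

length-filter≡∑ : ∀ {a p} {A : Set a} {P : A → Set p} (P? : ∀ x → Dec (P x)) xs →
  length (filter P? xs) ≡ ℕ∑.∑ xs (λ x → ℕ∑.⟦ P? x ⟧)
length-filter≡∑ P? []       = refl
length-filter≡∑ P? (x ∷ xs) with does (P? x)
... | true  = ≡.cong suc (length-filter≡∑ P? xs)
... | false = length-filter≡∑ P? xs

sum-tabulate≡∑ : ∀ {n} (f : Fin n → ℕ) → sum (Vec.tabulate f) ≡ ℕ∑.∑ (allFin n) f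
sum-tabulate≡∑ {zero}  f = refl
sum-tabulate≡∑ {suc n} f =
  ≡.trans (≡.cong (f zero ℕ.+_) (sum-tabulate≡∑ (f ∘ suc))) (≡.sym (ℕ∑.∑-allFin-suc n f))

length≡∑ : ∀ {a} {A : Set a} (xs : List A) → ℕ∑.∑ xs (λ _ → 1) ≡ length xs
length≡∑ []       = refl
length≡∑ (x ∷ xs) = ≡.cong suc (length≡∑ xs)

sum-content : ∀ {m} (w : List (Fin m)) → sum (content w id) ≡ length w
sum-content {m} w = begin
  sum (content w id)
    ≡⟨ sum-tabulate≡∑ (λ x → occurrences x w) ⟩
  ∑ (allFin m) (λ x → occurrences x w)
    ≡⟨ ∑-cong (allFin m) (λ x → length-filter≡∑ (Fin._≟ x) w) ⟩
  ∑ (allFin m) (λ x → ∑ w (λ y → ⟦ y Fin.≟ x ⟧))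
    ≡⟨ ∑-comm _ (allFin m) w ⟩
  ∑ w (λ y → ∑ (allFin m) (λ x → ⟦ y Fin.≟ x ⟧))
    ≡⟨ ∑-cong w (λ y → ≡.trans (∑-cong (allFin m) λ x → ≡.sym (ℕₚ.*-identityʳ _)) (∑-≟ y (λ _ → 1))) ⟩
  ∑ w (λ _ → 1)
    ≡⟨ length≡∑ w ⟩
  length w ∎
  where
  open ℕ∑
  open ≡.≡-Reasoning

∈-tabulate⇔ : ∀ {n p} {P : Fin n → Set p} (P? : ∀ j → Dec (P j)) j →
  j ∈ Vec.tabulate (does ∘ P?) ⇔ P j
∈-tabulate⇔ P? j = mk⇔
  (λ j∈ → holds (P? j) (≡.trans (≡.sym (Vecₚ.lookup∘tabulate (does ∘ P?) j)) (Vecₚ.[]=⇒lookup j∈)))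
  (λ p → Vecₚ.lookup⇒[]= j _ (≡.trans (Vecₚ.lookup∘tabulate (does ∘ P?) j) (dec-true (P? j) p)))
  where
  holds : ∀ {p} {P : Set p} (d : Dec P) → does d ≡ true → P
  holds (yes p) _ = p

-- Inversions with respect to a relation D

module Inversions {n d} {D : Rel (Fin n) d} (D? : B.Decidable D) where
  open ℕ∑
  open ≡.≡-Reasoning

  row : Fin n → List (Fin n) → ℕ
  row x w = ∑[ y ∈ w ] ⟦ D? x y ⟧

  cross : List (Fin n) → List (Fin n) → ℕ
  cross u v = ∑[ x ∈ u ] row x v

  invᴸ : List (Fin n) → ℕ
  invᴸ []      = 0
  invᴸ (x ∷ w) = row x w ℕ.+ invᴸ w

  invᴸ-++ : ∀ u v → invᴸ (u ++ v) ≡ (invᴸ u ℕ.+ cross u v) ℕ.+ invᴸ v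
  invᴸ-++ []      v = refl
  invᴸ-++ (x ∷ u) v = begin
    row x (u ++ v) ℕ.+ invᴸ (u ++ v)
      ≡⟨ ≡.cong₂ ℕ._+_ (∑-++ _ u v) (invᴸ-++ u v) ⟩
    (row x u ℕ.+ row x v) ℕ.+ ((invᴸ u ℕ.+ cross u v) ℕ.+ invᴸ v)
      ≡⟨ lemma (row x u) (row x v) (invᴸ u) (cross u v) (invᴸ v) ⟩
    ((row x u ℕ.+ invᴸ u) ℕ.+ (row x v ℕ.+ cross u v)) ℕ.+ invᴸ v ∎
    where
    lemma : ∀ a b d e f → (a ℕ.+ b) ℕ.+ ((d ℕ.+ e) ℕ.+ f) ≡ ((a ℕ.+ d) ℕ.+ (b ℕ.+ e)) ℕ.+ f
    lemma = solve-∀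

  row-zero : ∀ {x w} → All (λ y → ¬ D x y) w → row x w ≡ 0
  row-zero []                 = refl
  row-zero {x} (_∷_ {y} ¬d ds) = ≡.cong₂ ℕ._+_ (⟦⟧-false (D? x y) ¬d) (row-zero ds)

  cross-∷ʳ : ∀ {x u} v → All (λ y → ¬ D y x) u → cross u (x ∷ v) ≡ cross u v
  cross-∷ʳ v []                 = refl
  cross-∷ʳ {x} v (_∷_ {y} ¬d ds) =
    ≡.cong₂ ℕ._+_ (≡.cong (ℕ._+ row y v) (⟦⟧-false (D? y x) ¬d)) (cross-∷ʳ v ds)

  ∑-<≡invᴸ : ∀ {k} (w : Fin k → Fin n) →
    ∑[ i ∈ allFin k ] ∑[ j ∈ allFin k ] ⟦ (i Fin.<? j) ×-dec D? (w i) (w j) ⟧ ≡ invᴸ (tabulate w)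
  ∑-<≡invᴸ {zero}  w = refl
  ∑-<≡invᴸ {suc k} w = begin
    ∑[ i ∈ allFin (suc k) ] ∑[ j ∈ allFin (suc k) ] t i j
      ≡⟨ ∑-allFin-suc k _ ⟩
    (∑[ j ∈ allFin (suc k) ] t zero j) ℕ.+ (∑[ i ∈ allFin k ] ∑[ j ∈ allFin (suc k) ] t (suc i) j)
      ≡⟨ ≡.cong₂ ℕ._+_ (∑-allFin-suc k (t zero)) (∑-cong (allFin k) λ i → ∑-allFin-suc k (t (suc i))) ⟩
    (∑[ j ∈ allFin k ] ⟦ D? (w zero) (w (suc j)) ⟧) ℕ.+ (∑[ i ∈ allFin k ] ∑[ j ∈ allFin k ] t (suc i) (suc j))
      ≡⟨ ≡.cong₂ ℕ._+_ (∑-tabulate (w ∘ suc) _) (≡.trans (≡.sym (∑-<≡invᴸ (w ∘ suc))) refl) ⟨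
    invᴸ (tabulate w) ∎
    where
    t : Fin (suc k) → Fin (suc k) → ℕ
    t i j = ⟦ (i Fin.<? j) ×-dec D? (w i) (w j) ⟧

-- The coefficients of F as values on 𝕙-slots

module WordSide {c ℓ p} (R : CommutativeRing c ℓ) (P : FinitePoset p) (β : Multiset P) where
  open CommutativeRing R hiding (refl; trans; zero)
  private module R = CommutativeRing R
  open FinitePoset P
  open Sum commutativeSemiring
  open Alternating R
  open Counting R
  open Noncommutative R _<ₚ?_
  open import Relation.Binary.Reasoning.Setoid setoid

  _▷?_ : B.Decidable (λ x y → y <ₚ x)
  x ▷? y = y <ₚ? x

  ∑-quasi : ∀ {m} (α : Vec ℕ m) φ →
    ∑[ w ∈ wordsᴷ (sum α) ] φ w * quasi _▷?_ w α ≈ G φ (hslots (toList α))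
  ∑-quasi []      φ = R.trans (+-identityʳ _) (R.trans (*-congˡ (R.trans (+-identityʳ _) (*-identityˡ _))) (*-identityʳ _))
  ∑-quasi (a ∷ α) φ = begin
    ∑[ w ∈ wordsᴷ (a ℕ.+ sum α) ] φ w * quasi _▷?_ w (a ∷ α)
      ≈⟨ ∑-words-+ (allFin size) a (sum α) _ ⟩
    ∑[ u ∈ wordsᴷ a ] ∑[ v ∈ wordsᴷ (sum α) ] φ (u ++ v) * quasi _▷?_ (u ++ v) (a ∷ α)
      ≈⟨ ∑-congAll (All.map (λ {u} |u|≡a → block u |u|≡a) (words-length (allFin size) a)) ⟩
    ∑[ u ∈ wordsᴷ a ] ⟦ nod? u ⟧ * (∑[ v ∈ wordsᴷ (sum α) ] φ (u ++ v) * quasi _▷?_ v α)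
      ≈⟨ ∑-cong (wordsᴷ a) (λ u → *-congˡ (∑-quasi α (φ ∘ (u ++_)))) ⟩
    G φ (hslots (toList (a ∷ α))) ∎
    where
    open import Algebra.Properties.CommutativeSemigroup *-commutativeSemigroup using (x∙yz≈y∙xz)
    block : ∀ u → length u ≡ a →
      ∑[ v ∈ wordsᴷ (sum α) ] φ (u ++ v) * quasi _▷?_ (u ++ v) (a ∷ α) ≈
      ⟦ nod? u ⟧ * (∑[ v ∈ wordsᴷ (sum α) ] φ (u ++ v) * quasi _▷?_ v α)
    block u refl = R.trans
      (∑-cong (wordsᴷ (sum α)) λ v → R.trans (*-congˡ (quasi-block _▷?_ u v α)) (x∙yz≈y∙xz _ _ _))
      (∑-*ˡ ⟦ nod? u ⟧ _ (wordsᴷ (sum α)))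

  Des⇔ : ∀ {n} (w : Fin n → Fin size) j j′ → toℕ j′ ≡ suc (toℕ j) → j ∈ Des P (n , w) ⇔ w j′ <ₚ w j
  Des⇔ w j j′ eq = mk⇔
    (λ j∈ → let (j″ , eq″ , lt) = Equivalence.to mem j∈
            in ≡.subst (λ i → w i <ₚ w j) (Finₚ.toℕ-injective (≡.trans eq″ (≡.sym eq))) lt)
    (λ lt → Equivalence.from mem (j′ , eq , lt))
    where
    mem = ∈-tabulate⇔ (λ i → Finₚ.any? λ j → (toℕ j ℕ.≟ suc (toℕ i)) ×-dec (w j <ₚ? w i)) j

  module _ (ψ : List (Fin size) → Carrier) where

    weightβ : List (Fin size) → Carrier
    weightβ w = ⟦ content w id ≟ᵛ β ⟧ * ψ w

    weightβ-length : ∀ w → sum β ≢ length w → weightβ w ≈ 0#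
    weightβ-length w ne = ⟦⟧-false* (content w id ≟ᵛ β)
      (λ eq → ne (≡.trans (≡.cong sum (≡.sym eq)) (sum-content w))) (ψ w)

    G-degree : ∀ s → sum β ≢ total s → G weightβ s ≈ 0#
    G-degree s ne = R.trans
      (G-congLength s λ w |w|≡ → weightβ-length w λ eq → ne (≡.trans eq |w|≡))
      (G-zero s λ _ → R.refl)

    F≈G : (wt : Word size → Carrier) → (∀ {n} w → wt (n , w) ≈ ψ (tabulate w)) → ∀ {m} (α : Vec ℕ m) →
      F R P (map (λ w → (wt w , w)) (wordsOfContent P β)) m α ≈ G weightβ (hslots (toList α))
    F≈G wt wt≈ {m} α = begin
      F R P (map (λ w → (wt w , w)) (wordsOfContent P β)) m α
        ≈⟨ ∑-map (λ w → (wt w , w)) (λ x → proj₁ x * Q R (Des P (proj₂ x)) m α) (wordsOfContent P β) ⟩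
      ∑[ w ∈ wordsOfContent P β ] wt w * Q R (Des P w) m α
        ≈⟨ ∑-map (sum β ,_) (λ w → wt w * Q R (Des P w) m α) (filter inContent? functions) ⟩
      ∑[ w ∈ filter inContent? functions ] wt (sum β , w) * Q R (Des P (sum β , w)) m α
        ≈⟨ ∑-filter inContent? (λ w → wt (sum β , w) * Q R (Des P (sum β , w)) m α) functions ⟩
      ∑[ w ∈ functions ] ⟦ inContent? w ⟧ * (wt (sum β , w) * Q R (Des P (sum β , w)) m α)
        ≈⟨ ∑-cong functions (λ w → R.trans (*-cong
             (reflexive (≡.cong (λ v → ⟦ v ≟ᵛ β ⟧) (content-tabulate w)))
             (*-cong (wt≈ w) (Q≈quasi _▷?_ (Des P (sum β , w)) w α (Des⇔ w)))) (sym (*-assoc _ _ _))) ⟩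
      ∑[ w ∈ functions ] weightβ (tabulate w) * quasi _▷?_ (tabulate w) α
        ≈⟨ ∑-functions (allFin size) (sum β) (λ w → weightβ w * quasi _▷?_ w α) ⟩
      ∑[ w ∈ wordsᴷ (sum β) ] weightβ w * quasi _▷?_ w α
        ≈⟨ byDegree (sum β ℕ.≟ sum α) ⟩
      G weightβ (hslots (toList α)) ∎
      where
      functions : List (Fin (sum β) → Fin size)
      functions = allFunctions (λ _ → allFin size)
      inContent? : ∀ w → Dec (content (allFin (sum β)) w ≡ β)
      inContent? w = content (allFin (sum β)) w ≟ᵛ β
      -- The words of F have the length of β, those in `∑-quasi` the degree of α. If the two differ,
      -- both sides are zero.
      byDegree : Dec (sum β ≡ sum α) →
        ∑[ w ∈ wordsᴷ (sum β) ] weightβ w * quasi _▷?_ w α ≈ G weightβ (hslots (toList α))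
      byDegree (yes eq) rewrite eq = ∑-quasi α weightβ
      byDegree (no ne) = R.trans
        (∑-congAll (All.map (λ {w} |w|≡ → R.trans (*-congˡ (quasi-length _▷?_ w α λ eq → ne (≡.trans (≡.sym |w|≡) eq))) (zeroʳ _))
          (words-length (allFin size) (sum β))))
        (R.trans (∑-zero (wordsᴷ (sum β)) (λ _ → R.refl))
          (sym (G-degree (hslots (toList α)) λ eq → ne (≡.trans eq (total-slots 𝕙 α)))))

-- Multiplicities of letters and 0-1 vectors

module _ {m : ℕ} where

  ≡⊎≢ : ∀ (x y : Fin m) → x ≡ y ⊎ x ≢ y
  ≡⊎≢ x y = toSum (x Fin.≟ y)

  occurrences-here : ∀ (x : Fin m) w → occurrences x (x ∷ w) ≡ suc (occurrences x w)
  occurrences-here x w = ≡.cong length (filter-accept (Fin._≟ x) {xs = w} refl)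

  occurrences-there : ∀ {x y : Fin m} → x ≢ y → ∀ w → occurrences y (x ∷ w) ≡ occurrences y w
  occurrences-there {x} {y} ne w = ≡.cong length (filter-reject (Fin._≟ y) {xs = w} ne)

  occurring : ∀ {q} {Q : Fin m → Set q} {y w} → All Q w → occurrences y w ≢ 0 → Q y
  occurring                 []                ne = contradiction refl ne
  occurring {Q = Q} {y = y} (_∷_ {x} {xs} q qs) ne with ≡⊎≢ x y
  ... | inj₁ eq = ≡.subst Q eq q
  ... | inj₂ ne′ = occurring qs (≡.subst (_≢ 0) (occurrences-there ne′ xs) ne)

  occurrences-all : ∀ {q} {Q : Fin m → Set q} w → (∀ y → occurrences y w ≢ 0 → Q y) → All Q w
  occurrences-all []      f = []
  occurrences-all (x ∷ w) f =
    f x (λ eq → contradiction (≡.trans (≡.sym (occurrences-here x w)) eq) λ ()) ∷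
    occurrences-all w λ y ne → f y λ eq → ne (below y eq)
    where
    below : ∀ y → occurrences y (x ∷ w) ≡ 0 → occurrences y w ≡ 0
    below y eq with ≡⊎≢ x y
    ... | inj₁ refl = contradiction (≡.trans (≡.sym (occurrences-here x w)) eq) λ ()
    ... | inj₂ ne    = ≡.trans (≡.sym (occurrences-there ne w)) eq

  lookup-content : ∀ (w : List (Fin m)) y → lookup (content w id) y ≡ occurrences y w
  lookup-content w y = Vecₚ.lookup∘tabulate (λ x → occurrences x w) y

  content⇔ : ∀ (w : List (Fin m)) v → content w id ≡ v ⇔ (∀ y → occurrences y w ≡ lookup v y)
  content⇔ w v = mk⇔
    (λ eq y → ≡.trans (≡.sym (lookup-content w y)) (≡.cong (λ u → lookup u y) eq))
    (λ eq → ≡.trans (Vecₚ.tabulate-cong eq) (Vecₚ.tabulate∘lookup v))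

sum-update : ∀ {m} (v : Vec ℕ m) x → lookup v x ≡ 1 → sum v ≡ suc (sum (v [ x ]≔ 0))
sum-update (a ∷ v) zero    eq = ≡.cong (ℕ._+ sum v) eq
sum-update (a ∷ v) (suc x) eq = ≡.trans (≡.cong (a ℕ.+_) (sum-update v x eq)) (ℕₚ.+-suc a _)

sum-zero : ∀ {m} (v : Vec ℕ m) → (∀ y → lookup v y ≡ 0) → sum v ≡ 0
sum-zero []      f = refl
sum-zero (a ∷ v) f = ≡.cong₂ ℕ._+_ (f zero) (sum-zero v (f ∘ suc))

sum-zero⁻ : ∀ {m} (v : Vec ℕ m) → sum v ≡ 0 → ∀ y → lookup v y ≡ 0
sum-zero⁻ (a ∷ v) eq zero    = ℕₚ.m+n≡0⇒m≡0 a eq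
sum-zero⁻ (a ∷ v) eq (suc y) = sum-zero⁻ v (ℕₚ.m+n≡0⇒n≡0 a eq) y

vectors : ∀ {a} {A : Set a} → List A → (n : ℕ) → List (Vec A n)
vectors as zero    = [] ∷ []
vectors as (suc n) = cartesianProductWith _∷_ as (vectors as n)

binary : (n : ℕ) → List (Vec ℕ n)
binary = vectors (0 ∷ 1 ∷ [])

Binary : ∀ {n} → Vec ℕ n → Set
Binary v = ∀ x → lookup v x ℕ.≤ 1

binary-Binary : ∀ n → All Binary (binary n)
binary-Binary zero    = (λ ()) ∷ []
binary-Binary (suc n) = Allₚ.++⁺ (Allₚ.map⁺ (All.map (λ {v} → cons ℕ.z≤n v) (binary-Binary n)))
  (Allₚ.++⁺ (Allₚ.map⁺ (All.map (λ {v} → cons (ℕ.s≤s ℕ.z≤n) v) (binary-Binary n))) [])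
  where
  cons : ∀ {a m} → a ℕ.≤ 1 → (v : Vec ℕ m) → Binary v → Binary (a ∷ v)
  cons le v b zero    = le
  cons le v b (suc x) = b x

≤1⇒≡1 : ∀ {n} → n ℕ.≤ 1 → n ≢ 0 → n ≡ 1
≤1⇒≡1 ℕ.z≤n         ne = contradiction refl ne
≤1⇒≡1 (ℕ.s≤s ℕ.z≤n) ne = refl

-- Decreasing words as 0-1 vectors

module Chains {c ℓ p} (R : CommutativeRing c ℓ) {M : ℕ} {_≺_ : Rel (Fin M) p}
  (isOrder : IsDecStrictPartialOrder _≡_ _≺_) where
  open CommutativeRing R hiding (refl; trans; zero)
  private module R = CommutativeRing R
  open IsDecStrictPartialOrder isOrder using (irrefl) renaming (_<?_ to _≺?_; trans to ≺-trans)
  open Sum commutativeSemiring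
  open Alternating R
  open Noncommutative R _≺?_ using (wordsᴷ; dec?)
  open import Relation.Binary.Reasoning.Setoid setoid

  Decreasing : List (Fin M) → Set p
  Decreasing = Linked (λ x y → y ≺ x)

  Chain : Vec ℕ M → Set p
  Chain v = ∀ x y → lookup v x ≢ 0 → lookup v y ≢ 0 → x ≡ y ⊎ (x ≺ y ⊎ y ≺ x)

  chain? : ∀ v → Dec (Chain v)
  chain? v = Finₚ.all? λ x → Finₚ.all? λ y → ¬? (lookup v x ℕ.≟ 0) →-dec (¬? (lookup v y ℕ.≟ 0) →-dec
    ((x Fin.≟ y) ⊎-dec ((x ≺? y) ⊎-dec (y ≺? x))))

  Max : Vec ℕ M → Fin M → Set p
  Max v x = lookup v x ≢ 0 × (∀ y → lookup v y ≢ 0 → y ≡ x ⊎ y ≺ x)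

  max? : ∀ v x → Dec (Max v x)
  max? v x = ¬? (lookup v x ℕ.≟ 0) ×-dec
    Finₚ.all? λ y → ¬? (lookup v y ℕ.≟ 0) →-dec ((y Fin.≟ x) ⊎-dec (y ≺? x))

  Max-unique : ∀ {v x y} → Max v x → Max v y → y ≡ x
  Max-unique {v} {x} {y} (nx , mx) (ny , my) with mx y ny | my x nx
  ... | inj₁ eq | _       = eq
  ... | inj₂ _  | inj₁ eq = ≡.sym eq
  ... | inj₂ y≺x | inj₂ x≺y = contradiction (≺-trans y≺x x≺y) (irrefl refl)

  max-exists : ∀ v → Chain v → sum v ≢ 0 → ∃ (Max v)
  max-exists v ch ne with go (allFin M)
    where
    go : ∀ xs → All (λ y → lookup v y ≡ 0) xs ⊎
      (∃ λ x → lookup v x ≢ 0 × All (λ y → lookup v y ≢ 0 → y ≡ x ⊎ y ≺ x) xs)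
    go [] = inj₁ []
    go (y ∷ xs) with lookup v y ℕ.≟ 0 | go xs
    ... | yes y≡0 | inj₁ zs             = inj₁ (y≡0 ∷ zs)
    ... | yes y≡0 | inj₂ (x , nx , mx)  = inj₂ (x , nx , (λ ny → contradiction y≡0 ny) ∷ mx)
    ... | no ny   | inj₁ zs             = inj₂ (y , ny , (λ _ → inj₁ refl) ∷ All.map (λ z≡0 nz → contradiction z≡0 nz) zs)
    ... | no ny   | inj₂ (x , nx , mx) with ch x y nx ny
    ...   | inj₁ refl       = inj₂ (x , nx , (λ _ → inj₁ refl) ∷ mx)
    ...   | inj₂ (inj₂ y≺x) = inj₂ (x , nx , (λ _ → inj₂ y≺x) ∷ mx)
    ...   | inj₂ (inj₁ x≺y) = inj₂ (y , ny , (λ _ → inj₁ refl) ∷ All.map (λ below nz → inj₂ (raise (below nz))) mx)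
      where
      raise : ∀ {z} → z ≡ x ⊎ z ≺ x → z ≺ y
      raise (inj₁ refl) = x≺y
      raise (inj₂ z≺x)  = ≺-trans z≺x x≺y
  ... | inj₁ zs            = contradiction (sum-zero v λ y → All.lookup zs (∈-allFin y)) ne
  ... | inj₂ (x , nx , mx) = x , nx , λ y → All.lookup mx (∈-allFin y)

  decreasing-uncons : ∀ {x w} → Decreasing (x ∷ w) → All (_≺ x) w × Decreasing w
  decreasing-uncons d with Linked⇒AllPairs (λ y≺x z≺y → ≺-trans z≺y y≺x) d
  decreasing-uncons [-]      | lt ∷ _ = lt , []
  decreasing-uncons (_ ∷ d)  | lt ∷ _ = lt , d

  decreasing-cons : ∀ {x w} → All (_≺ x) w → Decreasing w → Decreasing (x ∷ w)
  decreasing-cons []       []      = [-]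
  decreasing-cons (lt ∷ _) [-]     = lt ∷ [-]
  decreasing-cons (lt ∷ _) (d ∷ ds) = lt ∷ d ∷ ds

  decreasing-occurrences : ∀ {w} → Decreasing w → ∀ y → occurrences y w ℕ.≤ 1
  decreasing-occurrences {[]}    d y = ℕ.z≤n
  decreasing-occurrences {x ∷ w} d y with lt , d′ ← decreasing-uncons d with ≡⊎≢ x y
  ... | inj₂ ne    = ≡.subst (ℕ._≤ 1) (≡.sym (occurrences-there ne w)) (decreasing-occurrences d′ y)
  ... | inj₁ refl = ≡.subst (ℕ._≤ 1) (≡.sym (occurrences-here x w)) (ℕ.s≤s (ℕₚ.≤-reflexive (absent lt)))
    where
    absent : ∀ {x w} → All (_≺ x) w → occurrences x w ≡ 0
    absent {x} {w} lt with occurrences x w ℕ.≟ 0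
    ... | yes eq = eq
    ... | no ne  = contradiction (occurring lt ne) (irrefl refl)

  module _ (v : Vec ℕ M) (bin : Binary v) (x : Fin M) where

    remove-max : ∀ w → (Decreasing (x ∷ w) × content (x ∷ w) id ≡ v) →
      Max v x × (Decreasing w × content w id ≡ v [ x ]≔ 0)
    remove-max w (d , refl) with lt , d′ ← decreasing-uncons d =
      ((λ eq → 1+n≢0 (≡.trans (≡.sym (occurrences-here x w)) (≡.trans (≡.sym (lookup-content (x ∷ w) x)) eq))) ,
       λ y ny → below y (ny ∘ ≡.trans (lookup-content (x ∷ w) y))) ,
      d′ , Equivalence.from (content⇔ w _) counts
      where
      1+n≢0 : ∀ {n} → suc n ≢ 0
      1+n≢0 ()
      below : ∀ y → occurrences y (x ∷ w) ≢ 0 → y ≡ x ⊎ y ≺ x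
      below y ny with ≡⊎≢ x y
      ... | inj₁ eq = inj₁ (≡.sym eq)
      ... | inj₂ ne  = inj₂ (occurring lt (≡.subst (_≢ 0) (occurrences-there ne w) ny))
      counts : ∀ y → occurrences y w ≡ lookup (content (x ∷ w) id [ x ]≔ 0) y
      counts y with ≡⊎≢ y x
      ... | inj₂ ne    = ≡.trans (≡.sym (occurrences-there (ne ∘ ≡.sym) w)) (≡.trans (≡.sym (lookup-content (x ∷ w) y))
        (≡.sym (Vecₚ.lookup∘update′ ne (content (x ∷ w) id) 0)))
      ... | inj₁ refl = ≡.trans
        (ℕₚ.n≤0⇒n≡0 (ℕ.s≤s⁻¹ (≡.subst (ℕ._≤ 1) (occurrences-here x w) (decreasing-occurrences d x))))
        (≡.sym (Vecₚ.lookup∘update x (content (x ∷ w) id) 0))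

    insert-max : ∀ w → Max v x × (Decreasing w × content w id ≡ v [ x ]≔ 0) →
      (Decreasing (x ∷ w) × content (x ∷ w) id ≡ v)
    insert-max w ((nx , mx) , d , eq) =
      decreasing-cons (occurrences-all w below) d , Equivalence.from (content⇔ (x ∷ w) v) counts
      where
      count : ∀ y → occurrences y w ≡ lookup (v [ x ]≔ 0) y
      count = Equivalence.to (content⇔ w _) eq
      below : ∀ y → occurrences y w ≢ 0 → y ≺ x
      below y ny with ≡⊎≢ y x
      ... | inj₁ refl = contradiction (≡.trans (count x) (Vecₚ.lookup∘update x v 0)) ny
      ... | inj₂ ne with mx y (ny ∘ ≡.trans (≡.trans (count y) (Vecₚ.lookup∘update′ ne v 0)))
      ...   | inj₁ y≡x = contradiction y≡x ne
      ...   | inj₂ y≺x = y≺x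
      counts : ∀ y → occurrences y (x ∷ w) ≡ lookup v y
      counts y with ≡⊎≢ x y
      ... | inj₂ ne    = ≡.trans (occurrences-there ne w) (≡.trans (count y) (Vecₚ.lookup∘update′ (ne ∘ ≡.sym) v 0))
      ... | inj₁ refl = ≡.trans (occurrences-here x w) (≡.trans (≡.cong suc (≡.trans (count x) (Vecₚ.lookup∘update x v 0)))
        (≡.sym (≤1⇒≡1 (bin x) nx)))

    update-below : ∀ {y} → lookup (v [ x ]≔ 0) y ≢ 0 → lookup v y ≢ 0
    update-below {y} ny eq with ≡⊎≢ y x
    ... | inj₁ refl = ny (Vecₚ.lookup∘update x v 0)
    ... | inj₂ ne    = ny (≡.trans (Vecₚ.lookup∘update′ ne v 0) eq)

    update-Binary : Binary (v [ x ]≔ 0)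
    update-Binary y with ≡⊎≢ y x
    ... | inj₁ refl = ≡.subst (ℕ._≤ 1) (≡.sym (Vecₚ.lookup∘update x v 0)) ℕ.z≤n
    ... | inj₂ ne    = ≡.subst (ℕ._≤ 1) (≡.sym (Vecₚ.lookup∘update′ ne v 0)) (bin y)

    extend-chain : Max v x → Chain (v [ x ]≔ 0) → Chain v
    extend-chain (nx , mx) ch y z ny nz with ≡⊎≢ y x | ≡⊎≢ z x
    ... | inj₁ refl | _ with mx z nz
    ...   | inj₁ eq = inj₁ (≡.sym eq)
    ...   | inj₂ lt = inj₂ (inj₂ lt)
    extend-chain (nx , mx) ch y z ny nz | inj₂ _ | inj₁ refl with mx y ny
    ...   | inj₁ eq = inj₁ eq
    ...   | inj₂ lt = inj₂ (inj₁ lt)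
    extend-chain (nx , mx) ch y z ny nz | inj₂ y≢x | inj₂ z≢x =
      ch y z (ny ∘ ≡.trans (≡.sym (Vecₚ.lookup∘update′ y≢x v 0))) (nz ∘ ≡.trans (≡.sym (Vecₚ.lookup∘update′ z≢x v 0)))

    restrict-chain : Chain v → Chain (v [ x ]≔ 0)
    restrict-chain ch y z ny nz = ch y z (update-below ny) (update-below nz)

  -- The letters of a decreasing word are those of a chain, and determine it.
  count-decreasing : ∀ n v → Binary v →
    ∑[ w ∈ wordsᴷ n ] ⟦ dec? w ⟧ * ⟦ content w id ≟ᵛ v ⟧ ≈ ⟦ chain? v ⟧ * ⟦ n ℕ.≟ sum v ⟧
  count-decreasing zero v bin = begin
    1# * ⟦ content [] id ≟ᵛ v ⟧ + 0#
      ≈⟨ R.trans (+-identityʳ _) (*-identityˡ _) ⟩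
    ⟦ content [] id ≟ᵛ v ⟧
      ≈⟨ ⟦⟧-cong to from (content [] id ≟ᵛ v) (chain? v ×-dec (0 ℕ.≟ sum v)) ⟩
    ⟦ chain? v ×-dec (0 ℕ.≟ sum v) ⟧
      ≈⟨ ⟦⟧-× (chain? v) (0 ℕ.≟ sum v) ⟩
    ⟦ chain? v ⟧ * ⟦ 0 ℕ.≟ sum v ⟧ ∎
    where
    to : content [] id ≡ v → Chain v × 0 ≡ sum v
    to eq = (λ x y nx _ → contradiction (≡.sym (Equivalence.to (content⇔ [] v) eq x)) nx) ,
      ≡.sym (sum-zero v λ y → ≡.sym (Equivalence.to (content⇔ [] v) eq y))
    from : Chain v × 0 ≡ sum v → content [] id ≡ v
    from (_ , eq) = Equivalence.from (content⇔ [] v) λ y → ≡.sym (sum-zero⁻ v (≡.sym eq) y)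
  count-decreasing (suc n) v bin = begin
    ∑[ w ∈ wordsᴷ (suc n) ] ⟦ dec? w ⟧ * ⟦ content w id ≟ᵛ v ⟧
      ≈⟨ ∑-words-suc (allFin M) n _ ⟩
    ∑[ x ∈ allFin M ] ∑[ w ∈ wordsᴷ n ] ⟦ dec? (x ∷ w) ⟧ * ⟦ content (x ∷ w) id ≟ᵛ v ⟧
      -- A decreasing word starts with the maximum of its letters. Hence only the maximum x of the
      -- support of v contributes, and the rest of the word has content v with the entry at x
      -- erased.
      ≈⟨ ∑-cong (allFin M) (λ x → R.trans (∑-cong (wordsᴷ n) (peel x)) (∑-*ˡ ⟦ max? v x ⟧ _ (wordsᴷ n))) ⟩
    ∑[ x ∈ allFin M ] ⟦ max? v x ⟧ * (∑[ w ∈ wordsᴷ n ] ⟦ dec? w ⟧ * ⟦ content w id ≟ᵛ (v [ x ]≔ 0) ⟧)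
      ≈⟨ ∑-cong (allFin M) (λ x → R.trans
           (*-congˡ (count-decreasing n (v [ x ]≔ 0) (update-Binary v bin x))) (guard (max? v x) (shrink x))) ⟩
    ∑[ x ∈ allFin M ] ⟦ max? v x ⟧ * target
      ≈⟨ R.trans (∑-*ʳ target _ (allFin M)) (*-comm _ _) ⟩
    (⟦ chain? v ⟧ * ⟦ suc n ℕ.≟ sum v ⟧) * (∑[ x ∈ allFin M ] ⟦ max? v x ⟧)
      ≈⟨ R.trans (*-assoc _ _ _) (guard (chain? v) λ ch → guard (suc n ℕ.≟ sum v) λ eq → unique ch eq) ⟩
    ⟦ chain? v ⟧ * (⟦ suc n ℕ.≟ sum v ⟧ * 1#)
      ≈⟨ *-congˡ (*-identityʳ _) ⟩
    target ∎
    where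
    target = ⟦ chain? v ⟧ * ⟦ suc n ℕ.≟ sum v ⟧

    peel : ∀ x w → ⟦ dec? (x ∷ w) ⟧ * ⟦ content (x ∷ w) id ≟ᵛ v ⟧ ≈
      ⟦ max? v x ⟧ * (⟦ dec? w ⟧ * ⟦ content w id ≟ᵛ (v [ x ]≔ 0) ⟧)
    peel x w = begin
      ⟦ dec? (x ∷ w) ⟧ * ⟦ content (x ∷ w) id ≟ᵛ v ⟧
        ≈⟨ ⟦⟧-× (dec? (x ∷ w)) (content (x ∷ w) id ≟ᵛ v) ⟨
      ⟦ dec? (x ∷ w) ×-dec (content (x ∷ w) id ≟ᵛ v) ⟧
        ≈⟨ ⟦⟧-cong (remove-max v bin x w) (insert-max v bin x w)
             (dec? (x ∷ w) ×-dec (content (x ∷ w) id ≟ᵛ v))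
             (max? v x ×-dec (dec? w ×-dec (content w id ≟ᵛ (v [ x ]≔ 0)))) ⟩
      ⟦ max? v x ×-dec (dec? w ×-dec (content w id ≟ᵛ (v [ x ]≔ 0))) ⟧
        ≈⟨ R.trans (⟦⟧-× (max? v x) (dec? w ×-dec (content w id ≟ᵛ (v [ x ]≔ 0)))) (*-congˡ (⟦⟧-× (dec? w) (content w id ≟ᵛ (v [ x ]≔ 0)))) ⟩
      ⟦ max? v x ⟧ * (⟦ dec? w ⟧ * ⟦ content w id ≟ᵛ (v [ x ]≔ 0) ⟧) ∎

    shrink : ∀ x → Max v x →
      ⟦ chain? (v [ x ]≔ 0) ⟧ * ⟦ n ℕ.≟ sum (v [ x ]≔ 0) ⟧ ≈ ⟦ chain? v ⟧ * ⟦ suc n ℕ.≟ sum v ⟧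
    shrink x mx = *-cong
      (⟦⟧-cong (extend-chain v bin x mx) (restrict-chain v bin x) (chain? (v [ x ]≔ 0)) (chain? v))
      (reflexive (≡.cong (λ s → ⟦ suc n ℕ.≟ s ⟧) (≡.sym (sum-update v x (≤1⇒≡1 (bin x) (proj₁ mx))))))

    unique : Chain v → suc n ≡ sum v → ∑[ x ∈ allFin M ] ⟦ max? v x ⟧ ≈ 1#
    unique ch eq with x , mx ← max-exists v ch (λ eq′ → contradiction (≡.trans eq eq′) λ ()) =
      R.trans (∑-cong (allFin M) λ y → sym (*-identityʳ _)) (∑-unique (max? v) x mx (λ y my → Max-unique {v} mx my) (λ _ → 1#))

  ∑-binary : ∀ {m} (u : Vec ℕ m) → Binary u → (f : Vec ℕ m → Carrier) →
    ∑[ v ∈ binary m ] ⟦ u ≟ᵛ v ⟧ * f v ≈ f u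
  ∑-binary []      bin f = R.trans (+-identityʳ _) (*-identityˡ _)
  ∑-binary {suc m} (a ∷ u) bin f = begin
    ∑[ v ∈ binary (suc m) ] ⟦ (a ∷ u) ≟ᵛ v ⟧ * f v
      ≈⟨ ∑-product _∷_ (λ v → ⟦ (a ∷ u) ≟ᵛ v ⟧ * f v) (0 ∷ 1 ∷ []) (binary m) ⟩
    ∑[ b ∈ 0 ∷ 1 ∷ [] ] ∑[ v ∈ binary m ] ⟦ (a ∷ u) ≟ᵛ (b ∷ v) ⟧ * f (b ∷ v)
      ≈⟨ ∑-cong (0 ∷ 1 ∷ []) (λ b → R.trans
           (∑-cong (binary m) λ v → ⟦⟧-×* (a ℕ.≟ b) (u ≟ᵛ v) (f (b ∷ v)))
           (R.trans (∑-*ˡ ⟦ a ℕ.≟ b ⟧ _ (binary m)) (*-congˡ (∑-binary u (bin ∘ suc) (f ∘ (b ∷_)))))) ⟩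
    ∑[ b ∈ 0 ∷ 1 ∷ [] ] ⟦ a ℕ.≟ b ⟧ * f (b ∷ u)
      ≈⟨ pick (bin zero) ⟩
    f (a ∷ u) ∎
    where
    pick : ∀ {a} → a ℕ.≤ 1 → ∑[ b ∈ 0 ∷ 1 ∷ [] ] ⟦ a ℕ.≟ b ⟧ * f (b ∷ u) ≈ f (a ∷ u)
    pick ℕ.z≤n         = R.trans (+-cong (*-identityˡ _) (R.trans (+-identityʳ _) (zeroˡ _))) (+-identityʳ _)
    pick (ℕ.s≤s ℕ.z≤n) = R.trans (+-cong (zeroˡ _) (R.trans (+-identityʳ _) (*-identityˡ _))) (+-identityˡ _)

  -- Trades words for vectors, since a family of words cannot be transposed but a 0-1 matrix can.
  ∑-decreasing : ∀ n (f : Vec ℕ M → Carrier) →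
    ∑[ w ∈ wordsᴷ n ] ⟦ dec? w ⟧ * f (content w id) ≈
    ∑[ v ∈ binary M ] (⟦ chain? v ⟧ * ⟦ n ℕ.≟ sum v ⟧) * f v
  ∑-decreasing n f = begin
    ∑[ w ∈ wordsᴷ n ] ⟦ dec? w ⟧ * f (content w id)
      ≈⟨ ∑-cong (wordsᴷ n) (λ w → R.trans
           (guard (dec? w) λ d → sym (∑-binary (content w id)
             (λ x → ≡.subst (ℕ._≤ 1) (≡.sym (lookup-content w x)) (decreasing-occurrences d x)) f))
           (sym (∑-*ˡ ⟦ dec? w ⟧ _ (binary M)))) ⟩
    ∑[ w ∈ wordsᴷ n ] ∑[ v ∈ binary M ] ⟦ dec? w ⟧ * (⟦ content w id ≟ᵛ v ⟧ * f v)
      ≈⟨ ∑-comm _ (wordsᴷ n) (binary M) ⟩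
    ∑[ v ∈ binary M ] ∑[ w ∈ wordsᴷ n ] ⟦ dec? w ⟧ * (⟦ content w id ≟ᵛ v ⟧ * f v)
      ≈⟨ ∑-cong (binary M) (λ v → R.trans (∑-cong (wordsᴷ n) λ w → sym (*-assoc _ _ _)) (∑-*ʳ (f v) _ (wordsᴷ n))) ⟩
    ∑[ v ∈ binary M ] (∑[ w ∈ wordsᴷ n ] ⟦ dec? w ⟧ * ⟦ content w id ≟ᵛ v ⟧) * f v
      ≈⟨ ∑-congAll (All.map (λ {v} bin → *-congʳ (count-decreasing n v bin)) (binary-Binary M)) ⟩
    ∑[ v ∈ binary M ] (⟦ chain? v ⟧ * ⟦ n ℕ.≟ sum v ⟧) * f v ∎

  rows : ∀ {N} → Vec ℕ N → List (Vec (List (Fin M)) N)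
  rows []       = [] ∷ []
  rows (l ∷ ls) = cartesianProductWith _∷_ (wordsᴷ l) (rows ls)

  contents : ∀ {N} → Vec (List (Fin M)) N → Vec (Vec ℕ M) N
  contents = Vec.map (λ w → content w id)

  allDec? : ∀ {N} (r : Vec (List (Fin M)) N) → Dec (VecAll.All Decreasing r)
  allDec? = VecAll.all? dec?

  allChain? : ∀ {N} (B : Vec (Vec ℕ M) N) → Dec (VecAll.All Chain B)
  allChain? = VecAll.all? chain?

  ∑-rows : ∀ {N} (ls : Vec ℕ N) (Θ : Vec (Vec ℕ M) N → Carrier) →
    ∑[ r ∈ rows ls ] ⟦ allDec? r ⟧ * Θ (contents r) ≈
    ∑[ B ∈ vectors (binary M) N ] (⟦ allChain? B ⟧ * ⟦ ls ≟ᵛ Vec.map sum B ⟧) * Θ B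
  ∑-rows []       Θ = +-congʳ (*-congʳ (sym (*-identityˡ _)))
  ∑-rows {suc N} (l ∷ ls) Θ = begin
    _ ≈⟨ ∑-product _∷_ _ (wordsᴷ l) (rows ls) ⟩
    ∑[ w ∈ wordsᴷ l ] ∑[ r ∈ rows ls ] ⟦ allDec? (w ∷ r) ⟧ * Θ (content w id ∷ contents r)
      ≈⟨ ∑-cong (wordsᴷ l) (λ w → R.trans
           (∑-cong (rows ls) λ r → ⟦⟧-×* (dec? w) (allDec? r) _)
           (R.trans (∑-*ˡ ⟦ dec? w ⟧ _ (rows ls)) (*-congˡ (∑-rows ls (Θ ∘ (content w id ∷_)))))) ⟩
    ∑[ w ∈ wordsᴷ l ] ⟦ dec? w ⟧ * rest (content w id)
      ≈⟨ ∑-decreasing l rest ⟩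
    ∑[ v ∈ binary M ] (⟦ chain? v ⟧ * ⟦ l ℕ.≟ sum v ⟧) * rest v
      ≈⟨ ∑-cong (binary M) (λ v → R.trans (sym (∑-*ˡ _ _ (vectors (binary M) N)))
           (∑-cong (vectors (binary M) N) (regroup v))) ⟩
    ∑[ v ∈ binary M ] ∑[ B ∈ vectors (binary M) N ]
      (⟦ allChain? (v ∷ B) ⟧ * ⟦ (l ∷ ls) ≟ᵛ Vec.map sum (v ∷ B) ⟧) * Θ (v ∷ B)
      ≈⟨ ∑-product _∷_ _ (binary M) (vectors (binary M) N) ⟨
    _ ∎
    where
    open import Algebra.Properties.CommutativeSemigroup *-commutativeSemigroup using (interchange)
    rest : Vec ℕ M → Carrier
    rest v = ∑[ B ∈ vectors (binary M) N ] (⟦ allChain? B ⟧ * ⟦ ls ≟ᵛ Vec.map sum B ⟧) * Θ (v ∷ B)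
    regroup : ∀ v B →
      (⟦ chain? v ⟧ * ⟦ l ℕ.≟ sum v ⟧) * ((⟦ allChain? B ⟧ * ⟦ ls ≟ᵛ Vec.map sum B ⟧) * Θ (v ∷ B)) ≈
      (⟦ allChain? (v ∷ B) ⟧ * ⟦ (l ∷ ls) ≟ᵛ Vec.map sum (v ∷ B) ⟧) * Θ (v ∷ B)
    regroup v B = R.trans (sym (*-assoc _ _ _)) (*-congʳ (R.trans (interchange _ _ _ _) (*-cong
      (sym (⟦⟧-× (chain? v) (allChain? B)))
      (sym (⟦⟧-× (l ℕ.≟ sum v) (ls ≟ᵛ Vec.map sum B))))))

-- Matrices and their transposes

Matrix : ℕ → ℕ → Set
Matrix K m = Vec (Vec ℕ m) K

entry : ∀ {K m} → Matrix K m → Fin K → Fin m → ℕ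
entry B a c = lookup (lookup B a) c

transposeᴹ : ∀ {K m} → Matrix K m → Matrix m K
transposeᴹ []      = Vec.replicate _ []
transposeᴹ (v ∷ B) = Vec.zipWith _∷_ v (transposeᴹ B)

entry-transpose : ∀ {K m} (B : Matrix K m) a c → entry (transposeᴹ B) c a ≡ entry B a c
entry-transpose (v ∷ B) a c = ≡.trans
  (≡.cong (λ u → lookup u a) (Vecₚ.lookup-zipWith _∷_ c v (transposeᴹ B))) (cases a)
  where
  cases : ∀ a → lookup (lookup v c ∷ lookup (transposeᴹ B) c) a ≡ entry (v ∷ B) a c
  cases zero    = refl
  cases (suc a) = entry-transpose B a c

vec-ext : ∀ {a} {A : Set a} {n} {u v : Vec A n} → (∀ i → lookup u i ≡ lookup v i) → u ≡ v
vec-ext {u = u} {v} eq =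
  ≡.trans (≡.sym (Vecₚ.tabulate∘lookup u)) (≡.trans (Vecₚ.tabulate-cong eq) (Vecₚ.tabulate∘lookup v))

sum≡∑ : ∀ {n} (v : Vec ℕ n) → sum v ≡ ℕ∑.∑ (allFin n) (lookup v)
sum≡∑ v = ≡.trans (≡.cong sum (≡.sym (Vecₚ.tabulate∘lookup v))) (sum-tabulate≡∑ (lookup v))

columnSums : ∀ {K m} → Matrix K m → Vec ℕ m
columnSums {K} B = Vec.tabulate λ c → ℕ∑.∑ (allFin K) (λ a → entry B a c)

rowSums-transpose : ∀ {K m} (B : Matrix K m) → Vec.map sum (transposeᴹ B) ≡ columnSums B
rowSums-transpose {K} B = vec-ext λ c → ≡.trans (Vecₚ.lookup-map c sum (transposeᴹ B))
  (≡.trans (sum≡∑ (lookup (transposeᴹ B) c))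
    (≡.trans (ℕ∑.∑-cong (allFin K) λ a → entry-transpose B a c)
      (≡.sym (Vecₚ.lookup∘tabulate (λ c → ℕ∑.∑ (allFin K) (λ a → entry B a c)) c))))

columnSums-transpose : ∀ {K m} (B : Matrix K m) → columnSums (transposeᴹ B) ≡ Vec.map sum B
columnSums-transpose {K} {m} B = vec-ext λ a → ≡.trans
  (Vecₚ.lookup∘tabulate (λ a → ℕ∑.∑ (allFin m) (λ c → entry (transposeᴹ B) c a)) a)
  (≡.trans (ℕ∑.∑-cong (allFin m) λ c → entry-transpose B a c)
    (≡.trans (≡.sym (sum≡∑ (lookup B a))) (≡.sym (Vecₚ.lookup-map a sum B))))

occurrences≡∑ : ∀ {m} (c : Fin m) w → occurrences c w ≡ ℕ∑.∑ w (λ x → ℕ∑.⟦ x Fin.≟ c ⟧)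
occurrences≡∑ c w = length-filter≡∑ (Fin._≟ c) w

occurrences-++ : ∀ {m} (c : Fin m) u v → occurrences c (u ++ v) ≡ occurrences c u ℕ.+ occurrences c v
occurrences-++ c u v = ≡.trans (occurrences≡∑ c (u ++ v)) (≡.trans (ℕ∑.∑-++ _ u v)
  (≡.sym (≡.cong₂ ℕ._+_ (occurrences≡∑ c u) (occurrences≡∑ c v))))

module _ where
  open ℕ∑
  open ≡.≡-Reasoning

  ∑-occurrences : ∀ {m} (w : List (Fin m)) (g : Fin m → ℕ) →
    ∑ w g ≡ ∑[ x ∈ allFin m ] occurrences x w ℕ.* g x
  ∑-occurrences {m} w g = begin
    ∑ w g
      ≡⟨ ∑-cong w (λ y → ≡.sym (∑-≟ y g)) ⟩
    ∑[ y ∈ w ] ∑[ x ∈ allFin m ] ⟦ y Fin.≟ x ⟧ ℕ.* g x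
      ≡⟨ ∑-comm _ w (allFin m) ⟩
    ∑[ x ∈ allFin m ] ∑[ y ∈ w ] ⟦ y Fin.≟ x ⟧ ℕ.* g x
      ≡⟨ ∑-cong (allFin m) (λ x → ≡.trans (∑-*ʳ (g x) _ w) (≡.cong (ℕ._* g x) (≡.sym (occurrences≡∑ x w)))) ⟩
    ∑[ x ∈ allFin m ] occurrences x w ℕ.* g x ∎

  ∑∑-occurrences : ∀ {m n} (u : List (Fin m)) (v : List (Fin n)) (g : Fin m → Fin n → ℕ) →
    ∑[ p ∈ u ] ∑ v (g p) ≡ ∑[ x ∈ allFin m ] ∑[ y ∈ allFin n ] (occurrences x u ℕ.* occurrences y v) ℕ.* g x y
  ∑∑-occurrences {m} {n} u v g = begin
    ∑[ p ∈ u ] ∑ v (g p)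
      ≡⟨ ∑-occurrences u (λ p → ∑ v (g p)) ⟩
    ∑[ x ∈ allFin m ] occurrences x u ℕ.* ∑ v (g x)
      ≡⟨ ∑-cong (allFin m) (λ x → ≡.trans (≡.cong (occurrences x u ℕ.*_) (∑-occurrences v (g x)))
           (≡.trans (≡.sym (∑-*ˡ (occurrences x u) _ (allFin n)))
             (∑-cong (allFin n) λ y → ≡.sym (ℕₚ.*-assoc (occurrences x u) _ _)))) ⟩
    _ ∎

-- Later entries stand further to the left: an ascent of a colouring has the larger element in the
-- larger colour, and such a pair becomes an inversion when the larger colours come first.
concatʳ : ∀ {a} {A : Set a} {n} → Vec (List A) n → List A
concatʳ []      = []
concatʳ (r ∷ rs) = concatʳ rs ++ r

-- The statistic common to inversions and ascents

module Statistic {n d} {D : Rel (Fin n) d} (D? : B.Decidable D) where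
  open Inversions D?
  open ℕ∑
  open ≡.≡-Reasoning

  -- Pairs of a larger letter in a later column and a smaller one in an earlier column.
  statistic : ∀ {m} → (Fin n → Fin m → ℕ) → ℕ
  statistic {m} e = ∑[ c ∈ allFin m ] ∑[ c′ ∈ allFin m ]
    ⟦ c Fin.<? c′ ⟧ ℕ.* (∑[ x ∈ allFin n ] ∑[ y ∈ allFin n ] (e x c′ ℕ.* e y c) ℕ.* ⟦ D? x y ⟧)

  statistic-cong : ∀ {m} {e e′ : Fin n → Fin m → ℕ} → (∀ a c → e a c ≡ e′ a c) → statistic e ≡ statistic e′
  statistic-cong {m} eq = ∑-cong (allFin m) λ c → ∑-cong (allFin m) λ c′ → ≡.cong (⟦ c Fin.<? c′ ⟧ ℕ.*_)
    (∑-cong (allFin n) λ x → ∑-cong (allFin n) λ y → ≡.cong (ℕ._* ⟦ D? x y ⟧) (≡.cong₂ ℕ._*_ (eq x c′) (eq y c)))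

  statistic≡∑cross : ∀ {m} (r : Vec (List (Fin n)) m) →
    statistic (λ a c → occurrences a (lookup r c)) ≡
    ∑[ c ∈ allFin m ] ∑[ c′ ∈ allFin m ] ⟦ c Fin.<? c′ ⟧ ℕ.* cross (lookup r c′) (lookup r c)
  statistic≡∑cross {m} r = ∑-cong (allFin m) λ c → ∑-cong (allFin m) λ c′ → ≡.cong (⟦ c Fin.<? c′ ⟧ ℕ.*_)
    (≡.sym (∑∑-occurrences (lookup r c′) (lookup r c) (λ x y → ⟦ D? x y ⟧)))

  cross-concatʳ : ∀ {m} (r : Vec (List (Fin n)) m) v → cross (concatʳ r) v ≡ ∑[ c ∈ allFin m ] cross (lookup r c) v
  cross-concatʳ []       v = refl
  cross-concatʳ {suc m} (r ∷ rs) v = begin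
    cross (concatʳ rs ++ r) v
      ≡⟨ ∑-++ _ (concatʳ rs) r ⟩
    cross (concatʳ rs) v ℕ.+ cross r v
      ≡⟨ ≡.trans (≡.cong (ℕ._+ cross r v) (cross-concatʳ rs v)) (ℕₚ.+-comm _ (cross r v)) ⟩
    cross r v ℕ.+ (∑[ c ∈ allFin m ] cross (lookup rs c) v)
      ≡⟨ ∑-allFin-suc m (λ c → cross (lookup (r ∷ rs) c) v) ⟨
    ∑[ c ∈ allFin (suc m) ] cross (lookup (r ∷ rs) c) v ∎

  -- When no factor has inversions of its own, only pairs from two different factors count, and
  -- `concatʳ` puts the letter from the later factor on the left.
  invᴸ-concatʳ : ∀ {m} (r : Vec (List (Fin n)) m) → VecAll.All (λ w → invᴸ w ≡ 0) r →
    invᴸ (concatʳ r) ≡ statistic (λ a c → occurrences a (lookup r c))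
  invᴸ-concatʳ r zs = ≡.trans (go r zs) (≡.sym (statistic≡∑cross r))
    where
    go : ∀ {m} (r : Vec (List (Fin n)) m) → VecAll.All (λ w → invᴸ w ≡ 0) r →
      invᴸ (concatʳ r) ≡ ∑[ c ∈ allFin m ] ∑[ c′ ∈ allFin m ] ⟦ c Fin.<? c′ ⟧ ℕ.* cross (lookup r c′) (lookup r c)
    go []       _                  = refl
    go {suc m} (r ∷ rs) (z VecAll.∷ zs) = begin
      invᴸ (concatʳ rs ++ r)
        ≡⟨ invᴸ-++ (concatʳ rs) r ⟩
      (invᴸ (concatʳ rs) ℕ.+ cross (concatʳ rs) r) ℕ.+ invᴸ r
        ≡⟨ ≡.trans (≡.cong ((invᴸ (concatʳ rs) ℕ.+ cross (concatʳ rs) r) ℕ.+_) z) (ℕₚ.+-identityʳ _) ⟩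
      invᴸ (concatʳ rs) ℕ.+ cross (concatʳ rs) r
        ≡⟨ ≡.trans (ℕₚ.+-comm (invᴸ (concatʳ rs)) _) (≡.cong₂ ℕ._+_ (cross-concatʳ rs r) (go rs zs)) ⟩
      (∑[ c′ ∈ allFin m ] cross (lookup rs c′) r) ℕ.+ (∑[ c ∈ allFin m ] ∑[ c′ ∈ allFin m ] term (suc c) (suc c′))
        ≡⟨ ≡.cong₂ ℕ._+_
             (≡.trans (∑-allFin-suc m (term zero)) (∑-cong (allFin m) λ c′ → ℕₚ.*-identityˡ _))
             (∑-cong (allFin m) λ c → ∑-allFin-suc m (term (suc c))) ⟨
      (∑[ c′ ∈ allFin (suc m) ] term zero c′) ℕ.+ (∑[ c ∈ allFin m ] ∑[ c′ ∈ allFin (suc m) ] term (suc c) c′)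
        ≡⟨ ∑-allFin-suc m (λ c → ∑ (allFin (suc m)) (term c)) ⟨
      ∑[ c ∈ allFin (suc m) ] ∑[ c′ ∈ allFin (suc m) ] term c c′ ∎
      where
      term : Fin (suc m) → Fin (suc m) → ℕ
      term c c′ = ⟦ c Fin.<? c′ ⟧ ℕ.* cross (lookup (r ∷ rs) c′) (lookup (r ∷ rs) c)

  -- The second reading of `statistic`: with the number of copies of a of colour c as entries it
  -- counts ascents, whereas `invᴸ-concatʳ` reads it as inversions. Together they match the powers
  -- of t on the two sides.
  statistic≡∑colours : ∀ {m} {k : Fin n → ℕ} (κ : ∀ a → Fin (k a) → Fin m) →
    ∑[ a ∈ allFin n ] ∑[ i ∈ allFin (k a) ] ∑[ a′ ∈ allFin n ] ∑[ i′ ∈ allFin (k a′) ]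
      ⟦ D? a′ a ×-dec (κ a i Fin.<? κ a′ i′) ⟧ ≡
    statistic (λ a c → occurrences c (tabulate (κ a)))
  statistic≡∑colours {m} {k} κ = begin
    _ ≡⟨ ∑-cong (allFin n) (λ a → ≡.trans (∑-comm _ (allFin (k a)) (allFin n)) (∑-cong (allFin n) λ a′ → pair a a′)) ⟩
    ∑[ a ∈ allFin n ] ∑[ a′ ∈ allFin n ] ∑[ c ∈ allFin m ] ∑[ c′ ∈ allFin m ] term a a′ c c′
      ≡⟨ ∑-cong (allFin n) (λ a → ∑-comm _ (allFin n) (allFin m)) ⟩
    ∑[ a ∈ allFin n ] ∑[ c ∈ allFin m ] ∑[ a′ ∈ allFin n ] ∑[ c′ ∈ allFin m ] term a a′ c c′
      ≡⟨ ∑-comm _ (allFin n) (allFin m) ⟩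
    ∑[ c ∈ allFin m ] ∑[ a ∈ allFin n ] ∑[ a′ ∈ allFin n ] ∑[ c′ ∈ allFin m ] term a a′ c c′
      ≡⟨ ∑-cong (allFin m) (λ c → ∑-cong (allFin n) λ a → ∑-comm _ (allFin n) (allFin m)) ⟩
    ∑[ c ∈ allFin m ] ∑[ a ∈ allFin n ] ∑[ c′ ∈ allFin m ] ∑[ a′ ∈ allFin n ] term a a′ c c′
      ≡⟨ ∑-cong (allFin m) (λ c → ∑-comm _ (allFin n) (allFin m)) ⟩
    ∑[ c ∈ allFin m ] ∑[ c′ ∈ allFin m ] ∑[ a ∈ allFin n ] ∑[ a′ ∈ allFin n ] term a a′ c c′
      ≡⟨ ∑-cong (allFin m) (λ c → ∑-cong (allFin m) λ c′ → collect c c′) ⟩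
    statistic e ∎
    where
    e : Fin n → Fin m → ℕ
    e a c = occurrences c (tabulate (κ a))

    term : Fin n → Fin n → Fin m → Fin m → ℕ
    term a a′ c c′ = (e a c ℕ.* e a′ c′) ℕ.* (⟦ D? a′ a ⟧ ℕ.* ⟦ c Fin.<? c′ ⟧)

    pair : ∀ a a′ → ∑[ i ∈ allFin (k a) ] ∑[ i′ ∈ allFin (k a′) ] ⟦ D? a′ a ×-dec (κ a i Fin.<? κ a′ i′) ⟧ ≡
      ∑[ c ∈ allFin m ] ∑[ c′ ∈ allFin m ] term a a′ c c′
    pair a a′ = begin
      _ ≡⟨ ∑-cong (allFin (k a)) (λ i → ∑-cong (allFin (k a′)) λ i′ → ⟦⟧-× (D? a′ a) (κ a i Fin.<? κ a′ i′)) ⟩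
      ∑[ i ∈ allFin (k a) ] ∑[ i′ ∈ allFin (k a′) ] g (κ a i) (κ a′ i′)
        ≡⟨ ∑-cong (allFin (k a)) (λ i → ∑-tabulate (κ a′) (g (κ a i))) ⟨
      ∑[ i ∈ allFin (k a) ] ∑ (tabulate (κ a′)) (g (κ a i))
        ≡⟨ ∑-tabulate (κ a) (λ c → ∑ (tabulate (κ a′)) (g c)) ⟨
      ∑[ c ∈ tabulate (κ a) ] ∑ (tabulate (κ a′)) (g c)
        ≡⟨ ∑∑-occurrences (tabulate (κ a)) (tabulate (κ a′)) g ⟩
      _ ∎
      where
      g : Fin m → Fin m → ℕ
      g c c′ = ⟦ D? a′ a ⟧ ℕ.* ⟦ c Fin.<? c′ ⟧

    collect : ∀ c c′ → ∑[ a ∈ allFin n ] ∑[ a′ ∈ allFin n ] term a a′ c c′ ≡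
      ⟦ c Fin.<? c′ ⟧ ℕ.* (∑[ x ∈ allFin n ] ∑[ y ∈ allFin n ] (e x c′ ℕ.* e y c) ℕ.* ⟦ D? x y ⟧)
    collect c c′ = begin
      _ ≡⟨ ∑-comm _ (allFin n) (allFin n) ⟩
      ∑[ x ∈ allFin n ] ∑[ y ∈ allFin n ] term y x c c′
        ≡⟨ ∑-cong (allFin n) (λ x → ≡.trans
             (∑-cong (allFin n) λ y → lemma (e y c) (e x c′) ⟦ D? x y ⟧ ⟦ c Fin.<? c′ ⟧)
             (∑-*ˡ ⟦ c Fin.<? c′ ⟧ _ (allFin n))) ⟩
      _ ≡⟨ ∑-*ˡ ⟦ c Fin.<? c′ ⟧ _ (allFin n) ⟩
      _ ∎
      where
      lemma : ∀ a b d f → (a ℕ.* b) ℕ.* (d ℕ.* f) ≡ f ℕ.* ((b ℕ.* a) ℕ.* d)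
      lemma = solve-∀

-- The coefficients of X as values on 𝕖-slots

module ColouringSide {c ℓ p d} (R : CommutativeRing c ℓ) (P : FinitePoset p) (β : Multiset P)
  {D : Rel (Fin (FinitePoset.size P)) d} (D? : B.Decidable D)
  (D⇒≮ : ∀ {x y} → D x y → ¬ (FinitePoset._<ₚ_ P y x)) (t : CommutativeRing.Carrier R) where
  open CommutativeRing R hiding (refl; trans; zero)
  private module R = CommutativeRing R
  open FinitePoset P
  open Sum commutativeSemiring
  open Counting R
  open Noncommutative R _<ₚ?_
  open WordSide R P β
  open Inversions D?
  open Statistic D?
  open import Algebra.Properties.Semiring.Exp semiring using (_^_)
  open import Relation.Binary.Reasoning.Setoid setoid

  <-isDecStrictPartialOrder : ∀ {m} → IsDecStrictPartialOrder _≡_ (Fin._<_ {m})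
  <-isDecStrictPartialOrder = IsStrictTotalOrder.isDecStrictPartialOrder Finₚ.<-isStrictTotalOrder

  -- Decreasing words occur in two roles: the letters of one colour, ordered by P, and the colours
  -- of the copies of one letter, ordered as numbers.
  module ℙ = Chains R isDecStrictPartialOrder
  module 𝔽 {m} = Chains R {m} <-isDecStrictPartialOrder

  φ : List (Fin size) → Carrier
  φ = weightβ (λ w → t ^ invᴸ w)

  ∑-transpose : ∀ K m (H : Matrix m K → Carrier) →
    ∑[ B ∈ vectors (binary m) K ] H (transposeᴹ B) ≈ ∑ (vectors (binary K) m) H
  ∑-transpose zero    m H = R.trans (+-identityʳ _) (sym (empty m H))
    where
    empty : ∀ m (H : Matrix m 0 → Carrier) → ∑ (vectors (binary 0) m) H ≈ H (Vec.replicate m [])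
    empty zero    H = +-identityʳ _
    empty (suc m) H = R.trans (∑-product _∷_ H (binary 0) (vectors (binary 0) m))
      (R.trans (+-identityʳ _) (empty m (H ∘ ([] ∷_))))
  ∑-transpose (suc K) m H = begin
    _ ≈⟨ ∑-product _∷_ (H ∘ transposeᴹ) (binary m) (vectors (binary m) K) ⟩
    ∑[ v ∈ binary m ] ∑[ B ∈ vectors (binary m) K ] H (Vec.zipWith _∷_ v (transposeᴹ B))
      ≈⟨ ∑-cong (binary m) (λ v → ∑-transpose K m (H ∘ Vec.zipWith _∷_ v)) ⟩
    ∑[ v ∈ binary m ] ∑[ C ∈ vectors (binary K) m ] H (Vec.zipWith _∷_ v C)
      ≈⟨ column m H ⟨
    ∑ (vectors (binary (suc K)) m) H ∎
    where
    column : ∀ m (H : Matrix m (suc K) → Carrier) → ∑ (vectors (binary (suc K)) m) H ≈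
      ∑[ v ∈ binary m ] ∑[ C ∈ vectors (binary K) m ] H (Vec.zipWith _∷_ v C)
    column zero    H = sym (+-identityʳ _)
    column (suc m) H = begin
      _ ≈⟨ ∑-product _∷_ H (binary (suc K)) (vectors (binary (suc K)) m) ⟩
      ∑[ r ∈ binary (suc K) ] ∑[ C ∈ vectors (binary (suc K)) m ] H (r ∷ C)
        ≈⟨ ∑-product _∷_ (λ r → ∑[ C ∈ vectors (binary (suc K)) m ] H (r ∷ C)) bits (binary K) ⟩
      ∑[ x ∈ bits ] ∑[ r ∈ binary K ] ∑[ C ∈ vectors (binary (suc K)) m ] H ((x ∷ r) ∷ C)
        ≈⟨ ∑-cong bits (λ x → R.trans (∑-cong (binary K) λ r → column m (H ∘ ((x ∷ r) ∷_))) (∑-comm _ (binary K) (binary m))) ⟩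
      ∑[ x ∈ bits ] ∑[ v ∈ binary m ] ∑[ r ∈ binary K ] ∑[ C ∈ vectors (binary K) m ] H ((x ∷ r) ∷ Vec.zipWith _∷_ v C)
        ≈⟨ ∑-cong bits (λ x → ∑-cong (binary m) λ v → sym (∑-product _∷_ (H ∘ Vec.zipWith _∷_ (x ∷ v)) (binary K) (vectors (binary K) m))) ⟩
      ∑[ x ∈ bits ] ∑[ v ∈ binary m ] ∑[ C ∈ vectors (binary K) (suc m) ] H (Vec.zipWith _∷_ (x ∷ v) C)
        ≈⟨ ∑-product _∷_ (λ v → ∑[ C ∈ vectors (binary K) (suc m) ] H (Vec.zipWith _∷_ v C)) bits (binary m) ⟨
      _ ∎
      where
      bits : List ℕ
      bits = 0 ∷ 1 ∷ []

  -- The word side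

  invᴸ-decreasing : ∀ {w} → ℙ.Decreasing w → invᴸ w ≡ 0
  invᴸ-decreasing {[]}    _ = refl
  invᴸ-decreasing {x ∷ w} d with lt , d′ ← ℙ.decreasing-uncons d =
    ≡.cong₂ ℕ._+_ (row-zero (All.map (λ y<x Dxy → D⇒≮ Dxy y<x) lt)) (invᴸ-decreasing d′)

  G-concatʳ : ∀ φ {m} (α : Vec ℕ m) →
    G φ (eslots (reverse (toList α))) ≈ ∑[ r ∈ ℙ.rows α ] ⟦ ℙ.allDec? r ⟧ * φ (concatʳ r)
  G-concatʳ φ []      = sym (R.trans (+-identityʳ _) (*-identityˡ _))
  G-concatʳ φ (a ∷ α) = begin
    G φ (eslots (reverse (a ∷ toList α)))
      ≡⟨ ≡.cong (G φ) (≡.trans (≡.cong eslots (unfold-reverse a (toList α))) (map-++ (𝕖 ,_) (reverse (toList α)) (a ∷ []))) ⟩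
    G φ (eslots (reverse (toList α)) ++ (𝕖 , a) ∷ [])
      ≈⟨ G-++ φ (eslots (reverse (toList α))) ((𝕖 , a) ∷ []) ⟩
    G (λ w → ∑[ u ∈ wordsᴷ a ] ⟦ dec? u ⟧ * φ (w ++ (u ++ []))) (eslots (reverse (toList α)))
      ≈⟨ G-concatʳ _ α ⟩
    ∑[ r ∈ ℙ.rows α ] ⟦ ℙ.allDec? r ⟧ * (∑[ u ∈ wordsᴷ a ] ⟦ dec? u ⟧ * φ (concatʳ r ++ (u ++ [])))
      ≈⟨ ∑-cong (ℙ.rows α) (λ r → sym (∑-*ˡ ⟦ ℙ.allDec? r ⟧ _ (wordsᴷ a))) ⟩
    ∑[ r ∈ ℙ.rows α ] ∑[ u ∈ wordsᴷ a ] ⟦ ℙ.allDec? r ⟧ * (⟦ dec? u ⟧ * φ (concatʳ r ++ (u ++ [])))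
      ≈⟨ ∑-comm _ (ℙ.rows α) (wordsᴷ a) ⟩
    ∑[ u ∈ wordsᴷ a ] ∑[ r ∈ ℙ.rows α ] ⟦ ℙ.allDec? r ⟧ * (⟦ dec? u ⟧ * φ (concatʳ r ++ (u ++ [])))
      ≈⟨ ∑-cong (wordsᴷ a) (λ u → ∑-cong (ℙ.rows α) λ r → R.trans (x∙yz≈y∙xz _ _ _)
           (R.trans (sym (⟦⟧-×* (dec? u) (ℙ.allDec? r) _))
             (*-congˡ (reflexive (≡.cong (λ v → φ (concatʳ r ++ v)) (++-identityʳ u)))))) ⟩
    ∑[ u ∈ wordsᴷ a ] ∑[ r ∈ ℙ.rows α ] ⟦ ℙ.allDec? (u ∷ r) ⟧ * φ (concatʳ (u ∷ r))
      ≈⟨ ∑-product _∷_ _ (wordsᴷ a) (ℙ.rows α) ⟨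
    _ ∎
    where
    open import Algebra.Properties.CommutativeSemigroup *-commutativeSemigroup using (x∙yz≈y∙xz)

  content-concatʳ : ∀ {m} (r : Vec (List (Fin size)) m) → content (concatʳ r) id ≡ columnSums (ℙ.contents r)
  content-concatʳ r = Vecₚ.tabulate-cong λ a → go r a
    where
    go : ∀ {m} (r : Vec (List (Fin size)) m) a →
      occurrences a (concatʳ r) ≡ ℕ∑.∑ (allFin m) (λ c → entry (ℙ.contents r) c a)
    go []       a = refl
    go {suc m} (r ∷ rs) a = ≡.trans (occurrences-++ a (concatʳ rs) r) (≡.trans
      (≡.trans (ℕₚ.+-comm (occurrences a (concatʳ rs)) _) (≡.cong₂ ℕ._+_ (≡.sym (lookup-content r a)) (go rs a)))
      (≡.sym (ℕ∑.∑-allFin-suc m (λ c → entry (ℙ.contents (r ∷ rs)) c a))))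

  wordTerm : ∀ {m} → Matrix m size → Carrier
  wordTerm C = ⟦ columnSums C ≟ᵛ β ⟧ * t ^ statistic (λ a c → entry C c a)

  entry-contents : ∀ {K m} (r : Vec (List (Fin m)) K) a c → entry (𝔽.contents r) a c ≡ occurrences c (lookup r a)
  entry-contents r a c = ≡.trans (≡.cong (λ v → lookup v c) (Vecₚ.lookup-map a _ r)) (lookup-content (lookup r a) c)

  G≈matrices : ∀ {m} (α : Vec ℕ m) → G φ (eslots (reverse (toList α))) ≈
    ∑[ C ∈ vectors (binary size) m ] (⟦ ℙ.allChain? C ⟧ * ⟦ α ≟ᵛ Vec.map sum C ⟧) * wordTerm C
  G≈matrices {m} α = begin
    G φ (eslots (reverse (toList α)))
      ≈⟨ G-concatʳ φ α ⟩
    ∑[ r ∈ ℙ.rows α ] ⟦ ℙ.allDec? r ⟧ * φ (concatʳ r)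
      ≈⟨ ∑-cong (ℙ.rows α) (λ r → guard (ℙ.allDec? r) λ ds → *-cong
           (reflexive (≡.cong (λ v → ⟦ v ≟ᵛ β ⟧) (content-concatʳ r)))
           (reflexive (≡.cong (t ^_) (≡.trans (invᴸ-concatʳ r (VecAll.map invᴸ-decreasing ds))
             (statistic-cong λ a c → ≡.sym (entry-contents r c a)))))) ⟩
    ∑[ r ∈ ℙ.rows α ] ⟦ ℙ.allDec? r ⟧ * wordTerm (ℙ.contents r)
      ≈⟨ ℙ.∑-rows α wordTerm ⟩
    _ ∎

  -- The colouring side

  tabulate-decreasing : ∀ {n m} (f : Fin n → Fin m) → (∀ i j → i Fin.< j → f j Fin.< f i) → 𝔽.Decreasing (tabulate f)
  tabulate-decreasing f lt = AllPairs⇒Linked (AllPairsₚ.tabulate⁺-< λ {i} {j} → lt i j)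

  decreasing-tabulate : ∀ {n m} (f : Fin n → Fin m) → 𝔽.Decreasing (tabulate f) → ∀ i j → i Fin.< j → f j Fin.< f i
  decreasing-tabulate {suc n} f d i j i<j with lt , d′ ← 𝔽.decreasing-uncons d with i | j | i<j
  ... | zero  | suc j′ | _           = Allₚ.tabulate⁻ lt j′
  ... | suc i′ | suc j′ | ℕ.s≤s i′<j′ = decreasing-tabulate (f ∘ suc) d′ i′ j′ i′<j′

  ColumnChains : ∀ {m} → Matrix size m → Set p
  ColumnChains B = ∀ c a a′ → entry B a c ≢ 0 → entry B a′ c ≢ 0 → a ≡ a′ ⊎ (a <ₚ a′ ⊎ a′ <ₚ a)

  columnChains? : ∀ {m} (B : Matrix size m) → Dec (ColumnChains B)
  columnChains? B = Finₚ.all? λ c → Finₚ.all? λ a → Finₚ.all? λ a′ →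
    ¬? (entry B a c ℕ.≟ 0) →-dec (¬? (entry B a′ c ℕ.≟ 0) →-dec
      ((a Fin.≟ a′) ⊎-dec ((a <ₚ? a′) ⊎-dec (a′ <ₚ? a))))

  module _ {m : ℕ} where

    rowsOf : ∀ {k} {b : Vec ℕ k} → (∀ a → Fin (lookup b a) → Fin m) → Vec (List (Fin m)) k
    rowsOf κ = Vec.tabulate (λ a → tabulate (κ a))

    ∑-rowsOf : ∀ {k} (b : Vec ℕ k) (g : Vec (List (Fin m)) k → Carrier) →
      ∑[ κ ∈ allFunctions (λ a → allFunctions {n = lookup b a} λ i → allFin m) ] g (rowsOf {b = b} κ) ≈ ∑ (𝔽.rows b) g
    ∑-rowsOf []      g = R.refl
    ∑-rowsOf (l ∷ b) g = begin
      _ ≈⟨ ∑-product _ _ (allFunctions {n = l} λ i → allFin m) _ ⟩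
      ∑[ f ∈ allFunctions {n = l} (λ i → allFin m) ]
        ∑[ κ ∈ allFunctions (λ a → allFunctions {n = lookup b a} λ i → allFin m) ] g (tabulate f ∷ rowsOf {b = b} κ)
        ≈⟨ ∑-cong (allFunctions {n = l} λ i → allFin m) (λ f → ∑-rowsOf b (g ∘ (tabulate f ∷_))) ⟩
      ∑[ f ∈ allFunctions {n = l} (λ i → allFin m) ] ∑ (𝔽.rows b) (λ r → g (tabulate f ∷ r))
        ≈⟨ ∑-functions (allFin m) l (λ w → ∑[ r ∈ 𝔽.rows b ] g (w ∷ r)) ⟩
      ∑[ w ∈ words (allFin m) l ] ∑[ r ∈ 𝔽.rows b ] g (w ∷ r)
        ≈⟨ ∑-product _∷_ g (words (allFin m) l) (𝔽.rows b) ⟨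
      ∑ (𝔽.rows (l ∷ b)) g ∎

    matrixOf : Colouring P β m → Matrix size m
    matrixOf κ = 𝔽.contents (rowsOf {b = β} κ)

    entry-matrixOf : ∀ κ a c → entry (matrixOf κ) a c ≡ occurrences c (tabulate (κ a))
    entry-matrixOf κ a c = ≡.trans (entry-contents (rowsOf {b = β} κ) a c)
      (≡.cong (occurrences c) (Vecₚ.lookup∘tabulate (λ a → tabulate (κ a)) a))

    occurs-tabulate : ∀ {n} (f : Fin n → Fin m) i → occurrences (f i) (tabulate f) ≢ 0
    occurs-tabulate f zero eq = contradiction (≡.trans (≡.sym (occurrences-here (f zero) (tabulate (f ∘ suc)))) eq) λ ()
    occurs-tabulate f (suc i) eq with ≡⊎≢ (f zero) (f (suc i))
    ... | inj₁ f≡ = contradiction (≡.trans (≡.sym (≡.trans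
      (≡.cong (λ c → occurrences c (tabulate f)) (≡.sym f≡)) (occurrences-here (f zero) (tabulate (f ∘ suc))))) eq) λ ()
    ... | inj₂ ne = occurs-tabulate (f ∘ suc) i (≡.trans (≡.sym (occurrences-there ne (tabulate (f ∘ suc)))) eq)

    tabulate-occurs : ∀ {n} (f : Fin n → Fin m) c → occurrences c (tabulate f) ≢ 0 → ∃ λ i → f i ≡ c
    tabulate-occurs f c ne = occurring {Q = λ c → ∃ λ i → f i ≡ c} (Allₚ.tabulate⁺ λ i → i , refl) ne

    entry-colour : ∀ κ a i → entry (matrixOf κ) a (κ a i) ≢ 0
    entry-colour κ a i eq = occurs-tabulate (κ a) i (≡.trans (≡.sym (entry-matrixOf κ a (κ a i))) eq)

    -- Copies of different letters may share a colour only if the letters are comparable, which is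
    -- the chain condition on columns. Copies of one letter get different colours because these
    -- decrease, so the converse recovers that case from the rows.
    admissible⇒ : ∀ κ → Admissible P {β} κ → VecAll.All 𝔽.Decreasing (rowsOf {b = β} κ) × ColumnChains (matrixOf κ)
    admissible⇒ κ (proper , dec) = VecAllₚ.tabulate⁺ (λ a → tabulate-decreasing (κ a) (dec a)) , chains
      where
      chains : ColumnChains (matrixOf κ)
      chains c a a′ ne ne′
        with i , eq ← tabulate-occurs (κ a) c (ne ∘ ≡.trans (entry-matrixOf κ a c))
        with i′ , eq′ ← tabulate-occurs (κ a′) c (ne′ ∘ ≡.trans (entry-matrixOf κ a′ c))
        with a Fin.≟ a′ | a <ₚ? a′ | a′ <ₚ? a
      ... | yes a≡a′ | _        | _        = inj₁ a≡a′
      ... | no _     | yes a<a′ | _        = inj₂ (inj₁ a<a′)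
      ... | no _     | no _     | yes a′<a = inj₂ (inj₂ a′<a)
      ... | no a≢a′  | no a≮a′  | no a′≮a  =
        contradiction (≡.trans eq (≡.sym eq′)) (proper a i a′ i′ (a≢a′ ∘ ≡.cong proj₁ , a≮a′ , a′≮a))

    admissible⇐ : ∀ κ → VecAll.All 𝔽.Decreasing (rowsOf {b = β} κ) × ColumnChains (matrixOf κ) → Admissible P {β} κ
    admissible⇐ κ (decs , chains) = proper , dec
      where
      dec : ∀ a i j → i Fin.< j → κ a j Fin.< κ a i
      dec a = decreasing-tabulate (κ a) (VecAllₚ.tabulate⁻ decs a)
      proper : ∀ a i a′ i′ → Incomparable P {β} (a , i) (a′ , i′) → κ a i ≢ κ a′ i′
      proper a i a′ i′ (ne , a≮a′ , a′≮a) eq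
        with chains (κ a i) a a′ (entry-colour κ a i) (≡.subst (λ c → entry (matrixOf κ) a′ c ≢ 0) (≡.sym eq) (entry-colour κ a′ i′))
      ... | inj₂ (inj₁ a<a′) = a≮a′ a<a′
      ... | inj₂ (inj₂ a′<a) = a′≮a a′<a
      ... | inj₁ refl with Finₚ.<-cmp i i′
      ...   | tri< i<i′ _ _ = Finₚ.<⇒≢ (dec a i i′ i<i′) (≡.sym eq)
      ...   | tri≈ _ refl _ = ne refl
      ...   | tri> _ _ i′<i = Finₚ.<⇒≢ (dec a i′ i i′<i) eq

    ∑-elements : ∀ (g : P[_] P β → ℕ) →
      ℕ∑.∑ (elements P β) g ≡ ℕ∑.∑ (allFin size) (λ a → ℕ∑.∑ (allFin (lookup β a)) (λ i → g (a , i)))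
    ∑-elements g = ≡.trans (ℕ∑.∑-concatMap (λ a → map (a ,_) (allFin (lookup β a))) g (allFin size))
      (ℕ∑.∑-cong (allFin size) λ a → ℕ∑.∑-map (a ,_) g (allFin (lookup β a)))

    content-elements : ∀ κ → content (elements P β) (colour P {β} κ) ≡ columnSums (matrixOf κ)
    content-elements κ = Vecₚ.tabulate-cong λ c → ≡.trans
      (length-filter≡∑ (λ b → colour P {β} κ b Fin.≟ c) (elements P β)) (≡.trans
      (∑-elements (λ b → ℕ∑.⟦ colour P {β} κ b Fin.≟ c ⟧))
      (ℕ∑.∑-cong (allFin size) λ a → ≡.trans (≡.sym (ℕ∑.∑-tabulate (κ a) (λ x → ℕ∑.⟦ x Fin.≟ c ⟧)))
        (≡.trans (≡.sym (occurrences≡∑ c (tabulate (κ a)))) (≡.sym (entry-matrixOf κ a c)))))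

    ascents : Colouring P β m → ℕ
    ascents κ = ℕ∑.∑ (allFin size) λ a → ℕ∑.∑ (allFin (lookup β a)) λ i →
      ℕ∑.∑ (allFin size) λ a′ → ℕ∑.∑ (allFin (lookup β a′)) λ i′ → ℕ∑.⟦ D? a′ a ×-dec (κ a i Fin.<? κ a′ i′) ⟧

    colourTerm : Vec ℕ m → Matrix size m → Carrier
    colourTerm α B = ⟦ columnChains? B ⟧ * (⟦ columnSums B ≟ᵛ α ⟧ * t ^ statistic (entry B))

    X≈matrices : (wt : Colouring P β m → Carrier) → (∀ κ → Admissible P {β} κ → wt κ ≈ t ^ ascents κ) → ∀ α →
      ∑ (colourings P β α) wt ≈
      ∑[ B ∈ vectors (binary m) size ] (⟦ 𝔽.allChain? B ⟧ * ⟦ β ≟ᵛ Vec.map sum B ⟧) * colourTerm α B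
    X≈matrices wt wt≈ α = begin
      ∑ (colourings P β α) wt
        ≈⟨ ∑-filter (λ κ → admissible? P {β} κ ×-dec hasContent? κ) wt functions ⟩
      ∑[ κ ∈ functions ] ⟦ admissible? P {β} κ ×-dec hasContent? κ ⟧ * wt κ
        ≈⟨ ∑-cong functions term ⟩
      ∑[ κ ∈ functions ] ⟦ 𝔽.allDec? (rowsOf {b = β} κ) ⟧ * colourTerm α (matrixOf κ)
        ≈⟨ ∑-rowsOf β (λ r → ⟦ 𝔽.allDec? r ⟧ * colourTerm α (𝔽.contents r)) ⟩
      ∑[ r ∈ 𝔽.rows β ] ⟦ 𝔽.allDec? r ⟧ * colourTerm α (𝔽.contents r)
        ≈⟨ 𝔽.∑-rows β (colourTerm α) ⟩
      _ ∎
      where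
      functions : List (Colouring P β m)
      functions = allFunctions λ a → allFunctions λ i → allFin m
      hasContent? : ∀ κ → Dec (content (elements P β) (colour P {β} κ) ≡ α)
      hasContent? κ = content (elements P β) (colour P {β} κ) ≟ᵛ α
      term : ∀ κ → ⟦ admissible? P {β} κ ×-dec hasContent? κ ⟧ * wt κ ≈
        ⟦ 𝔽.allDec? (rowsOf {b = β} κ) ⟧ * colourTerm α (matrixOf κ)
      term κ = begin
        ⟦ admissible? P {β} κ ×-dec hasContent? κ ⟧ * wt κ
          ≈⟨ ⟦⟧-×* (admissible? P {β} κ) (hasContent? κ) (wt κ) ⟩
        ⟦ admissible? P {β} κ ⟧ * (⟦ hasContent? κ ⟧ * wt κ)
          ≈⟨ ⟦⟧-cong* (admissible⇒ κ) (admissible⇐ κ) (admissible? P {β} κ)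
               (𝔽.allDec? (rowsOf {b = β} κ) ×-dec columnChains? (matrixOf κ)) (λ adm → *-cong
               (reflexive (≡.cong (λ v → ⟦ v ≟ᵛ α ⟧) (content-elements κ)))
               (R.trans (wt≈ κ adm) (reflexive (≡.cong (t ^_) (≡.trans (statistic≡∑colours κ)
                 (statistic-cong λ a c → ≡.sym (entry-matrixOf κ a c))))))) ⟩
        _ ≈⟨ ⟦⟧-×* (𝔽.allDec? (rowsOf {b = β} κ)) (columnChains? (matrixOf κ)) _ ⟩
        ⟦ 𝔽.allDec? (rowsOf {b = β} κ) ⟧ * colourTerm α (matrixOf κ) ∎

    transposed : ∀ α (B : Matrix size m) →
      (⟦ 𝔽.allChain? B ⟧ * ⟦ β ≟ᵛ Vec.map sum B ⟧) * colourTerm α B ≈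
      (⟦ ℙ.allChain? (transposeᴹ B) ⟧ * ⟦ α ≟ᵛ Vec.map sum (transposeᴹ B) ⟧) * wordTerm (transposeᴹ B)
    transposed α B = begin
      (⟦ 𝔽.allChain? B ⟧ * ⟦ β ≟ᵛ Vec.map sum B ⟧) * (⟦ columnChains? B ⟧ * (⟦ columnSums B ≟ᵛ α ⟧ * t ^ statistic (entry B)))
        -- Colours are totally ordered, so every row is a chain and the first bracket is 1; the
        -- condition that carries information is the one on columns.
        ≈⟨ *-cong (R.trans (*-congʳ (⟦⟧-true (𝔽.allChain? B) (VecAll.universal total-chain B))) (*-identityˡ _))
             (*-cong (⟦⟧-cong chain⇒ chain⇐ (columnChains? B) (ℙ.allChain? (transposeᴹ B))) (*-cong
               (R.trans (≟ᵛ-sym (columnSums B) α) (reflexive (≡.cong (λ v → ⟦ α ≟ᵛ v ⟧) (≡.sym (rowSums-transpose B)))))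
               (reflexive (≡.cong (t ^_) (statistic-cong λ a c → ≡.sym (entry-transpose B a c)))))) ⟩
      ⟦ β ≟ᵛ Vec.map sum B ⟧ * (chains * (sums * power))
        ≈⟨ *-congʳ (R.trans (≟ᵛ-sym β (Vec.map sum B)) (reflexive (≡.cong (λ v → ⟦ v ≟ᵛ β ⟧) (≡.sym (columnSums-transpose B))))) ⟩
      ⟦ columnSums (transposeᴹ B) ≟ᵛ β ⟧ * (chains * (sums * power))
        ≈⟨ *-congˡ (sym (*-assoc _ _ _)) ⟩
      ⟦ columnSums (transposeᴹ B) ≟ᵛ β ⟧ * ((chains * sums) * power)
        ≈⟨ x∙yz≈y∙xz _ _ _ ⟩
      (chains * sums) * (⟦ columnSums (transposeᴹ B) ≟ᵛ β ⟧ * power) ∎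
      where
      open import Algebra.Properties.CommutativeSemigroup *-commutativeSemigroup using (x∙yz≈y∙xz)
      chains = ⟦ ℙ.allChain? (transposeᴹ B) ⟧
      sums   = ⟦ α ≟ᵛ Vec.map sum (transposeᴹ B) ⟧
      power  = t ^ statistic (λ a c → entry (transposeᴹ B) c a)
      ≟ᵛ-sym : ∀ {n} (u v : Vec ℕ n) → ⟦ u ≟ᵛ v ⟧ ≈ ⟦ v ≟ᵛ u ⟧
      ≟ᵛ-sym u v = ⟦⟧-cong ≡.sym ≡.sym (u ≟ᵛ v) (v ≟ᵛ u)
      total-chain : ∀ v → 𝔽.Chain v
      total-chain v x y _ _ with Finₚ.<-cmp x y
      ... | tri< x<y _ _ = inj₂ (inj₁ x<y)
      ... | tri≈ _ x≡y _ = inj₁ x≡y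
      ... | tri> _ _ y<x = inj₂ (inj₂ y<x)
      chain⇒ : ColumnChains B → VecAll.All ℙ.Chain (transposeᴹ B)
      chain⇒ ch = VecAllₚ.lookup⁻ λ c a a′ ne ne′ →
        ch c a a′ (ne ∘ ≡.trans (entry-transpose B a c)) (ne′ ∘ ≡.trans (entry-transpose B a′ c))
      chain⇐ : VecAll.All ℙ.Chain (transposeᴹ B) → ColumnChains B
      chain⇐ chs c a a′ ne ne′ = VecAllₚ.lookup⁺ chs c a a′
        (ne ∘ ≡.trans (≡.sym (entry-transpose B a c))) (ne′ ∘ ≡.trans (≡.sym (entry-transpose B a′ c)))

    X≈G : (wt : Colouring P β m → Carrier) → (∀ κ → Admissible P {β} κ → wt κ ≈ t ^ ascents κ) → ∀ α →
      ∑ (colourings P β α) wt ≈ G φ (eslots (reverse (toList α)))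
    X≈G wt wt≈ α = begin
      ∑ (colourings P β α) wt
        ≈⟨ X≈matrices wt wt≈ α ⟩
      _ ≈⟨ ∑-cong (vectors (binary m) size) (transposed α) ⟩
      _ ≈⟨ ∑-transpose size m (λ C → (⟦ ℙ.allChain? C ⟧ * ⟦ α ≟ᵛ Vec.map sum C ⟧) * wordTerm C) ⟩
      _ ≈⟨ G≈matrices α ⟨
      G φ (eslots (reverse (toList α))) ∎

occurrences-↭ : ∀ {m} (c : Fin m) {u v} → u ↭ v → occurrences c u ≡ occurrences c v
occurrences-↭ c {u} {v} r = ≡.trans (occurrences≡∑ c u)
  (≡.trans (ℕ∑.∑-↭ _ r) (≡.sym (occurrences≡∑ c v)))

content-↭ : ∀ {m} {u v : List (Fin m)} → u ↭ v → content u id ≡ content v id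
content-↭ r = Vecₚ.tabulate-cong λ c → occurrences-↭ c r

-- Splitting a word into two subwords

left right : ∀ {a} {A : Set a} → List A → List Bool → List A
left  (x ∷ y) (true  ∷ ε) = x ∷ left y ε
left  (x ∷ y) (false ∷ ε) = left y ε
left  _       _           = []
right (x ∷ y) (true  ∷ ε) = right y ε
right (x ∷ y) (false ∷ ε) = x ∷ right y ε
right _       _           = []

trues falses : List Bool → ℕ
trues []           = 0
trues (true  ∷ ε)  = suc (trues ε)
trues (false ∷ ε)  = trues ε
falses []          = 0
falses (true  ∷ ε) = falses ε
falses (false ∷ ε) = suc (falses ε)

bools : List Bool
bools = true ∷ false ∷ []

shift : ∀ {a} {A : Set a} → Bool → (ℕ → ℕ → A) → ℕ → ℕ → A
shift true  ρ i j = ρ (suc i) j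
shift false ρ i j = ρ i (suc j)

-- Exchanging neighbouring chains in a natural unit interval order

module UnitInterval {c ℓ p q} (R : CommutativeRing c ℓ) (P : FinitePoset p)
  (N : NaturalUnitIntervalOrder q P) (t : CommutativeRing.Carrier R) where
  open CommutativeRing R hiding (refl; trans; zero)
  private module R = CommutativeRing R
  open FinitePoset P
  open NaturalUnitIntervalOrder N
  open IsDecStrictPartialOrder isDecStrictPartialOrder using () renaming (trans to <ₚ-trans)
  open IsStrictTotalOrder isStrictTotalOrder using (compare) renaming (irrefl to <-irrefl; trans to <-trans; asym to <-asym)
  open Sum commutativeSemiring
  open Alternating R
  open Noncommutative R _<ₚ?_
  open import Algebra.Properties.Semiring.Exp semiring using (_^_; ^-homo-*)
  open import Algebra.Properties.CommutativeSemigroup *-commutativeSemigroup using (x∙yz≈y∙xz)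
  open import Relation.Binary.Reasoning.Setoid setoid
  private module ℙ = Chains R isDecStrictPartialOrder

  _≤_ : Rel (Fin size) q
  z ≤ x = ¬ (x < z)

  D : Rel (Fin size) (p Level.⊔ q)
  D x y = (y < x) × (x ∼ₚ y)

  D? : ∀ x y → Dec (D x y)
  D? x y = (y <? x) ×-dec (x ∼ₚ? y)

  D⇒≮ : ∀ {x y} → D x y → ¬ (y <ₚ x)
  D⇒≮ (_ , _ , y≮x) = y≮x

  open Inversions D?

  ≤-refl : ∀ {x} → x ≤ x
  ≤-refl = <-irrefl ≡.refl

  <⇒≤ : ∀ {x y} → x < y → x ≤ y
  <⇒≤ = <-asym

  ≤⇒<⊎≡ : ∀ {x y} → x ≤ y → x < y ⊎ x ≡ y
  ≤⇒<⊎≡ {x} {y} y≮x with compare x y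
  ... | tri< x<y _ _ = inj₁ x<y
  ... | tri≈ _ x≡y _ = inj₂ x≡y
  ... | tri> _ _ y<x = contradiction y<x y≮x

  ≤-<-trans : ∀ {x y z} → x ≤ y → y < z → x < z
  ≤-<-trans x≤y y<z with ≤⇒<⊎≡ x≤y
  ... | inj₁ x<y    = <-trans x<y y<z
  ... | inj₂ ≡.refl = y<z

  ≤-trans : ∀ {x y z} → x ≤ y → y ≤ z → x ≤ z
  ≤-trans x≤y y≤z z<x with ≤⇒<⊎≡ x≤y
  ... | inj₁ x<y    = y≤z (<-trans z<x x<y)
  ... | inj₂ ≡.refl = y≤z z<x

  ≤⇒≮ₚ : ∀ {x y} → x ≤ y → ¬ (y <ₚ x)
  ≤⇒≮ₚ x≤y y<x = x≤y (<ₚ⇒< y<x)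

  -- If y <ₚ x, then z is incomparable or equal to both, and `∼ₚ-between` would place z strictly
  -- between y and x, against z ≤ y.
  ∼-upper : ∀ {x y z} → x ∼ₚ z → z ≤ y → y ≤ x → ¬ (y <ₚ x)
  ∼-upper {x} {y} {z} (x≮z , z≮x) z≤y y≤x y<x =
    z≤y (proj₁ (∼ₚ-between (≤⇒≮ₚ z≤y , λ z<y → z≮x (<ₚ-trans z<y y<x)) (z≮x , x≮z) y<x))

  -- Dual to `∼-upper`, which supplies the relation between x and y: `∼ₚ-between` would place x
  -- strictly between z and y.
  ∼-lower : ∀ {x y z} → x ∼ₚ z → z ≤ y → y ≤ x → ¬ (z <ₚ y)
  ∼-lower {x} {y} {z} (x≮z , z≮x) z≤y y≤x z<y =
    y≤x (proj₂ (∼ₚ-between (z≮x , x≮z) (≤⇒≮ₚ y≤x , ∼-upper (x≮z , z≮x) z≤y y≤x) z<y))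

  -- The elements below x in P thus form an initial segment of the total order. In a weakly
  -- decreasing word, a letter that lies above its successor in P therefore lies above all later
  -- letters in P.
  <ₚ-≤-trans : ∀ {x y z} → y <ₚ x → z ≤ y → z <ₚ x
  <ₚ-≤-trans {x} {y} {z} y<x z≤y with z <ₚ? x
  ... | yes z<x = z<x
  ... | no z≮x  = contradiction y<x (∼-upper (x≮z , z≮x) z≤y (<⇒≤ (<ₚ⇒< y<x)))
    where
    x≮z : ¬ (x <ₚ z)
    x≮z x<z = <-irrefl ≡.refl (<-trans (<ₚ⇒< x<z) (≤-<-trans z≤y (<ₚ⇒< y<x)))

  -- Splitting the weakly decreasing word y according to ε gives two P-decreasing words; of two
  -- equal letters the first goes to the left word, so that every pair of words arises once.
  Valid : List (Fin size) → List Bool → Set (p Level.⊔ q)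
  Valid []      []          = ⊤
  Valid (x ∷ y) (true  ∷ ε) = All (_<ₚ x) (left y ε) × (All (_≤ x) (right y ε) × Valid y ε)
  Valid (x ∷ y) (false ∷ ε) = All (_< x) (left y ε) × (All (_<ₚ x) (right y ε) × Valid y ε)
  Valid _       _           = ⊥

  valid? : ∀ y ε → Dec (Valid y ε)
  valid? []      []          = yes (tt)
  valid? (x ∷ y) (true  ∷ ε) =
    all? (_<ₚ? x) (left y ε) ×-dec (all? (λ z → ¬? (x <? z)) (right y ε) ×-dec valid? y ε)
  valid? (x ∷ y) (false ∷ ε) =
    all? (_<? x) (left y ε) ×-dec (all? (_<ₚ? x) (right y ε) ×-dec valid? y ε)
  valid? []      (_ ∷ _)     = no λ ()
  valid? (_ ∷ _) []          = no λ ()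

  -- Merging two decreasing words

  -- Which of two decreasing words supplies the first letter of the merged word: the one with the
  -- larger head, and the left one on a tie. The conditions range over the whole other word in order
  -- to agree with those of `Valid`.
  lead₁ lead₂ : List (Fin size) → List (Fin size) → Carrier
  lead₁ []      b = 0#
  lead₁ (x ∷ a) b = ⟦ all? (λ z → ¬? (x <? z)) b ⟧
  lead₂ a []      = 0#
  lead₂ a (z ∷ b) = ⟦ all? (_<? z) a ⟧

  lead₁+lead₂ : ∀ {a b} → ℙ.Decreasing a → ℙ.Decreasing b → length a ℕ.+ length b ≢ 0 → lead₁ a b + lead₂ a b ≈ 1#
  lead₁+lead₂ {[]}    {[]}    _  _  ne = contradiction ≡.refl ne
  lead₁+lead₂ {x ∷ a} {[]}    _  _  _  = +-identityʳ _
  lead₁+lead₂ {[]}    {z ∷ b} _  _  _  = +-identityˡ _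
  lead₁+lead₂ {x ∷ a} {z ∷ b} da db _ with toSum (x <? z)
  ... | inj₁ x<z = R.trans (+-cong
    (⟦⟧-false (all? (λ w → ¬? (x <? w)) (z ∷ b)) λ { (z≤x ∷ _) → z≤x x<z })
    (⟦⟧-true (all? (_<? z) (x ∷ a)) (x<z ∷ All.map (λ y<x → <-trans (<ₚ⇒< y<x) x<z) (proj₁ (ℙ.decreasing-uncons da)))))
    (+-identityˡ _)
  ... | inj₂ z≤x = R.trans (+-cong
    (⟦⟧-true (all? (λ w → ¬? (x <? w)) (z ∷ b)) (z≤x ∷ All.map (λ y<z → ≤-trans (<⇒≤ (<ₚ⇒< y<z)) z≤x) (proj₁ (ℙ.decreasing-uncons db))))
    (⟦⟧-false (all? (_<? z) (x ∷ a)) λ { (x<z ∷ _) → z≤x x<z }))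
    (+-identityʳ _)

  pairs : ℕ → ℕ → (List (Fin size) → List (Fin size) → Carrier) → Carrier
  pairs i j g = ∑[ a ∈ wordsᴷ i ] ⟦ dec? a ⟧ * (∑[ b ∈ wordsᴷ j ] ⟦ dec? b ⟧ * g a b)

  pairs-cong : ∀ i j {g g′} → (∀ {a b} → length a ≡ i → length b ≡ j → ℙ.Decreasing a → ℙ.Decreasing b → g a b ≈ g′ a b) →
    pairs i j g ≈ pairs i j g′
  pairs-cong i j eq =
    ∑-congAll (All.map (λ {a} |a| → guard (dec? a) λ da →
      ∑-congAll (All.map (λ {b} |b| → guard (dec? b) λ db → eq |a| |b| da db) (words-length (allFin size) j)))
      (words-length (allFin size) i))

  pairs-+ : ∀ i j g g′ → pairs i j (λ a b → g a b + g′ a b) ≈ pairs i j g + pairs i j g′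
  pairs-+ i j g g′ = R.trans
    (∑-cong (wordsᴷ i) λ a → R.trans
      (*-congˡ (R.trans (∑-cong (wordsᴷ j) λ b → distribˡ ⟦ dec? b ⟧ (g a b) (g′ a b)) (∑-+ _ _ (wordsᴷ j))))
      (distribˡ ⟦ dec? a ⟧ _ _))
    (∑-+ _ _ (wordsᴷ i))

  ⟦dec-∷⟧ : ∀ x a → ⟦ dec? (x ∷ a) ⟧ ≈ ⟦ dec? a ⟧ * ⟦ all? (_<ₚ? x) a ⟧
  ⟦dec-∷⟧ x a = R.trans
    (⟦⟧-cong (λ d → let lt , d′ = ℙ.decreasing-uncons d in d′ , lt) (λ (d , lt) → ℙ.decreasing-cons lt d)
      (dec? (x ∷ a)) (dec? a ×-dec all? (_<ₚ? x) a))
    (⟦⟧-× (dec? a) (all? (_<ₚ? x) a))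

  onLeft onRight : Fin size → (List (Fin size) → List (Fin size) → Carrier) → List (Fin size) → List (Fin size) → Carrier
  onLeft  x g a b = ⟦ all? (_<ₚ? x) a ⟧ * (⟦ all? (λ z → ¬? (x <? z)) b ⟧ * g (x ∷ a) b)
  onRight x g a b = ⟦ all? (_<? x) a ⟧ * (⟦ all? (_<ₚ? x) b ⟧ * g a (x ∷ b))

  pairs-lead₁ : ∀ i j g → pairs (suc i) j (λ a b → lead₁ a b * g a b) ≈ ∑[ x ∈ allFin size ] pairs i j (onLeft x g)
  pairs-lead₁ i j g = R.trans (∑-words-suc (allFin size) i _) (∑-cong (allFin size) λ x → ∑-cong (wordsᴷ i) λ a →
    R.trans (*-congʳ (⟦dec-∷⟧ x a)) (R.trans (*-assoc _ _ _) (*-congˡ (R.trans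
      (sym (∑-*ˡ ⟦ all? (_<ₚ? x) a ⟧ _ (wordsᴷ j))) (∑-cong (wordsᴷ j) λ b → x∙yz≈y∙xz _ _ _)))))

  pairs-lead₂ : ∀ i j g → pairs i (suc j) (λ a b → lead₂ a b * g a b) ≈ ∑[ x ∈ allFin size ] pairs i j (onRight x g)
  pairs-lead₂ i j g = begin
    _ ≈⟨ ∑-cong (wordsᴷ i) (λ a → *-congˡ (R.trans (∑-words-suc (allFin size) j _)
           (∑-cong (allFin size) λ x → ∑-cong (wordsᴷ j) λ b →
             R.trans (*-congʳ (⟦dec-∷⟧ x b)) (R.trans (*-assoc _ _ _) (*-congˡ (x∙yz≈y∙xz _ _ _)))))) ⟩
    _ ≈⟨ ∑-cong (wordsᴷ i) (λ a → sym (∑-*ˡ ⟦ dec? a ⟧ _ (allFin size))) ⟩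
    _ ≈⟨ ∑-comm _ (wordsᴷ i) (allFin size) ⟩
    _ ∎

  exactly : ℕ → ℕ → ℕ → ℕ → Carrier
  exactly i j a b = ⟦ i ℕ.≟ a ⟧ * ⟦ j ℕ.≟ b ⟧

  -- An arbitrary weight ρ on the two lengths survives the removal of the first letter, as
  -- `shift c ρ`. For `exactly i j` this lowers one index, or gives the zero weight if that index is
  -- already 0.
  merged : ℕ → (ℕ → ℕ → Carrier) → (List (Fin size) → List (Fin size) → Carrier) → Carrier
  merged n ρ g = ∑[ y ∈ wordsᴷ n ] ∑[ ε ∈ words bools n ]
    ⟦ valid? y ε ⟧ * (ρ (trues ε) (falses ε) * g (left y ε) (right y ε))

  merged-suc : ∀ n ρ g → merged (suc n) ρ g ≈
    (∑[ x ∈ allFin size ] merged n (shift true ρ) (onLeft x g)) +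
    (∑[ x ∈ allFin size ] merged n (shift false ρ) (onRight x g))
  merged-suc n ρ g = begin
    merged (suc n) ρ g
      ≈⟨ ∑-words-suc (allFin size) n _ ⟩
    ∑[ x ∈ allFin size ] ∑[ y ∈ wordsᴷ n ] ∑[ ε ∈ words bools (suc n) ] term (x ∷ y) ε
      ≈⟨ ∑-cong (allFin size) (λ x → ∑-cong (wordsᴷ n) λ y → R.trans (∑-words-suc bools n _) (+-congˡ (+-identityʳ _))) ⟩
    ∑[ x ∈ allFin size ] ∑[ y ∈ wordsᴷ n ]
      ((∑[ ε ∈ words bools n ] term (x ∷ y) (true ∷ ε)) + (∑[ ε ∈ words bools n ] term (x ∷ y) (false ∷ ε)))
      ≈⟨ ∑-cong (allFin size) (λ x → ∑-+ _ _ (wordsᴷ n)) ⟩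
    _ ≈⟨ ∑-+ _ _ (allFin size) ⟩
    (∑[ x ∈ allFin size ] ∑[ y ∈ wordsᴷ n ] ∑[ ε ∈ words bools n ] term (x ∷ y) (true ∷ ε)) +
    (∑[ x ∈ allFin size ] ∑[ y ∈ wordsᴷ n ] ∑[ ε ∈ words bools n ] term (x ∷ y) (false ∷ ε))
      ≈⟨ +-cong
           (∑-cong (allFin size) λ x → ∑-cong (wordsᴷ n) λ y → ∑-cong (words bools n) λ ε →
             regroup (all? (_<ₚ? x) (left y ε)) (all? (λ z → ¬? (x <? z)) (right y ε)) (valid? y ε) _ _)
           (∑-cong (allFin size) λ x → ∑-cong (wordsᴷ n) λ y → ∑-cong (words bools n) λ ε →
             regroup (all? (_<? x) (left y ε)) (all? (_<ₚ? x) (right y ε)) (valid? y ε) _ _) ⟩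
    _ ∎
    where
    term : List (Fin size) → List Bool → Carrier
    term y ε = ⟦ valid? y ε ⟧ * (ρ (trues ε) (falses ε) * g (left y ε) (right y ε))
    regroup : ∀ {a b d} {A : Set a} {B : Set b} {D : Set d} (da : Dec A) (db : Dec B) (dd : Dec D) r s →
      ⟦ da ×-dec (db ×-dec dd) ⟧ * (r * s) ≈ ⟦ dd ⟧ * (r * (⟦ da ⟧ * (⟦ db ⟧ * s)))
    regroup da db dd r s = begin
      ⟦ da ×-dec (db ×-dec dd) ⟧ * (r * s)
        ≈⟨ R.trans (⟦⟧-×* da (db ×-dec dd) _) (*-congˡ (⟦⟧-×* db dd _)) ⟩
      ⟦ da ⟧ * (⟦ db ⟧ * (⟦ dd ⟧ * (r * s)))
        ≈⟨ *-congˡ (R.trans (x∙yz≈y∙xz _ _ _) (*-congˡ (x∙yz≈y∙xz _ _ _))) ⟩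
      ⟦ da ⟧ * (⟦ dd ⟧ * (r * (⟦ db ⟧ * s)))
        ≈⟨ R.trans (x∙yz≈y∙xz _ _ _) (*-congˡ (x∙yz≈y∙xz _ _ _)) ⟩
      ⟦ dd ⟧ * (r * (⟦ da ⟧ * (⟦ db ⟧ * s))) ∎

  merged-zero : ∀ n ρ g → (∀ i j → ρ i j ≈ 0#) → merged n ρ g ≈ 0#
  merged-zero n ρ g e = ∑-zero (wordsᴷ n) λ y → ∑-zero (words bools n) λ ε →
    R.trans (*-congˡ (R.trans (*-congʳ (e _ _)) (zeroˡ _))) (zeroʳ _)

  -- By `lead₁+lead₂`, exactly one of the two words supplies the first letter of the merged word,
  -- and removing it leaves a pair of the same kind.
  pairs≈merged : ∀ n i j → i ℕ.+ j ≡ n → ∀ g → pairs i j g ≈ merged n (exactly i j) g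
  pairs≈merged zero zero zero ≡.refl g = R.trans (+-identityʳ _) (R.trans (*-identityˡ _) (R.trans (+-identityʳ _)
    (R.trans (*-congˡ (sym (R.trans (*-congʳ (*-identityˡ _)) (*-identityˡ _)))) (R.trans (sym (+-identityʳ _)) (sym (+-identityʳ _))))))
  pairs≈merged (suc n) i j eq g = begin
    pairs i j g
      ≈⟨ pairs-cong i j (λ {a} {b} |a| |b| da db → sym (R.trans (sym (distribʳ (g a b) _ _))
           (R.trans (*-congʳ (lead₁+lead₂ da db λ eq′ → contradiction (≡.trans (≡.sym eq) (≡.trans (≡.sym (≡.cong₂ ℕ._+_ |a| |b|)) eq′)) λ ()))
             (*-identityˡ _)))) ⟩
    pairs i j (λ a b → lead₁ a b * g a b + lead₂ a b * g a b)
      ≈⟨ pairs-+ i j _ _ ⟩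
    pairs i j (λ a b → lead₁ a b * g a b) + pairs i j (λ a b → lead₂ a b * g a b)
      ≈⟨ +-cong (first i eq) (second j eq) ⟩
    (∑[ x ∈ allFin size ] merged n (shift true (exactly i j)) (onLeft x g)) +
    (∑[ x ∈ allFin size ] merged n (shift false (exactly i j)) (onRight x g))
      ≈⟨ merged-suc n (exactly i j) g ⟨
    merged (suc n) (exactly i j) g ∎
    where
    first : ∀ i → i ℕ.+ j ≡ suc n → pairs i j (λ a b → lead₁ a b * g a b) ≈
      ∑[ x ∈ allFin size ] merged n (shift true (exactly i j)) (onLeft x g)
    first zero eq = R.trans
      (R.trans (+-identityʳ _) (R.trans (*-identityˡ _) (∑-zero (wordsᴷ j) λ b → R.trans (*-congˡ (zeroˡ _)) (zeroʳ _))))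
      (sym (∑-zero (allFin size) λ x → merged-zero n (shift true (exactly 0 j)) (onLeft x g) λ _ b → zeroˡ ⟦ j ℕ.≟ b ⟧))
    first (suc i) eq = R.trans (pairs-lead₁ i j g)
      (∑-cong (allFin size) λ x → pairs≈merged n i j (ℕₚ.suc-injective eq) (onLeft x g))
    second : ∀ j → i ℕ.+ j ≡ suc n → pairs i j (λ a b → lead₂ a b * g a b) ≈
      ∑[ x ∈ allFin size ] merged n (shift false (exactly i j)) (onRight x g)
    second zero eq = R.trans
      (∑-zero (wordsᴷ i) λ a → R.trans (*-congˡ (R.trans (+-identityʳ _) (R.trans (*-congˡ (zeroˡ _)) (zeroʳ _)))) (zeroʳ _))
      (sym (∑-zero (allFin size) λ x → merged-zero n (shift false (exactly i 0)) (onRight x g) λ a _ → zeroʳ ⟦ i ℕ.≟ a ⟧))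
    second (suc j) eq = R.trans (pairs-lead₂ i j g)
      (∑-cong (allFin size) λ x → pairs≈merged n i j (ℕₚ.suc-injective (≡.trans (≡.sym (ℕₚ.+-suc i j)) eq)) (onRight x g))

  -- The swap for a fixed merged word y

  -- The part of the weight that depends on the splitting: a chain has no inversions of its own, and
  -- inversions that involve the surrounding word depend only on the letters of y.
  ω : List (Fin size) → List Bool → Carrier
  ω y ε = ⟦ valid? y ε ⟧ * t ^ cross (left y ε) (right y ε)

  bounded : ∀ x y c ε → Valid (x ∷ y) (c ∷ ε) →
    All (_≤ x) (left (x ∷ y) (c ∷ ε)) × All (_≤ x) (right (x ∷ y) (c ∷ ε))
  bounded x y true  ε (l , r , _) = (≤-refl ∷ All.map (<⇒≤ ∘ <ₚ⇒<) l) , r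
  bounded x y false ε (l , r , _) = All.map <⇒≤ l , (≤-refl ∷ All.map (<⇒≤ ∘ <ₚ⇒<) r)

  valid-tail : ∀ x y c ε → Valid (x ∷ y) (c ∷ ε) → Valid y ε
  valid-tail x y true  ε (_ , _ , v) = v
  valid-tail x y false ε (_ , _ , v) = v

  cross-false : ∀ {x a} b → All (_< x) a → cross a (x ∷ b) ≡ cross a b
  cross-false b lt = cross-∷ʳ b (All.map (λ y<x (x<y , _) → <-asym y<x x<y) lt)

  row-below : ∀ {x b} → All (_<ₚ x) b → row x b ≡ 0
  row-below lt = row-zero (All.map (λ y<x Dxy → D⇒≮ Dxy y<x) lt)

  -- By `<ₚ-≤-trans`, x lies above all later letters in P, so it may go to either side and takes
  -- part in no counted pair.
  ω-break : ∀ {x x′} y → x′ <ₚ x → ∀ c c′ ε → ω (x ∷ x′ ∷ y) (c ∷ c′ ∷ ε) ≈ ω (x′ ∷ y) (c′ ∷ ε)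
  ω-break {x} {x′} y x′<x c c′ ε = ⟦⟧-cong* (valid-tail x _ c _) (cons c)
    (valid? (x ∷ x′ ∷ y) (c ∷ c′ ∷ ε)) (valid? (x′ ∷ y) (c′ ∷ ε)) (reflexive ∘ ≡.cong (t ^_) ∘ same c)
    where
    below : Valid (x′ ∷ y) (c′ ∷ ε) → All (_<ₚ x) (left (x′ ∷ y) (c′ ∷ ε)) × All (_<ₚ x) (right (x′ ∷ y) (c′ ∷ ε))
    below v with l , r ← bounded x′ y c′ ε v = All.map (<ₚ-≤-trans x′<x) l , All.map (<ₚ-≤-trans x′<x) r
    cons : ∀ c → Valid (x′ ∷ y) (c′ ∷ ε) → Valid (x ∷ x′ ∷ y) (c ∷ c′ ∷ ε)
    cons true  v with l , r ← below v = l , All.map (<⇒≤ ∘ <ₚ⇒<) r , v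
    cons false v with l , r ← below v = All.map <ₚ⇒< l , r , v
    same : ∀ c → Valid (x ∷ x′ ∷ y) (c ∷ c′ ∷ ε) →
      cross (left (x ∷ x′ ∷ y) (c ∷ c′ ∷ ε)) (right (x ∷ x′ ∷ y) (c ∷ c′ ∷ ε)) ≡
      cross (left (x′ ∷ y) (c′ ∷ ε)) (right (x′ ∷ y) (c′ ∷ ε))
    same true  (_ , _ , v) = ≡.cong (ℕ._+ _) (row-below (proj₂ (below v)))
    same false (l , _ , _) = cross-false (right (x′ ∷ y) (c′ ∷ ε)) l

  -- Expresses that x is joined to no letter of y. When y has a valid splitting it is weakly
  -- decreasing, and the first letter decides, as `fresh-below` shows.
  Fresh : Fin size → List (Fin size) → Set p
  Fresh x []      = ⊤
  Fresh x (z ∷ _) = z <ₚ x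

  fresh-below : ∀ {x} y ε → Fresh x y → Valid y ε → All (_<ₚ x) (left y ε) × All (_<ₚ x) (right y ε)
  fresh-below []      []      _   _ = [] , []
  fresh-below (z ∷ y) (c ∷ ε) z<x v with l , r ← bounded z y c ε v =
    All.map (<ₚ-≤-trans z<x) l , All.map (<ₚ-≤-trans z<x) r

  ω-same : ∀ {x x′} y → ¬ (x′ <ₚ x) → ∀ c ε → ω (x ∷ x′ ∷ y) (c ∷ c ∷ ε) ≈ 0#
  ω-same {x} {x′} y x′≮x true  ε = ⟦⟧-false* (valid? (x ∷ x′ ∷ y) (true ∷ true ∷ ε)) (λ { (x′<x ∷ _ , _) → x′≮x x′<x }) _
  ω-same {x} {x′} y x′≮x false ε = ⟦⟧-false* (valid? (x ∷ x′ ∷ y) (false ∷ false ∷ ε)) (λ { (_ , x′<x ∷ _ , _) → x′≮x x′<x }) _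

  ω-unsorted : ∀ {x x′} y → x < x′ → ∀ c c′ ε → ω (x ∷ x′ ∷ y) (c ∷ c′ ∷ ε) ≈ 0#
  ω-unsorted {x} {x′} y x<x′ c c′ ε = ⟦⟧-false* (valid? (x ∷ x′ ∷ y) (c ∷ c′ ∷ ε)) (unsorted c c′) _
    where
    unsorted : ∀ c c′ → ¬ Valid (x ∷ x′ ∷ y) (c ∷ c′ ∷ ε)
    unsorted true  true  (x′<x ∷ _ , _)     = <-asym x<x′ (<ₚ⇒< x′<x)
    unsorted true  false (_ , x′≤x ∷ _ , _) = x′≤x x<x′
    unsorted false true  (x′<x ∷ _ , _)     = <-asym x<x′ x′<x
    unsorted false false (_ , x′<x ∷ _ , _) = <-asym x<x′ (<ₚ⇒< x′<x)

  -- Three pairwise incomparable letters cannot be split into two chains.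
  ω-crowded : ∀ {x x′ x″} y → ¬ (x′ <ₚ x) → ¬ (x″ <ₚ x) → ∀ c c′ ε → ω (x ∷ x′ ∷ x″ ∷ y) (c ∷ c′ ∷ ε) ≈ 0#
  ω-crowded {x} {x′} {x″} y x′≮x x″≮x c c′ ε = ⟦⟧-false* (valid? (x ∷ x′ ∷ x″ ∷ y) (c ∷ c′ ∷ ε)) (crowded c c′ ε) _
    where
    conflict : x″ <ₚ x′ → ¬ ¬ (x < x′)
    conflict x″<x′ x′≤x = ∼-lower (≤⇒≮ₚ x″≤x , x″≮x) (<⇒≤ (<ₚ⇒< x″<x′)) x′≤x x″<x′
      where
      x″≤x : x″ ≤ x
      x″≤x = ≤-trans (<⇒≤ (<ₚ⇒< x″<x′)) x′≤x
    crowded : ∀ c c′ ε → ¬ Valid (x ∷ x′ ∷ x″ ∷ y) (c ∷ c′ ∷ ε)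
    crowded true  true  ε           (x′<x ∷ _ , _)                          = x′≮x x′<x
    crowded false false ε           (_ , x′<x ∷ _ , _)                      = x′≮x x′<x
    crowded true  false []          (_ , _ , _ , _ , ())
    crowded false true  []          (_ , _ , _ , _ , ())
    crowded true  false (true  ∷ ε) (x″<x ∷ _ , _)                          = x″≮x x″<x
    crowded false true  (false ∷ ε) (_ , x″<x ∷ _ , _)                      = x″≮x x″<x
    crowded true  false (false ∷ ε) (_ , x′≤x ∷ _ , _ , x″<x′ ∷ _ , _)      = conflict x″<x′ x′≤x
    crowded false true  (true  ∷ ε) (x′<x ∷ _ , _ , x″<x′ ∷ _ , _)          = conflict x″<x′ (<⇒≤ x′<x)

  -- Since x lies above every letter of y in P, the only pair it can add to the count is the one
  -- with x′, and here x is on the left, where it counts unless the two letters are equal.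
  ω-true-false : ∀ {x x′} y → x′ ≤ x → Fresh x y → ∀ ε →
    ω (x ∷ x′ ∷ y) (true ∷ false ∷ ε) ≈ t ^ ℕ∑.⟦ D? x x′ ⟧ * ω (x′ ∷ y) (false ∷ ε)
  ω-true-false {x} {x′} y x′≤x fresh ε = R.trans
    (⟦⟧-cong* (λ (_ , _ , v) → v) cons (valid? (x ∷ x′ ∷ y) (true ∷ false ∷ ε)) (valid? (x′ ∷ y) (false ∷ ε)) (power ∘ proj₂ ∘ proj₂))
    (x∙yz≈y∙xz _ _ _)
    where
    below : Valid (x′ ∷ y) (false ∷ ε) → All (_<ₚ x) (left y ε) × All (_<ₚ x) (right y ε)
    below (_ , _ , v) = fresh-below y ε fresh v
    cons : Valid (x′ ∷ y) (false ∷ ε) → Valid (x ∷ x′ ∷ y) (true ∷ false ∷ ε)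
    cons v with l , r ← below v = l , x′≤x ∷ All.map (<⇒≤ ∘ <ₚ⇒<) r , v
    power : Valid (x′ ∷ y) (false ∷ ε) →
      t ^ cross (x ∷ left y ε) (x′ ∷ right y ε) ≈ t ^ ℕ∑.⟦ D? x x′ ⟧ * t ^ cross (left y ε) (x′ ∷ right y ε)
    power v = R.trans
      (reflexive (≡.cong (λ k → t ^ (k ℕ.+ cross (left y ε) (x′ ∷ right y ε)))
        (≡.trans (≡.cong (ℕ∑.⟦ D? x x′ ⟧ ℕ.+_) (row-below (proj₂ (below v)))) (ℕₚ.+-identityʳ _))))
      (^-homo-* t ℕ∑.⟦ D? x x′ ⟧ _)

  -- With x on the right its pair with x′ is not an inversion, so no t appears; equal letters are
  -- excluded by the rule that the first of them goes left.
  ω-false-true : ∀ {x x′} y → Fresh x y → ∀ ε →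
    ω (x ∷ x′ ∷ y) (false ∷ true ∷ ε) ≈ ⟦ x′ <? x ⟧ * ω (x′ ∷ y) (true ∷ ε)
  ω-false-true {x} {x′} y fresh ε = R.trans
    (⟦⟧-cong* (λ { (x′<x ∷ _ , _ , v) → x′<x , v }) cons
      (valid? (x ∷ x′ ∷ y) (false ∷ true ∷ ε)) ((x′ <? x) ×-dec valid? (x′ ∷ y) (true ∷ ε))
      (λ (l , _) → reflexive (≡.cong (t ^_) (cross-false (right y ε) l))))
    (⟦⟧-×* (x′ <? x) (valid? (x′ ∷ y) (true ∷ ε)) _)
    where
    cons : x′ < x × Valid (x′ ∷ y) (true ∷ ε) → Valid (x ∷ x′ ∷ y) (false ∷ true ∷ ε)
    cons (x′<x , v@(_ , _ , v′)) with l , r ← fresh-below y ε fresh v′ = x′<x ∷ All.map <ₚ⇒< l , r , v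

  -- The generating function of the splittings of y, with ρ at the two lengths in place of a
  -- monomial in two variables.
  Z : List (Fin size) → (ℕ → ℕ → Carrier) → Carrier
  Z y ρ = ∑[ ε ∈ words bools (length y) ] ω y ε * ρ (trues ε) (falses ε)

  Zᶜ : Bool → Fin size → List (Fin size) → (ℕ → ℕ → Carrier) → Carrier
  Zᶜ c x y ρ = ∑[ ε ∈ words bools (length y) ] ω (x ∷ y) (c ∷ ε) * shift c ρ (trues ε) (falses ε)

  Z-∷ : ∀ x y ρ → Z (x ∷ y) ρ ≈ Zᶜ true x y ρ + Zᶜ false x y ρ
  Z-∷ x y ρ = R.trans (∑-words-suc bools (length y) _) (+-congˡ (+-identityʳ _))

  Zᶜ-step : ∀ c x x′ y (k : Bool → Carrier) →
    (∀ c′ ε → ω (x ∷ x′ ∷ y) (c ∷ c′ ∷ ε) ≈ k c′ * ω (x′ ∷ y) (c′ ∷ ε)) → ∀ ρ →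
    Zᶜ c x (x′ ∷ y) ρ ≈ k true * Zᶜ true x′ y (shift c ρ) + k false * Zᶜ false x′ y (shift c ρ)
  Zᶜ-step c x x′ y k eq ρ = R.trans (∑-words-suc bools (length y) _)
    (+-cong (part true) (R.trans (+-identityʳ _) (part false)))
    where
    part : ∀ c′ → ∑[ ε ∈ words bools (length y) ] ω (x ∷ x′ ∷ y) (c ∷ c′ ∷ ε) * shift c ρ (trues (c′ ∷ ε)) (falses (c′ ∷ ε)) ≈
      k c′ * Zᶜ c′ x′ y (shift c ρ)
    part true  = R.trans (∑-cong (words bools (length y)) λ ε → R.trans (*-congʳ (eq true ε)) (*-assoc _ _ _))
      (∑-*ˡ (k true) _ (words bools (length y)))
    part false = R.trans (∑-cong (words bools (length y)) λ ε → R.trans (*-congʳ (eq false ε)) (*-assoc _ _ _))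
      (∑-*ˡ (k false) _ (words bools (length y)))

  FlipInvariant : ((ℕ → ℕ → Carrier) → Carrier) → Set (c Level.⊔ ℓ)
  FlipInvariant Y = ∀ ρ → Y ρ ≈ Y (flip ρ)

  Adjacent : Fin size → List (Fin size) → Set p
  Adjacent x []      = ⊥
  Adjacent x (z ∷ _) = ¬ (z <ₚ x)

  Double : Fin size → List (Fin size) → Set
  Double x []      = ⊥
  Double x (z ∷ _) = z ≡ x

  -- In y, joining consecutive incomparable letters gives paths, and the two splittings of a
  -- path are exchanged by swapping it.  The cases say whether the path of the top letter x
  -- has odd or even length, or is a pair of equal letters (whose splitting is forced).
  data Shape (x : Fin size) (y : List (Fin size)) : Set (c Level.⊔ ℓ Level.⊔ p) where
    odd  : ∀ Y → FlipInvariant Y →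
           (∀ ρ → Zᶜ true x y ρ ≈ Y (shift true ρ)) → (∀ ρ → Zᶜ false x y ρ ≈ Y (shift false ρ)) → Shape x y
    even : Adjacent x y → ∀ Y → FlipInvariant Y →
           (∀ ρ → Zᶜ true x y ρ ≈ t * Y ρ) → (∀ ρ → Zᶜ false x y ρ ≈ Y ρ) → Shape x y
    twin : Double x y → ∀ Y → FlipInvariant Y →
           (∀ ρ → Zᶜ true x y ρ ≈ Y ρ) → (∀ ρ → Zᶜ false x y ρ ≈ 0#) → Shape x y

  -- An odd path has one letter more on the side of x; the flip moves x to the other side, where the
  -- weight is the same. An even path and a pair of equal letters are balanced, so their splitting
  -- is kept and only the rest of the word is flipped.
  shape⇒flip : ∀ {x y} → Shape x y → FlipInvariant (Z (x ∷ y))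
  shape⇒flip {x} {y} s ρ = R.trans (Z-∷ x y ρ) (R.trans (go s) (sym (Z-∷ x y (flip ρ))))
    where
    go : Shape x y → Zᶜ true x y ρ + Zᶜ false x y ρ ≈ Zᶜ true x y (flip ρ) + Zᶜ false x y (flip ρ)
    go (odd Y inv z₁ z₂) = begin
      Zᶜ true x y ρ + Zᶜ false x y ρ             ≈⟨ +-cong (z₁ ρ) (z₂ ρ) ⟩
      Y (shift true ρ) + Y (shift false ρ)       ≈⟨ +-comm _ _ ⟩
      Y (shift false ρ) + Y (shift true ρ)       ≈⟨ +-cong (inv (shift false ρ)) (inv (shift true ρ)) ⟩
      Y (shift true (flip ρ)) + Y (shift false (flip ρ)) ≈⟨ +-cong (z₁ (flip ρ)) (z₂ (flip ρ)) ⟨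
      Zᶜ true x y (flip ρ) + Zᶜ false x y (flip ρ) ∎
    go (even _ Y inv z₁ z₂) = R.trans (+-cong (R.trans (z₁ ρ) (*-congˡ (inv ρ))) (R.trans (z₂ ρ) (inv ρ)))
      (sym (+-cong (z₁ (flip ρ)) (z₂ (flip ρ))))
    go (twin _ Y inv z₁ z₂) = R.trans (+-cong (R.trans (z₁ ρ) (inv ρ)) (z₂ ρ))
      (sym (+-cong (z₁ (flip ρ)) (z₂ (flip ρ))))

  vanishing : ∀ x x′ y → (∀ c c′ ε → ω (x ∷ x′ ∷ y) (c ∷ c′ ∷ ε) ≈ 0#) → Shape x (x′ ∷ y)
  vanishing x x′ y zero-ω = odd (λ _ → 0#) (λ _ → R.refl) (vanish true) (vanish false)
    where
    vanish : ∀ c ρ → Zᶜ c x (x′ ∷ y) ρ ≈ 0#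
    vanish c ρ = R.trans
      (Zᶜ-step c x x′ y (λ _ → 0#) (λ c′ ε → R.trans (zero-ω c c′ ε) (sym (zeroˡ _))) ρ)
      (R.trans (+-cong (zeroˡ _) (zeroˡ _)) (+-identityˡ 0#))

  broken : ∀ x x′ y → x′ <ₚ x → FlipInvariant (Z (x′ ∷ y)) → Shape x (x′ ∷ y)
  broken x x′ y x′<x inv = odd (Z (x′ ∷ y)) inv (joint true) (joint false)
    where
    joint : ∀ c ρ → Zᶜ c x (x′ ∷ y) ρ ≈ Z (x′ ∷ y) (shift c ρ)
    joint c ρ = R.trans
      (Zᶜ-step c x x′ y (λ _ → 1#) (λ c′ ε → R.trans (ω-break y x′<x c c′ ε) (sym (*-identityˡ _))) ρ)
      (R.trans (+-cong (*-identityˡ _) (*-identityˡ _)) (sym (Z-∷ x′ y (shift c ρ))))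

  -- The letter x joins the path of x′ on the opposite side, which changes the parity. When x′ < x,
  -- an odd path becomes even with weights t and 1 for x on the left and right. An even path becomes
  -- odd: x on the left gains t over the weight 1 of x′ on the right, and x on the right inherits
  -- the t of x′ on the left, so the weights agree again.
  joined : ∀ x x′ y → x′ ≤ x → ¬ (x′ <ₚ x) → Fresh x y → Shape x′ y → Shape x (x′ ∷ y)
  joined x x′ y x′≤x x′≮x fresh s = extend (≤⇒<⊎≡ x′≤x) s
    where
    step₁ : ∀ ρ → Zᶜ true x (x′ ∷ y) ρ ≈ t ^ ℕ∑.⟦ D? x x′ ⟧ * Zᶜ false x′ y (shift true ρ)
    step₁ ρ = R.trans (Zᶜ-step true x x′ y k eq ρ) (R.trans (+-congʳ (zeroˡ _)) (+-identityˡ _))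
      where
      k : Bool → Carrier
      k true  = 0#
      k false = t ^ ℕ∑.⟦ D? x x′ ⟧
      eq : ∀ c′ ε → ω (x ∷ x′ ∷ y) (true ∷ c′ ∷ ε) ≈ k c′ * ω (x′ ∷ y) (c′ ∷ ε)
      eq true  ε = R.trans (ω-same y x′≮x true ε) (sym (zeroˡ _))
      eq false ε = ω-true-false y x′≤x fresh ε

    step₂ : ∀ ρ → Zᶜ false x (x′ ∷ y) ρ ≈ ⟦ x′ <? x ⟧ * Zᶜ true x′ y (shift false ρ)
    step₂ ρ = R.trans (Zᶜ-step false x x′ y k eq ρ) (R.trans (+-congˡ (zeroˡ _)) (+-identityʳ _))
      where
      k : Bool → Carrier
      k true  = ⟦ x′ <? x ⟧
      k false = 0#
      eq : ∀ c′ ε → ω (x ∷ x′ ∷ y) (false ∷ c′ ∷ ε) ≈ k c′ * ω (x′ ∷ y) (c′ ∷ ε)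
      eq true  ε = ω-false-true y fresh ε
      eq false ε = R.trans (ω-same y x′≮x false ε) (sym (zeroˡ _))

    -- A pair of equal letters is a path of its own: a further letter joined to one of them would be
    -- joined to both, which `Fresh` excludes.
    no-extension : x′ ≡ x → ¬ Adjacent x′ y
    no-extension ≡.refl = clash y fresh
      where
      clash : ∀ y → Fresh x y → ¬ Adjacent x y
      clash (z ∷ y) z<x z≮x = z≮x z<x

    no-double : ¬ Double x′ y
    no-double = clash y fresh
      where
      clash : ∀ y → Fresh x y → ¬ Double x′ y
      clash (z ∷ y) z<x ≡.refl = x′≮x z<x

    extend : x′ < x ⊎ x′ ≡ x → Shape x′ y → Shape x (x′ ∷ y)
    extend (inj₁ x′<x) s = strict s
      where
      Dxx′ : D x x′
      Dxx′ = x′<x , (≤⇒≮ₚ x′≤x , x′≮x)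
      step₁′ : ∀ ρ → Zᶜ true x (x′ ∷ y) ρ ≈ t * Zᶜ false x′ y (shift true ρ)
      step₁′ ρ = R.trans (step₁ ρ) (*-congʳ (R.trans (reflexive (≡.cong (t ^_) (ℕ∑.⟦⟧-true (D? x x′) Dxx′))) (*-identityʳ t)))
      step₂′ : ∀ ρ → Zᶜ false x (x′ ∷ y) ρ ≈ Zᶜ true x′ y (shift false ρ)
      step₂′ ρ = R.trans (step₂ ρ) (⟦⟧-true* (x′ <? x) x′<x _)
      strict : Shape x′ y → Shape x (x′ ∷ y)
      -- One letter goes to each side, and raising both lengths by one commutes definitionally with
      -- `flip`, so the invariance is that of Y.
      strict (odd Y inv z₁ z₂) = even x′≮x (λ ρ → Y (shift false (shift true ρ))) (λ ρ → inv _)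
        (λ ρ → R.trans (step₁′ ρ) (*-congˡ (z₂ (shift true ρ))))
        (λ ρ → R.trans (step₂′ ρ) (z₁ (shift false ρ)))
      strict (even _ Y inv z₁ z₂) = odd (λ ρ → t * Y ρ) (λ ρ → *-congˡ (inv ρ))
        (λ ρ → R.trans (step₁′ ρ) (*-congˡ (z₂ (shift true ρ))))
        (λ ρ → R.trans (step₂′ ρ) (z₁ (shift false ρ)))
      strict (twin double _ _ _ _) = contradiction double no-double
    extend (inj₂ x′≡x) (even adj _ _ _ _) = contradiction adj (no-extension x′≡x)
    extend (inj₂ x′≡x) (twin double _ _ _ _) = contradiction double no-double
    -- With equal letters x is forced to the left, and the pair is not an inversion, so the power of
    -- t is 1.
    extend (inj₂ x′≡x) (odd Y inv z₁ z₂)  = twin x′≡x (λ ρ → Y (shift false (shift true ρ))) (λ ρ → inv _)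
      (λ ρ → R.trans (step₁ ρ) (R.trans
        (*-congʳ (reflexive (≡.cong (t ^_) (ℕ∑.⟦⟧-false (D? x x′) λ (x′<x , _) → <-irrefl x′≡x x′<x))))
        (R.trans (*-identityˡ _) (z₂ (shift true ρ)))))
      (λ ρ → R.trans (step₂ ρ) (⟦⟧-false* (x′ <? x) (<-irrefl x′≡x) _))

  shape : ∀ x y → Shape x y
  shape x [] = odd (λ ρ → ρ 0 0) (λ _ → R.refl) (λ ρ → single _) (λ ρ → single _)
    where
    single : ∀ r → (1# * 1#) * r + 0# ≈ r
    single r = R.trans (+-identityʳ _) (R.trans (*-congʳ (*-identityˡ 1#)) (*-identityˡ r))
  shape x (x′ ∷ y) with toSum (x <? x′) | toSum (x′ <ₚ? x)
  ... | inj₁ x<x′ | _          = vanishing x x′ y (ω-unsorted y x<x′)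
  ... | inj₂ _    | inj₁ x′<x  = broken x x′ y x′<x (shape⇒flip (shape x′ y))
  ... | inj₂ x′≤x | inj₂ x′≮x  = below y (shape x′ y)
    where
    below : ∀ y → Shape x′ y → Shape x (x′ ∷ y)
    below []       s = joined x x′ [] x′≤x x′≮x (tt) s
    below (x″ ∷ y) s with toSum (x″ <ₚ? x)
    ... | inj₁ x″<x = joined x x′ (x″ ∷ y) x′≤x x′≮x x″<x s
    ... | inj₂ x″≮x = vanishing x x′ (x″ ∷ y) (ω-crowded y x′≮x x″≮x)

  Z-flip : ∀ y → FlipInvariant (Z y)
  Z-flip []      ρ = R.refl
  Z-flip (x ∷ y) ρ = shape⇒flip (shape x y) ρ

  left++right : ∀ y ε → Valid y ε → left y ε ++ right y ε ↭ y
  left++right []      []          _           = refl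
  left++right (x ∷ y) (true  ∷ ε) (_ , _ , v) = prep x (left++right y ε v)
  left++right (x ∷ y) (false ∷ ε) (_ , _ , v) = trans (↭ₚ.shift x (left y ε) (right y ε)) (prep x (left++right y ε v))

  valid⇒inv-free : ∀ y ε → Valid y ε → invᴸ (left y ε) ≡ 0 × invᴸ (right y ε) ≡ 0
  valid⇒inv-free []      []          _           = ≡.refl , ≡.refl
  valid⇒inv-free (x ∷ y) (true  ∷ ε) (l , _ , v) with i , j ← valid⇒inv-free y ε v = ≡.cong₂ ℕ._+_ (row-below l) i , j
  valid⇒inv-free (x ∷ y) (false ∷ ε) (_ , r , v) with i , j ← valid⇒inv-free y ε v = i , ≡.cong₂ ℕ._+_ (row-below r) j

  module _ (β : Multiset P) where
    open WordSide R P β using (weightβ)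

    φ : List (Fin size) → Carrier
    φ = weightβ (λ w → t ^ invᴸ w)

    -- For a fixed merged word y the context and the content condition give the factor `K y`, common
    -- to all valid splittings. What remains is `Z y`, where the flip exchanges the two lengths.
    swapInvariant : SwapInvariant φ
    swapInvariant u v i j = begin
      pairs i j (λ a b → φ (u ++ ((a ++ b) ++ v)))
        ≈⟨ pairs≈merged (i ℕ.+ j) i j ≡.refl g ⟩
      merged (i ℕ.+ j) (exactly i j) g
        ≈⟨ asZ (exactly i j) ⟩
      ∑[ y ∈ wordsᴷ (i ℕ.+ j) ] K y * Z y (exactly i j)
        ≈⟨ ∑-cong (wordsᴷ (i ℕ.+ j)) (λ y → *-congˡ (R.trans (Z-flip y (exactly i j))
             (∑-cong (words bools (length y)) λ ε → *-congˡ (*-comm ⟦ i ℕ.≟ falses ε ⟧ ⟦ j ℕ.≟ trues ε ⟧)))) ⟩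
      ∑[ y ∈ wordsᴷ (i ℕ.+ j) ] K y * Z y (exactly j i)
        ≈⟨ asZ (exactly j i) ⟨
      merged (i ℕ.+ j) (exactly j i) g
        ≈⟨ pairs≈merged (i ℕ.+ j) j i (ℕₚ.+-comm j i) g ⟨
      pairs j i (λ a b → φ (u ++ ((a ++ b) ++ v))) ∎
      where
      g : List (Fin size) → List (Fin size) → Carrier
      g a b = φ (u ++ ((a ++ b) ++ v))

      outer : List (Fin size) → ℕ
      outer y = (invᴸ u ℕ.+ cross u (y ++ v)) ℕ.+ (cross y v ℕ.+ invᴸ v)

      K : List (Fin size) → Carrier
      K y = ⟦ content (u ++ (y ++ v)) id ≟ᵛ β ⟧ * t ^ outer y

      inv-split : ∀ w → invᴸ (u ++ (w ++ v)) ≡ outer w ℕ.+ invᴸ w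
      inv-split w = ≡.trans (invᴸ-++ u (w ++ v))
        (≡.trans (≡.cong ((invᴸ u ℕ.+ cross u (w ++ v)) ℕ.+_) (invᴸ-++ w v))
          (lemma (invᴸ u ℕ.+ cross u (w ++ v)) (invᴸ w) (cross w v) (invᴸ v)))
        where
        lemma : ∀ a b d f → a ℕ.+ ((b ℕ.+ d) ℕ.+ f) ≡ (a ℕ.+ (d ℕ.+ f)) ℕ.+ b
        lemma = solve-∀

      outer-↭ : ∀ {y w} → y ↭ w → outer y ≡ outer w
      outer-↭ r = ≡.cong₂ (λ k l → (invᴸ u ℕ.+ k) ℕ.+ (l ℕ.+ invᴸ v))
        (ℕ∑.∑-cong u λ x → ℕ∑.∑-↭ _ (↭ₚ.++⁺ʳ v r)) (ℕ∑.∑-↭ _ r)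

      factor : ∀ y ε → Valid y ε → g (left y ε) (right y ε) ≈ K y * t ^ cross (left y ε) (right y ε)
      factor y ε val = R.trans
        (*-cong (reflexive (≡.cong (λ w → ⟦ w ≟ᵛ β ⟧) (content-↭ (↭ₚ.++⁺ˡ u (↭ₚ.++⁺ʳ v (left++right y ε val))))))
          (R.trans (reflexive (≡.cong (t ^_) (≡.trans (inv-split (left y ε ++ right y ε))
            (≡.cong₂ ℕ._+_ (outer-↭ (left++right y ε val)) inner)))) (^-homo-* t (outer y) _)))
        (sym (*-assoc _ _ _))
        where
        inner : invᴸ (left y ε ++ right y ε) ≡ cross (left y ε) (right y ε)
        inner with i , j ← valid⇒inv-free y ε val = ≡.trans (invᴸ-++ (left y ε) (right y ε))
          (≡.trans (≡.cong₂ (λ k l → (k ℕ.+ cross (left y ε) (right y ε)) ℕ.+ l) i j) (ℕₚ.+-identityʳ _))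

      asZ : ∀ ρ → merged (i ℕ.+ j) ρ g ≈ ∑[ y ∈ wordsᴷ (i ℕ.+ j) ] K y * Z y ρ
      asZ ρ = ∑-congAll (All.map (λ {y} |y| → collect y |y|) (words-length (allFin size) (i ℕ.+ j)))
        where
        collect : ∀ y → length y ≡ i ℕ.+ j →
          ∑[ ε ∈ words bools (i ℕ.+ j) ] ⟦ valid? y ε ⟧ * (ρ (trues ε) (falses ε) * g (left y ε) (right y ε)) ≈ K y * Z y ρ
        collect y |y| rewrite ≡.sym |y| = R.trans
          (∑-cong (words bools (length y)) λ ε → R.trans
            (guard (valid? y ε) λ val → R.trans (*-congˡ (factor y ε val)) (*-comm _ _))
            (R.trans (sym (*-assoc _ _ _)) (R.trans (*-congʳ (x∙yz≈y∙xz _ _ _)) (*-assoc _ _ _))))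
          (∑-*ˡ (K y) _ (words bools (length y)))

-- The common coefficients of F and X

module Expansion {c ℓ p d} (R : CommutativeRing c ℓ) (P : FinitePoset p) (β : Multiset P)
  {D : Rel (Fin (FinitePoset.size P)) d} (D? : B.Decidable D)
  (D⇒≮ : ∀ {x y} → D x y → ¬ (FinitePoset._<ₚ_ P y x)) (t : CommutativeRing.Carrier R) where
  open CommutativeRing R hiding (refl; trans; zero)
  private module R = CommutativeRing R
  open FinitePoset P using (size; _<ₚ?_)
  open Sum commutativeSemiring
  open Superfunctions R
  open Counting R
  open Noncommutative R _<ₚ?_
  open WordSide R P β
  open ColouringSide R P β D? D⇒≮ t
  open Inversions D?
  open import Algebra.Properties.Semiring.Exp semiring using (_^_)

  IsPartition : Carrier × List ℕ → Set
  IsPartition (_ , ns) = Linked ℕ._≥_ ns × All NonZero ns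

  partitions : ∀ {cs} → All IsPartition cs → List (Carrier × Partition)
  partitions                   []                     = []
  partitions {(r , ns) ∷ _} ((dn , nz) ∷ ps) =
    (r , record { parts = ns ; positive = nz ; decreasing = dn }) ∷ partitions ps

  linearCombination≈ : ∀ (f : Partition → Series R) (κ : Kind) →
    (∀ λ′ {m} (α : Vec ℕ m) → f λ′ m α ≈ elementary (Partition.parts λ′) (map (κ ,_) (toList α))) →
    ∀ {cs} (ps : All IsPartition cs) {m} (α : Vec ℕ m) →
    linearCombination R f (partitions ps) m α ≈ combination cs (map (κ ,_) (toList α))
  linearCombination≈ f κ f≈ []       α = R.refl
  linearCombination≈ f κ f≈ (_ ∷ ps) α = +-cong (*-congˡ (f≈ _ α)) (linearCombination≈ f κ f≈ ps α)

  F≋ωX : SwapInvariant φ →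
    (wtF : Word size → Carrier) → (∀ {n} w → wtF (n , w) ≈ t ^ invᴸ (tabulate w)) →
    (wtX : ∀ {m} → Colouring P β m → Carrier) →
    (∀ {m} (κ : Colouring P β m) → Admissible P {β} κ → wtX κ ≈ t ^ ascents κ) →
    _≋ω_ R (F R P (map (λ w → (wtF w , w)) (wordsOfContent P β))) (λ m α → ∑ (colourings P β α) wtX)
  F≋ωX inv wtF wtF≈ wtX wtX≈
    with cs , ps , eq ← expansion (sum β) (G-super φ) (G-↭ φ inv) (G-degree (λ w → t ^ invᴸ w))
    = partitions ps ,
      (λ m α → R.trans (X≈G wtX wtX≈ α)
        -- Symmetry in the slots undoes the reversed order of the colours.
        (R.trans (G-↭ φ inv (↭ₚ.map⁺ (𝕖 ,_) (↭ₚ.↭-reverse (toList α))))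
          (R.trans (eq (eslots (toList α))) (sym (linearCombination≈ (hᵖ R) 𝕖 hᵖ≈ ps α))))) ,
      (λ m α → R.trans (F≈G (λ w → t ^ invᴸ w) wtF wtF≈ α)
        (R.trans (eq (hslots (toList α))) (sym (linearCombination≈ (eᵖ R) 𝕙 eᵖ≈ ps α))))

-- Arbitrary posets

module Unweighted {c ℓ p} (R : CommutativeRing c ℓ) (P : FinitePoset p) (β : Multiset P) where
  open CommutativeRing R hiding (refl; trans; zero)
  private module R = CommutativeRing R
  open FinitePoset P
  open Sum commutativeSemiring
  open Noncommutative R _<ₚ?_
  open import Relation.Binary.Reasoning.Setoid setoid
  open import Algebra.Properties.Semiring.Exp semiring using (_^_)
  open import Algebra.Properties.CommutativeSemigroup *-commutativeSemigroup using (x∙yz≈y∙xz)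

  -- With the empty relation every exponent of t is 0, so the weighted statements specialise to
  -- plain counts without any total order on P.
  Nothing : Rel (Fin size) Level.zero
  Nothing _ _ = ⊥

  nothing? : B.Decidable Nothing
  nothing? _ _ = no λ ()

  nothing⇒ : ∀ {x y} → Nothing x y → ¬ (y <ₚ x)
  nothing⇒ ()

  open Inversions nothing?
  open ColouringSide R P β nothing? nothing⇒ 1#
  open Expansion R P β nothing? nothing⇒ 1#

  invᴸ≡0 : ∀ w → invᴸ w ≡ 0
  invᴸ≡0 []      = refl
  invᴸ≡0 (x ∷ w) = ≡.cong₂ ℕ._+_ (ℕ∑.∑-zero w (λ _ → refl)) (invᴸ≡0 w)

  φ-↭ : ∀ {w w′} → w ↭ w′ → φ w ≈ φ w′
  φ-↭ {w} {w′} r = *-cong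
    (reflexive (≡.cong (λ v → ⟦ v ≟ᵛ β ⟧) (content-↭ r)))
    (reflexive (≡.cong (1# ^_) (≡.trans (invᴸ≡0 w) (≡.sym (invᴸ≡0 w′)))))

  swapInvariant : SwapInvariant φ
  swapInvariant u v i j = begin
    ∑[ a ∈ wordsᴷ i ] ⟦ dec? a ⟧ * (∑[ b ∈ wordsᴷ j ] ⟦ dec? b ⟧ * φ (u ++ ((a ++ b) ++ v)))
      ≈⟨ ∑-cong (wordsᴷ i) (λ a → sym (∑-*ˡ ⟦ dec? a ⟧ _ (wordsᴷ j))) ⟩
    ∑[ a ∈ wordsᴷ i ] ∑[ b ∈ wordsᴷ j ] ⟦ dec? a ⟧ * (⟦ dec? b ⟧ * φ (u ++ ((a ++ b) ++ v)))
      ≈⟨ ∑-comm _ (wordsᴷ i) (wordsᴷ j) ⟩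
    ∑[ b ∈ wordsᴷ j ] ∑[ a ∈ wordsᴷ i ] ⟦ dec? a ⟧ * (⟦ dec? b ⟧ * φ (u ++ ((a ++ b) ++ v)))
      ≈⟨ ∑-cong (wordsᴷ j) (λ b → R.trans
           (∑-cong (wordsᴷ i) λ a → R.trans (x∙yz≈y∙xz _ _ _)
             (*-congˡ (*-congˡ (φ-↭ (↭ₚ.++⁺ˡ u (↭ₚ.++⁺ʳ v (↭ₚ.++-comm a b)))))))
           (∑-*ˡ ⟦ dec? b ⟧ _ (wordsᴷ i))) ⟩
    ∑[ b ∈ wordsᴷ j ] ⟦ dec? b ⟧ * (∑[ a ∈ wordsᴷ i ] ⟦ dec? a ⟧ * φ (u ++ ((b ++ a) ++ v))) ∎

  F≋ωX₁ : _≋ω_ R (F R P (W R P β)) (X R P β)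
  F≋ωX₁ = F≋ωX swapInvariant
    (λ _ → 1#) (λ w → reflexive (≡.cong (1# ^_) (≡.sym (invᴸ≡0 (tabulate w)))))
    (λ _ → 1#) (λ κ _ → reflexive (≡.cong (1# ^_) (≡.sym (no-ascents κ))))
    where
    no-ascents : ∀ {m} (κ : Colouring P β m) → ascents κ ≡ 0
    no-ascents κ = ℕ∑.∑-zero (allFin size) λ a → ℕ∑.∑-zero (allFin (lookup β a)) λ i →
      ℕ∑.∑-zero (allFin size) λ a′ → ℕ∑.∑-zero (allFin (lookup β a′)) λ i′ → refl

-- Natural unit interval orders

module Weighted {c ℓ p q} (R : CommutativeRing c ℓ) (P : FinitePoset p) (β : Multiset P)
  (N : NaturalUnitIntervalOrder q P) (t : CommutativeRing.Carrier R) where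
  open CommutativeRing R hiding (refl; trans; zero)
  open FinitePoset P
  open NaturalUnitIntervalOrder N
  open UnitInterval R P N t
  open Inversions D?
  open ColouringSide R P β D? D⇒≮ t using (ascents; ∑-elements)
  open Expansion R P β D? D⇒≮ t
  open import Algebra.Properties.Semiring.Exp semiring using (_^_)

  inv≡invᴸ : ∀ {n} (w : Fin n → Fin size) → inv P N (n , w) ≡ invᴸ (tabulate w)
  inv≡invᴸ {n} w = ≡.trans
    (length-filter≡∑ (λ (i , j) → (i Fin.<? j) ×-dec ((w j <? w i) ×-dec (w i ∼ₚ? w j))) (cartesianProduct (allFin n) (allFin n)))
    (≡.trans (ℕ∑.∑-product _,_ _ (allFin n) (allFin n)) (∑-<≡invᴸ w))

  -- Two copies of one letter are incomparable in P[β] and so are candidates for `asc`. In an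
  -- admissible colouring the later copy has the smaller colour, hence they never form an ascent,
  -- and only pairs of different letters, which `D` describes, remain.
  asc≡ascents : ∀ {m} (κ : Colouring P β m) → Admissible P {β} κ → asc P N {β} κ ≡ ascents κ
  asc≡ascents {m} κ (_ , dec) = begin
    asc P N {β} κ
      ≡⟨ length-filter≡∑ (λ (b , b′) → ascent? b b′) (cartesianProduct (elements P β) (elements P β)) ⟩
    ℕ∑.∑ (cartesianProduct (elements P β) (elements P β)) (λ (b , b′) → ℕ∑.⟦ ascent? b b′ ⟧)
      ≡⟨ ℕ∑.∑-product _,_ _ (elements P β) (elements P β) ⟩
    ℕ∑.∑ (elements P β) (λ b → ℕ∑.∑ (elements P β) λ b′ → ℕ∑.⟦ ascent? b b′ ⟧)
      ≡⟨ ∑-elements {m} _ ⟩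
    ℕ∑.∑ (allFin size) (λ a → ℕ∑.∑ (allFin (lookup β a)) λ i → ℕ∑.∑ (elements P β) λ b′ → ℕ∑.⟦ ascent? (a , i) b′ ⟧)
      ≡⟨ ℕ∑.∑-cong (allFin size) (λ a → ℕ∑.∑-cong (allFin (lookup β a)) λ i → ≡.trans (∑-elements {m} _)
           (ℕ∑.∑-cong (allFin size) λ a′ → ℕ∑.∑-cong (allFin (lookup β a′)) λ i′ →
             ℕ∑.⟦⟧-cong (to a i a′ i′) (from a i a′ i′) (ascent? (a , i) (a′ , i′)) (D? a′ a ×-dec (κ a i Fin.<? κ a′ i′)))) ⟩
    ascents κ ∎
    where
    open ≡.≡-Reasoning
    ascent? : (b b′ : P[_] P β) → Dec (_⊏_ P N {β} b b′ × (Incomparable P {β} b b′ × colour P {β} κ b Fin.< colour P {β} κ b′))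
    ascent? b b′ = _⊏?_ P N {β} b b′ ×-dec (incomparable? P {β} b b′ ×-dec (colour P {β} κ b Fin.<? colour P {β} κ b′))

    to : ∀ a i a′ i′ → (_⊏_ P N {β} (a , i) (a′ , i′) × (Incomparable P {β} (a , i) (a′ , i′) × κ a i Fin.< κ a′ i′)) →
      D a′ a × κ a i Fin.< κ a′ i′
    to a i a′ i′ (inj₁ a<a′ , (_ , a≮a′ , a′≮a) , lt) = (a<a′ , (a′≮a , a≮a′)) , lt
    to a i a  i′ (inj₂ (refl , i<i′) , _ , lt)        = contradiction lt (Finₚ.<-asym (dec a i i′ i<i′))

    from : ∀ a i a′ i′ → D a′ a × κ a i Fin.< κ a′ i′ →
      (_⊏_ P N {β} (a , i) (a′ , i′) × (Incomparable P {β} (a , i) (a′ , i′) × κ a i Fin.< κ a′ i′))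
    from a i a′ i′ ((a<a′ , a′≮a , a≮a′) , lt) =
      inj₁ a<a′ , ((λ eq → IsStrictTotalOrder.irrefl isStrictTotalOrder (≡.cong proj₁ eq) a<a′) , a≮a′ , a′≮a) , lt

  F≋ωXₜ : _≋ω_ R (F R P (Wₜ R P N t β)) (Xₜ R P N t β)
  F≋ωXₜ = F≋ωX (swapInvariant β)
    (λ w → t ^ inv P N w) (λ w → reflexive (≡.cong (t ^_) (inv≡invᴸ w)))
    (λ κ → t ^ asc P N {β} κ) (λ κ adm → reflexive (≡.cong (t ^_) (asc≡ascents κ adm)))

mainTheorem7 : ∀ {c ℓ p q} (R : CommutativeRing c ℓ) (P : FinitePoset p) (β : Multiset P) →
    (_≋ω_ R (F R P (W R P β)) (X R P β)) ×
    ((N : NaturalUnitIntervalOrder q P) (t : CommutativeRing.Carrier R) →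
    _≋ω_ R (F R P (Wₜ R P N t β)) (Xₜ R P N t β))
mainTheorem7 R P β = Unweighted.F≋ωX₁ R P β , λ N t → Weighted.F≋ωXₜ R P β N t
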